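{- Let $w$ be a nonempty word of length $n$ over a finite alphabet, and let $S^\circ(w)$ denote the number of distinct squares of length at most $n$ that occur in $w$ read cyclically. Then \[ S^\circ(w)\le\left\lfloor\frac{3n}{2}\right\rfloor . \]
   Context: A word is a finite sequence of letters from a finite alphabet. A square is a word of the form $xx$ with $x$ a nonempty word. For a word $w$ of length $n\ge 1$, let $W=w^{\mathbb Z}$ be the bi-infinite periodic word indexed by $\mathbb Z$ with $W[1..n]=w$ and $W[i+n]=W[i]$ for all $i\in\mathbb Z$. A factor of $W$ is a finite word $W[i..j]=W[i]W[i+1]\cdots W[j]$. Then $S^\circ(w)$ is the number of distinct words of the form $xx$, with $x$ nonempty and $2|x|\le n$, that are factors of $W$ (so occurrences may cross the boundary between the last and first letters of $w$, and equal square words are counted once). -}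

module Defs where

open import Data.Nat as ℕ using (ℕ; zero; suc; NonZero; ⌊_/2⌋)
import Data.Nat.Properties as ℕₚ
import Data.Nat.Divisibility as ℕ∣
open import Data.Integer as ℤ using (ℤ; +_; 1ℤ; _%ℕ_; _/ℕ_)
import Data.Integer.Properties as ℤₚ
open import Data.Integer.DivMod using (n%ℕd<d; a≡a%ℕn+[a/ℕn]*n)
open import Data.Integer.Solver using (module +-*-Solver)
open import Data.Fin using (Fin; toℕ; fromℕ<)
import Data.Fin.Properties as Finₚ
open import Data.Vec using (Vec; lookup)
open import Data.List using (List; []; _∷_; _++_; length; take; applyUpTo; upTo; filter; deduplicate; cartesianProductWith)
open import Data.List.Properties using (≡-dec; length-++; length-applyUpTo)
open import Data.List.Membership.Propositional using (_∈_)
open import Data.List.Membership.Propositional.Properties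
  using (∈-filter⁺; ∈-filter⁻; ∈-deduplicate⁺; ∈-deduplicate⁻; ∈-upTo⁺; ∈-upTo⁻; ∈-cartesianProductWith⁺; ∈-cartesianProductWith⁻)
open import Data.List.Relation.Unary.Unique.Propositional using (Unique)
import Data.List.Relation.Unary.Unique.DecPropositional.Properties as UniqueDec
open import Data.Product using (∃; ∃₂; _×_; _,_; proj₁; proj₂)
open import Function using (_∘_)
open import Function.Bundles using (_⇔_; mk⇔)
open import Relation.Nullary.Decidable using (map′; _×-dec_; ¬?)
open import Relation.Unary using (Pred; Decidable)
open import Relation.Binary.Definitions using (DecidableEquality)
open import Relation.Binary.PropositionalEquality
open import Level using (0ℓ)

-- The alphabet is Fin k.  Words of the given length n are vectors; words
-- whose length is not fixed in advance are lists.

Word : ℕ → Set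
Word k = List (Fin k)

-- Positions are 1-based, so that W[1..n] = w for W = w ^ℤ.

infix 8 _^ℤ

_^ℤ : ∀ {k n} .{{_ : NonZero n}} → Vec (Fin k) n → ℤ → Fin k
_^ℤ {n = n} w i = lookup w (fromℕ< (n%ℕd<d (i ℤ.- 1ℤ) n))

-- factor W i m = W[i..i+m-1].

factor : ∀ {k} → (ℤ → Fin k) → ℤ → ℕ → Word k
factor W i m = applyUpTo (λ t → W (i ℤ.+ + t)) m

IsFactor : ∀ {k} → (ℤ → Fin k) → Pred (Word k) 0ℓ
IsFactor W u = ∃₂ λ i m → u ≡ factor W i m

IsSquare : ∀ {k} → Pred (Word k) 0ℓ
IsSquare u = ∃ λ x → x ≢ [] × u ≡ x ++ x

IsCyclicSquare : ∀ {k n} .{{_ : NonZero n}} → Vec (Fin k) n → Pred (Word k) 0ℓ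
IsCyclicSquare {n = n} w u = IsSquare u × length u ℕ.≤ n × IsFactor (w ^ℤ) u

-- A finite set presented by a list of its elements without repetition, so that
-- the length of the list is the cardinality of the set.

Enumerates : {A : Set} → Pred A 0ℓ → List A → Set
Enumerates P xs = Unique xs × (∀ u → u ∈ xs ⇔ P u)

-- w ^ℤ is n-periodic and extends w.

private
  ∣r-s∣<n : ∀ {n} r s → r ℕ.< n → s ℕ.< n → ℤ.∣ + r ℤ.- + s ∣ ℕ.< n
  ∣r-s∣<n {n} r s r<n s<n = subst (λ z → ℤ.∣ z ∣ ℕ.< n) (sym (ℤₚ.[+m]-[+n]≡m⊖n r s))
    (ℕₚ.≤-<-trans (ℤₚ.∣m⊝n∣≤m⊔n r s) (ℕₚ.⊔-pres-<m r<n s<n))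

  multiple-small : ∀ {n} z q → z ≡ q ℤ.* + n → ℤ.∣ z ∣ ℕ.< n → z ≡ + 0
  multiple-small {n} z q z≡qn ∣z∣<n =
    ℤₚ.∣i∣≡0⇒i≡0 (zero-of ℤ.∣ z ∣ (trans (cong ℤ.∣_∣ z≡qn) (ℤₚ.abs-* q (+ n))) ∣z∣<n)
    where
    zero-of : ∀ a → a ≡ ℤ.∣ q ∣ ℕ.* n → a ℕ.< n → a ≡ 0
    zero-of zero    _  _   = refl
    zero-of (suc a) eq a<n with () ← ℕ∣.>⇒∤ a<n (ℕ∣.divides ℤ.∣ q ∣ eq)

  %ℕ-unique : ∀ {n} .{{_ : NonZero n}} a r q → r ℕ.< n → a ≡ + r ℤ.+ q ℤ.* + n → a %ℕ n ≡ r
  %ℕ-unique {n} a r q r<n a≡r+qn =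
    ℤₚ.+-injective (ℤₚ.i-j≡0⇒i≡j (+ (a %ℕ n)) (+ r)
      (multiple-small _ (q ℤ.- a /ℕ n) diff (∣r-s∣<n (a %ℕ n) r (n%ℕd<d a n) r<n)))
    where
    open +-*-Solver
    diff : + (a %ℕ n) ℤ.- + r ≡ (q ℤ.- a /ℕ n) ℤ.* + n
    diff = begin
      + (a %ℕ n) ℤ.- + r
        ≡⟨ solve 4 (λ s p r N → s :- r := (s :+ p :* N) :- p :* N :- r) refl (+ (a %ℕ n)) (a /ℕ n) (+ r) (+ n) ⟩
      (+ (a %ℕ n) ℤ.+ a /ℕ n ℤ.* + n) ℤ.- a /ℕ n ℤ.* + n ℤ.- + r
        ≡⟨ cong (λ z → z ℤ.- a /ℕ n ℤ.* + n ℤ.- + r) (trans (sym (a≡a%ℕn+[a/ℕn]*n a n)) a≡r+qn) ⟩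
      (+ r ℤ.+ q ℤ.* + n) ℤ.- a /ℕ n ℤ.* + n ℤ.- + r
        ≡⟨ solve 4 (λ r q p N → (r :+ q :* N) :- p :* N :- r := (q :- p) :* N) refl (+ r) q (a /ℕ n) (+ n) ⟩
      (q ℤ.- a /ℕ n) ℤ.* + n ∎
      where open ≡-Reasoning

^ℤ-extends : ∀ {k n} .{{_ : NonZero n}} (w : Vec (Fin k) n) (j : Fin n) → (w ^ℤ) (1ℤ ℤ.+ + toℕ j) ≡ lookup w j
^ℤ-extends {n = n} w j = cong (lookup w) (trans
  (Finₚ.fromℕ<-cong _ (toℕ j)
    (%ℕ-unique _ (toℕ j) (+ 0) (Finₚ.toℕ<n j)
      (solve 2 (λ t N → con 1ℤ :+ t :- con 1ℤ := t :+ con (+ 0) :* N) refl (+ toℕ j) (+ n)))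
    _ (Finₚ.toℕ<n j))
  (Finₚ.fromℕ<-toℕ j (Finₚ.toℕ<n j)))
  where open +-*-Solver

^ℤ-periodic-* : ∀ {k n} .{{_ : NonZero n}} (w : Vec (Fin k) n) (i q : ℤ) →
                (w ^ℤ) (i ℤ.+ q ℤ.* + n) ≡ (w ^ℤ) i
^ℤ-periodic-* {n = n} w i q = cong (lookup w) (Finₚ.fromℕ<-cong _ _
  (%ℕ-unique _ r (p ℤ.+ q) (n%ℕd<d (i ℤ.- 1ℤ) n) eq) _ _)
  where
  open +-*-Solver
  open ≡-Reasoning
  r = (i ℤ.- 1ℤ) %ℕ n
  p = (i ℤ.- 1ℤ) /ℕ n
  eq : i ℤ.+ q ℤ.* + n ℤ.- 1ℤ ≡ + r ℤ.+ (p ℤ.+ q) ℤ.* + n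
  eq = begin
    i ℤ.+ q ℤ.* + n ℤ.- 1ℤ
      ≡⟨ solve 3 (λ i q N → i :+ q :* N :- con 1ℤ := (i :- con 1ℤ) :+ q :* N) refl i q (+ n) ⟩
    (i ℤ.- 1ℤ) ℤ.+ q ℤ.* + n
      ≡⟨ cong (ℤ._+ q ℤ.* + n) (a≡a%ℕn+[a/ℕn]*n (i ℤ.- 1ℤ) n) ⟩
    (+ r ℤ.+ p ℤ.* + n) ℤ.+ q ℤ.* + n
      ≡⟨ solve 4 (λ r p q N → (r :+ p :* N) :+ q :* N := r :+ (p :+ q) :* N) refl (+ r) p q (+ n) ⟩
    + r ℤ.+ (p ℤ.+ q) ℤ.* + n ∎

^ℤ-periodic : ∀ {k n} .{{_ : NonZero n}} (w : Vec (Fin k) n) (i : ℤ) → (w ^ℤ) (i ℤ.+ + n) ≡ (w ^ℤ) i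
^ℤ-periodic {n = n} w i = trans (cong (λ z → (w ^ℤ) (i ℤ.+ z)) (sym (ℤₚ.*-identityˡ (+ n)))) (^ℤ-periodic-* w i 1ℤ)

private
  applyUpTo-cong : ∀ {A : Set} {f g : ℕ → A} → (∀ t → f t ≡ g t) → ∀ m → applyUpTo f m ≡ applyUpTo g m
  applyUpTo-cong f≗g zero    = refl
  applyUpTo-cong f≗g (suc m) = cong₂ _∷_ (f≗g 0) (applyUpTo-cong (f≗g ∘ suc) m)

  factor-mod : ∀ {k n} .{{_ : NonZero n}} (w : Vec (Fin k) n) i m →
               factor (w ^ℤ) i m ≡ factor (w ^ℤ) (+ (i %ℕ n)) m
  factor-mod {n = n} w i = applyUpTo-cong λ t → begin
    (w ^ℤ) (i ℤ.+ + t)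
      ≡⟨ cong (λ z → (w ^ℤ) (z ℤ.+ + t)) (a≡a%ℕn+[a/ℕn]*n i n) ⟩
    (w ^ℤ) (+ (i %ℕ n) ℤ.+ i /ℕ n ℤ.* + n ℤ.+ + t)
      ≡⟨ cong (w ^ℤ) (solve 4 (λ r p N t → r :+ p :* N :+ t := r :+ t :+ p :* N) refl (+ (i %ℕ n)) (i /ℕ n) (+ n) (+ t)) ⟩
    (w ^ℤ) (+ (i %ℕ n) ℤ.+ + t ℤ.+ i /ℕ n ℤ.* + n)
      ≡⟨ ^ℤ-periodic-* w (+ (i %ℕ n) ℤ.+ + t) (i /ℕ n) ⟩
    (w ^ℤ) (+ (i %ℕ n) ℤ.+ + t) ∎
    where
    open +-*-Solver
    open ≡-Reasoning

  _≟ʷ_ : ∀ {k} → DecidableEquality (Word k)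
  _≟ʷ_ = ≡-dec Finₚ._≟_

  half : ∀ {k} → Word k → Word k
  half u = take ⌊ length u /2⌋ u

  take-length : ∀ {k} (x y : Word k) → take (length x) (x ++ y) ≡ x
  take-length []      y = refl
  take-length (a ∷ x) y = cong (a ∷_) (take-length x y)

  half-++ : ∀ {k} (x : Word k) → half (x ++ x) ≡ x
  half-++ x = trans
    (cong (λ l → take l (x ++ x)) (trans (cong ⌊_/2⌋ (length-++ x)) (sym (ℕₚ.n≡⌊n+n/2⌋ (length x)))))
    (take-length x x)

  isSquare? : ∀ {k} → Decidable (IsSquare {k})
  isSquare? u = map′ (λ p → half u , p) unhalf (¬? (half u ≟ʷ []) ×-dec (u ≟ʷ (half u ++ half u)))
    where
    unhalf : ∀ {u} → IsSquare u → half u ≢ [] × u ≡ half u ++ half u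
    unhalf (x , x≢[] , refl) rewrite half-++ x = x≢[] , refl

-- By periodicity, starting positions 0, …, n - 1 suffice.

cyclicSquares : ∀ {k n} .{{_ : NonZero n}} (w : Vec (Fin k) n) → ∃ (Enumerates (IsCyclicSquare w))
cyclicSquares {k} {n} w = deduplicate _≟ʷ_ squares , UniqueDec.deduplicate-! _≟ʷ_ squares , λ u → mk⇔ sound complete
  where
  W = w ^ℤ

  at : ℕ → ℕ → Word k
  at i m = factor W (+ i) m

  factors squares : List (Word k)
  factors = cartesianProductWith at (upTo n) (upTo (suc n))
  squares = filter isSquare? factors

  sound : ∀ {u} → u ∈ deduplicate _≟ʷ_ squares → IsCyclicSquare w u
  sound u∈ with ∈-filter⁻ isSquare? {xs = factors} (∈-deduplicate⁻ _≟ʷ_ squares u∈)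
  ... | u∈factors , sq with ∈-cartesianProductWith⁻ at (upTo n) (upTo (suc n)) u∈factors
  ...   | i , m , _ , m∈ , refl =
    sq , subst (ℕ._≤ n) (sym (length-applyUpTo _ m)) (ℕₚ.≤-pred (∈-upTo⁻ m∈)) , + i , m , refl

  complete : ∀ {u} → IsCyclicSquare w u → u ∈ deduplicate _≟ʷ_ squares
  complete (sq , len , i , m , refl) = ∈-deduplicate⁺ _≟ʷ_ (∈-filter⁺ isSquare?
    (subst (_∈ factors) (sym (factor-mod w i m))
      (∈-cartesianProductWith⁺ at (∈-upTo⁺ (n%ℕd<d i n))
        (∈-upTo⁺ (ℕ.s≤s (subst (ℕ._≤ n) (length-applyUpTo _ m) len)))))
    sq)

S° : ∀ {k n} .{{_ : NonZero n}} → Vec (Fin k) n → ℕ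
S° w = length (proj₁ (cyclicSquares w))

{-# OPTIONS --safe #-}
module Submission where

-- Let W be the two-sided infinite repetition of w, and call its factors of length l windows;
-- let p(l) be the number of distinct windows of length l.  Suppose first that w is not a
-- proper power, so that n is the least period of W.
--
-- The windows of length l are the vertices, and those of length l + 1 the edges, of a
-- connected graph.  A conjugacy class of primitive words of length d ≤ l all of whose windows
-- of length l + 1 (in the periodic sequence spelled by the class) occur in W forms a cycle of
-- length d in this graph.  From each such cycle delete the edge spelled by the first l + 1
-- letters of the repetition of the least rotation.  A least rotation of a primitive word has
-- no border (least-unbordered), hence the edge lies on no shorter such cycle, and the
-- remaining edges still connect the graph.  Therefore the number of cycles at level l is at
-- most p(l+1) - p(l) + 1 (Graph.cycles-bound).
--
-- The squares whose roots are powers of the words of a class are charged to one level each.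
-- If a class of length d has N such squares and T is the last level at which its cycle is
-- known to exist, they are charged to the levels T - N + 1, …, T; the cycle exists at all
-- levels d, …, T and N + d ≤ T + 1 if N > 0 (topBound).  Summing over the levels 1, …, n - 1
-- shows that W has at most p(n) - p(1) + B squares with roots shorter than n that are counted
-- here, where B is the number of levels at which the bound is attained with only the charged
-- cycles counted (telescope).  The other levels are called good.  As p(n) ≤ n and p(1) ≥ 2, it
-- suffices to show 2 B ≤ n + 4 (notGood-bound) for the squares of length at most n.
--
-- Let L ≥ n / 2 be the last level that is not good.  It must be preceded by (2 L - n - 4) / 2
-- good levels (not-good-late).  Good levels come from long periodic stretches: a class is
-- present but not charged at the levels d, …, T - N, so a stretch of period g with m + g
-- letters makes about (m - 2 g) / 2 levels good (save), and a window that has a period a and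
-- is repeated at distance a + g gives a stretch of period g (run-gap).
--
-- If a window of length L occurs three times within a period, take such occurrences as close
-- together as possible; the difference of two neighbouring distances is then the period of
-- a long stretch (triple-goal).  Otherwise the distances between equal windows of length L
-- are smaller than n - L or greater than L (gap).  If every class charged at L had a run
-- containing its whole cycle, these classes would leave their runs at distinct windows, each
-- of which has two continuations, and L would be good (fullRuns⇒good).  So there is a class,
-- of length d, charged at L whose cycle is spread over several runs (broken-class).  If it has
-- squares whose roots are proper powers, it makes sufficiently many levels good by itself.
-- Otherwise counting the positions of its squares shows that its long runs end at exactly two
-- places (TwoEnds).  W moves between them by two jumps D₁ and D₂ with D₁ + D₂ + d = n, and one
-- of the differences between D₁ or D₂ and d is the period of a long stretch, or two such
-- stretches together are long enough (Around.goal).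
--
-- If w is a proper power and n₀ the least period of W, then at most 2 n₀ ≤ n squares have
-- roots shorter than n₀, because p(n₀) ≤ n₀ and B ≤ n₀.  All other roots are powers of the n₀
-- rotations of the word of length n₀, which gives at most n / 2 squares (power-bound).

open import Defs
open import Data.Nat using (ℕ; NonZero; _*_; _/_; _≤_)
open import Data.Fin using (Fin)
open import Data.Vec using (Vec)

open import Data.Nat hiding (_/_; _%_)
open import Data.Nat.Properties
open import Data.Nat.Induction using (<-rec)
open import Data.Nat.DivMod
open import Data.Nat.Divisibility
open import Data.Nat.Solver using (module +-*-Solver)
open import Data.Integer as ℤ using (ℤ; _%ℕ_; _/ℕ_) renaming (+_ to int)
open import Data.Integer.DivMod using (a≡a%ℕn+[a/ℕn]*n)
import Data.Integer.Solver as ℤSolver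
open import Data.Fin using (toℕ)
open import Data.Fin.Properties using (toℕ-injective; toℕ<n)
import Data.Fin.Properties as Finₚ
open import Data.Empty using (⊥; ⊥-elim)
open import Data.Unit using (⊤; tt)
open import Data.Product using (∃; _×_; _,_; proj₁; proj₂)
open import Data.Sum using (_⊎_; inj₁; inj₂; [_,_]′)
open import Data.List using (List; []; _∷_; _++_; length; map; concatMap; filter; upTo; cartesianProduct; applyUpTo)
open import Data.List.Properties using (length-++; length-map; ∷-injective; length-applyUpTo; length-upTo)
open import Data.List.Membership.Propositional using (_∈_; find; lose)
open import Data.List.Membership.Propositional.Properties
open import Data.List.Relation.Unary.Any as Any using (here; there)
open import Data.List.Relation.Unary.All as All using (All; []; _∷_)
open import Data.List.Relation.Unary.All.Properties using (¬All⇒Any¬)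
open import Data.List.Relation.Unary.AllPairs as AllPairs using ([]; _∷_)
open import Data.List.Relation.Unary.Unique.Propositional using (Unique)
import Data.List.Relation.Unary.Unique.Propositional.Properties as Uniqueₚ
open import Function.Bundles using (Equivalence)
open import Relation.Nullary using (Dec; yes; no; ¬_)
open import Relation.Nullary.Decidable using (_×-dec_; _⊎-dec_; ¬?; map′; decidable-stable)
open import Relation.Binary.Definitions using (DecidableEquality; Tri; tri<; tri≈; tri>)
open import Relation.Binary.PropositionalEquality
open +-*-Solver using (solve; _:=_; _:+_; _:*_; con)

-- Linear arithmetic

-- A linear inequality l ≤ r is derived from known inequalities by adding them, with
-- repetitions, to one inequality X ≤ Y with _⊞_; then l + Y + s = r + X for a slack s,
-- an identity of polynomials.  lin₀ is the case without premises, and lin⊥ the case in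
-- which the sum of the premises is absurd.
infixl 6 _⊞_
_⊞_ : ∀ {a b c d} → a ≤ b → c ≤ d → a + c ≤ b + d
_⊞_ = +-mono-≤

lin₀ : ∀ {l r} s → l + s ≡ r → l ≤ r
lin₀ {l} s e = subst (l ≤_) e (m≤m+n l s)

lin : ∀ {X Y l r} s → X ≤ Y → l + Y + s ≡ r + X → l ≤ r
lin {X} {Y} {l} {r} s p e =
  +-cancelʳ-≤ X l r (≤-trans (+-monoʳ-≤ l p) (subst (l + Y ≤_) e (m≤m+n (l + Y) s)))

lin⊥ : ∀ {X Y} s → X ≤ Y → Y + suc s ≡ X → ⊥
lin⊥ {X} {Y} s p e = <-irrefl refl (<-≤-trans (subst (Y <_) e (m<m+n Y z<s)) p)

m≤n⇒∃[o]o+m≡n : ∀ {m n} → m ≤ n → ∃ λ o → o + m ≡ n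
m≤n⇒∃[o]o+m≡n {m} m≤n with m≤n⇒∃[o]m+o≡n m≤n
... | o , e = o , trans (+-comm o m) e

-- Pigeonhole and counting

-- The pigeonhole principle along a relation: if every element of xs is related to some
-- element of ys, and no element of ys to two elements of xs, then xs is not longer.
injection-length : ∀ {A B : Set} {xs : List A} {ys : List B} (R : A → B → Set) → Unique xs →
  (∀ {x} → x ∈ xs → ∃ λ y → y ∈ ys × R x y) → (∀ {x x′ y} → x ∈ xs → x′ ∈ xs → R x y → R x′ y → x ≡ x′) →
  length xs ≤ length ys
injection-length {xs = []} R u f inj = z≤n
injection-length {xs = x ∷ xs} {ys} R (x∉ ∷ u) f inj with f (here refl)
... | y , y∈ , rxy with ∈-∃++ y∈
... | as , bs , refl = subst (suc (length xs) ≤_) (sym len)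
      (s≤s (injection-length R u f′ λ p q → inj (there p) (there q)))
  where
  len : length (as ++ y ∷ bs) ≡ suc (length (as ++ bs))
  len = trans (length-++ as) (trans (+-suc (length as) (length bs)) (cong suc (sym (length-++ as))))
  f′ : ∀ {z} → z ∈ xs → ∃ λ y′ → y′ ∈ as ++ bs × R z y′
  f′ z∈ with f (there z∈)
  ... | y′ , y′∈ , r with ∈-++⁻ as y′∈
  ... | inj₁ p = y′ , ∈-++⁺ˡ p , r
  ... | inj₂ (there p) = y′ , ∈-++⁺ʳ as p , r
  ... | inj₂ (here refl) = ⊥-elim (All.lookup x∉ z∈ (inj (here refl) (there z∈) rxy r))

-- The numbers below n with a decidable property (sel), and how many there are (count).
module _ {P : ℕ → Set} (P? : ∀ i → Dec (P i)) where

  sel : ℕ → List ℕ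
  sel zero = []
  sel (suc n) with P? n
  ... | yes _ = n ∷ sel n
  ... | no  _ = sel n

  count : ℕ → ℕ
  count n = length (sel n)

  ∈-sel⁻ : ∀ {n x} → x ∈ sel n → x < n × P x
  ∈-sel⁻ {suc n} x∈ with P? n
  ∈-sel⁻ {suc n} (here refl) | yes p = ≤-refl , p
  ∈-sel⁻ {suc n} (there x∈)  | yes _ = m<n⇒m<1+n (proj₁ (∈-sel⁻ x∈)) , proj₂ (∈-sel⁻ {n} x∈)
  ... | no _ = m<n⇒m<1+n (proj₁ (∈-sel⁻ {n} x∈)) , proj₂ (∈-sel⁻ {n} x∈)

  ∈-sel⁺ : ∀ {n x} → x < n → P x → x ∈ sel n
  ∈-sel⁺ {suc n} {x} x<n px with P? n | x ≟ n
  ... | yes _  | yes refl = here refl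
  ... | yes _  | no x≢n   = there (∈-sel⁺ (≤∧≢⇒< (≤-pred x<n) x≢n) px)
  ... | no ¬p  | yes refl = ⊥-elim (¬p px)
  ... | no _   | no x≢n   = ∈-sel⁺ (≤∧≢⇒< (≤-pred x<n) x≢n) px

  sel-unique : ∀ n → Unique (sel n)
  sel-unique zero = []
  sel-unique (suc n) with P? n
  ... | yes _ = All.tabulate (λ {x} x∈ n≡x → <-irrefl (sym n≡x) (proj₁ (∈-sel⁻ x∈))) ∷ sel-unique n
  ... | no  _ = sel-unique n

  count≤ : ∀ n → count n ≤ n
  count≤ zero = z≤n
  count≤ (suc n) with P? n
  ... | yes _ = s≤s (count≤ n)
  ... | no  _ = m≤n⇒m≤1+n (count≤ n)

  count-suc-yes : ∀ {n} → P n → count (suc n) ≡ suc (count n)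
  count-suc-yes {n} p with P? n
  ... | yes _ = refl
  ... | no ¬p = ⊥-elim (¬p p)

  count-suc-no : ∀ {n} → ¬ P n → count (suc n) ≡ count n
  count-suc-no {n} ¬p with P? n
  ... | yes p = ⊥-elim (¬p p)
  ... | no _  = refl

  count-mono-suc : ∀ n → count n ≤ count (suc n)
  count-mono-suc n with P? n
  ... | yes _ = n≤1+n _
  ... | no  _ = ≤-refl

  count-all : ∀ a m → (∀ t → t < m → P (a + t)) → count (a + m) ≡ count a + m
  count-all a zero h = trans (cong count (+-identityʳ a)) (sym (+-identityʳ _))
  count-all a (suc m) h = trans (cong count (+-suc a m)) (trans (count-suc-yes (h m ≤-refl))
    (trans (cong suc (count-all a m λ t t<m → h t (m<n⇒m<1+n t<m))) (sym (+-suc _ m))))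

  count-none : ∀ a m → (∀ t → t < m → ¬ P (a + t)) → count (a + m) ≡ count a
  count-none a zero h = cong count (+-identityʳ a)
  count-none a (suc m) h = trans (cong count (+-suc a m)) (trans (count-suc-no (h m ≤-refl))
    (count-none a m λ t t<m → h t (m<n⇒m<1+n t<m)))

  count-mono : ∀ {a b} → a ≤ b → count a ≤ count b
  count-mono {a} a≤b with m≤n⇒∃[o]m+o≡n a≤b
  ... | m , refl = go m
    where
    go : ∀ m → count a ≤ count (a + m)
    go zero = ≤-reflexive (cong count (sym (+-identityʳ a)))
    go (suc m) = ≤-trans (go m) (subst (λ z → count (a + m) ≤ count z) (sym (+-suc a m)) (count-mono-suc (a + m)))

  -- The least solution up to a known one, and the greatest solution below a bound.
  least : ∀ n → P n → ∃ λ m → m ≤ n × P m × (∀ i → i < m → ¬ P i)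
  least n = <-rec (λ n → P n → ∃ λ m → m ≤ n × P m × (∀ i → i < m → ¬ P i)) step n
    where
    step : ∀ n → (∀ {i} → i < n → P i → ∃ λ m → m ≤ i × P m × (∀ i → i < m → ¬ P i)) →
           P n → ∃ λ m → m ≤ n × P m × (∀ i → i < m → ¬ P i)
    step n rec pn with anyUpTo? P? n
    ... | no ¬p = n , ≤-refl , pn , λ i i<n pi → ¬p (i , i<n , pi)
    ... | yes (i , i<n , pi) with rec i<n pi
    ... | m , m≤i , rest = m , ≤-trans m≤i (<⇒≤ i<n) , rest

  greatest : ∀ n → (∃ λ m → m < n × P m × (∀ i → m < i → i < n → ¬ P i)) ⊎ (∀ i → i < n → ¬ P i)
  greatest zero = inj₂ λ i ()
  greatest (suc n) with P? n
  ... | yes p = inj₁ (n , ≤-refl , p , λ i n<i i<sn → ⊥-elim (<⇒≱ n<i (≤-pred i<sn)))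
  ... | no ¬p with greatest n
  ... | inj₁ (m , m<n , pm , max) = inj₁ (m , m<n⇒m<1+n m<n , pm , λ i m<i i<sn pi →
          max i m<i (≤∧≢⇒< (≤-pred i<sn) λ { refl → ¬p pi }) pi)
  ... | inj₂ none = inj₂ λ i i<sn pi → none i (≤∧≢⇒< (≤-pred i<sn) λ { refl → ¬p pi }) pi

count-inj : ∀ {P Q : ℕ → Set} (P? : ∀ i → Dec (P i)) (Q? : ∀ i → Dec (Q i)) {m n} (R : ℕ → ℕ → Set) →
  (∀ {i} → i < m → P i → ∃ λ j → j < n × Q j × R i j) → (∀ {i i′ j} → i < m → i′ < m → R i j → R i′ j → i ≡ i′) →
  count P? m ≤ count Q? n
count-inj P? Q? {m} {n} R f inj = injection-length R (sel-unique P? m)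
  (λ x∈ → let (x<m , px) = ∈-sel⁻ P? x∈ ; (y , y<n , qy , r) = f x<m px in y , ∈-sel⁺ Q? y<n qy , r)
  (λ x∈ x′∈ → inj (proj₁ (∈-sel⁻ P? x∈)) (proj₁ (∈-sel⁻ P? x′∈)))

count-⊆ : ∀ {P Q : ℕ → Set} (P? : ∀ i → Dec (P i)) (Q? : ∀ i → Dec (Q i)) n → (∀ i → i < n → P i → Q i) →
  count P? n ≤ count Q? n
count-⊆ P? Q? n f = count-inj P? Q? _≡_ (λ {i} i<n pi → i , i<n , f i i<n pi , refl) λ { _ _ refl refl → refl }

count-split : ∀ {P Q : ℕ → Set} (P? : ∀ i → Dec (P i)) (Q? : ∀ i → Dec (Q i)) n →
  count (λ i → P? i ×-dec Q? i) n + count (λ i → P? i ×-dec ¬? (Q? i)) n ≡ count P? n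
count-split P? Q? zero = refl
count-split P? Q? (suc n) with P? n | Q? n
... | yes _ | yes _ = cong suc (count-split P? Q? n)
... | yes _ | no _  = trans (+-suc _ _) (cong suc (count-split P? Q? n))
... | no _  | yes _ = count-split P? Q? n
... | no _  | no _  = count-split P? Q? n

count-disjoint : ∀ {P Q : ℕ → Set} (P? : ∀ i → Dec (P i)) (Q? : ∀ i → Dec (Q i)) n → (∀ i → P i → ¬ Q i) →
  count P? n + count Q? n ≤ count (λ i → P? i ⊎-dec Q? i) n
count-disjoint P? Q? zero h = z≤n
count-disjoint P? Q? (suc n) h with P? n | Q? n
... | yes p | yes q = ⊥-elim (h n p q)
... | yes _ | no _  = s≤s (count-disjoint P? Q? n h)
... | no _  | yes _ = ≤-trans (≤-reflexive (+-suc _ _)) (s≤s (count-disjoint P? Q? n h))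
... | no _  | no _  = count-disjoint P? Q? n h

count-positive : ∀ {P : ℕ → Set} (P? : ∀ i → Dec (P i)) n → 0 < count P? n → ∃ λ i → i < n × P i
count-positive P? n pos = pick (sel P? n) pos λ x∈ → x∈
  where
  pick : ∀ xs → 0 < length xs → (∀ {x} → x ∈ xs → x ∈ sel P? n) → ∃ λ i → i < n × _
  pick (x ∷ xs) _ sub = x , ∈-sel⁻ P? (sub (here refl))

-- A finite connected graph with vertices V and edges E has at most one more vertex than
-- edges.  Connectedness is used in the form: a function that is constant along the edges
-- is constant on V.
connected-bound : (V : List ℕ) (E : List (ℕ × ℕ)) → Unique V →
  (∀ (f : ℕ → ℕ) → (∀ {a b} → (a , b) ∈ E → f a ≡ f b) → ∀ {x y} → x ∈ V → y ∈ V → f x ≡ f y) →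
  length V ≤ length E + 1
connected-bound V E uV conn = go (labels E)
  where
  -- A labelling constant along E that takes at least length V - length E values on V, the
  -- values being listed by ys; a further edge merges at most two values into one.
  Labels : List (ℕ × ℕ) → Set
  Labels E = ∃ λ (f : ℕ → ℕ) → (∀ {a b} → (a , b) ∈ E → f a ≡ f b) ×
    (∃ λ (ys : List ℕ) → Unique ys × (∀ {y} → y ∈ ys → ∃ λ x → x ∈ V × f x ≡ y) × length V ≤ length E + length ys)

  remove : ∀ c (ys : List ℕ) → Unique ys → ∃ λ zs → Unique zs × (∀ {z} → z ∈ zs → z ∈ ys × z ≢ c) × length ys ≤ suc
      (length zs)
  remove c [] u = [] , [] , (λ ()) , z≤n
  remove c (y ∷ ys) (y∉ ∷ u) with y ≟ c
  ... | yes refl = ys , u , (λ z∈ → there z∈ , λ { refl → All.lookup y∉ z∈ refl }) , ≤-refl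
  ... | no y≢c with remove c ys u
  ... | zs , uz , sub , len = y ∷ zs , All.tabulate (λ z∈ → All.lookup y∉ (proj₁ (sub z∈))) ∷ uz ,
        (λ { (here refl) → here refl , y≢c ; (there z∈) → there (proj₁ (sub z∈)) , proj₂ (sub z∈) }) , s≤s len

  labels : ∀ E → Labels E
  labels [] = (λ x → x) , (λ ()) , V , uV , (λ {y} y∈ → y , y∈ , refl) , ≤-refl
  labels ((a , b) ∷ E) with labels E
  ... | f , resp , ys , uy , img , len with remove (f b) ys uy
  ... | zs , uz , sub , len′ = g , resp′ , zs , uz , img′ ,
        (lin 0 (len ⊞ len′) (solve 4 (λ a b c d → a :+ (b :+ c :+ (con 1 :+ d)) :+ con 0 := con
            1 :+ b :+ d :+ (a :+ c)) refl (length V) (length E) (length ys) (length zs)))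
    where
    h : ℕ → ℕ
    h y with y ≟ f b
    ... | yes _ = f a
    ... | no  _ = y
    g : ℕ → ℕ
    g x = h (f x)
    h-b : h (f b) ≡ f a
    h-b with f b ≟ f b
    ... | yes _ = refl
    ... | no ¬p = ⊥-elim (¬p refl)
    h-a : h (f a) ≡ f a
    h-a with f a ≟ f b
    ... | yes _ = refl
    ... | no  _ = refl
    h-other : ∀ {y} → y ≢ f b → h y ≡ y
    h-other {y} y≢ with y ≟ f b
    ... | yes e = ⊥-elim (y≢ e)
    ... | no  _ = refl
    resp′ : ∀ {c e} → (c , e) ∈ (a , b) ∷ E → g c ≡ g e
    resp′ (here refl) = trans h-a (sym h-b)
    resp′ (there p)   = cong h (resp p)
    img′ : ∀ {z} → z ∈ zs → ∃ λ x → x ∈ V × g x ≡ z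
    img′ z∈ with img (proj₁ (sub z∈))
    ... | x , x∈ , refl = x , x∈ , h-other (proj₂ (sub z∈))

  go : Labels E → length V ≤ length E + 1
  go (f , resp , ys , uy , img , len) = ≤-trans len (+-monoʳ-≤ (length E) (one ys uy img))
    where
    one : ∀ ys → Unique ys → (∀ {y} → y ∈ ys → ∃ λ x → x ∈ V × f x ≡ y) → length ys ≤ 1
    one [] _ _ = z≤n
    one (y ∷ []) _ _ = ≤-refl
    one (y ∷ z ∷ ys) ((y≢z ∷ _) ∷ _) img with img (here refl) | img (there (here refl))
    ... | x , x∈ , refl | x′ , x′∈ , refl = ⊥-elim (y≢z (conn f resp x∈ x′∈))

-- Sums of a function over a list and over the numbers below a bound.
sumOver : {A : Set} → (A → ℕ) → List A → ℕ
sumOver f [] = 0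
sumOver f (x ∷ xs) = f x + sumOver f xs

sumBelow : (ℕ → ℕ) → ℕ → ℕ
sumBelow f zero = 0
sumBelow f (suc n) = f n + sumBelow f n

sumBelow-+ : ∀ (f g : ℕ → ℕ) n → sumBelow (λ l → f l + g l) n ≡ sumBelow f n + sumBelow g n
sumBelow-+ f g zero = refl
sumBelow-+ f g (suc n) = trans (cong (f n + g n +_) (sumBelow-+ f g n))
  (solve 4 (λ a b c d → a :+ b :+ (c :+ d) := a :+ c :+ (b :+ d)) refl (f n) (g n) (sumBelow f n) (sumBelow g n))

indicator : {P : Set} → Dec P → ℕ
indicator (yes _) = 1
indicator (no  _) = 0

sumBelow-indicator : ∀ {P : ℕ → Set} (P? : ∀ i → Dec (P i)) n → sumBelow (λ i → indicator (P? i)) n ≡ count P? n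
sumBelow-indicator P? zero = refl
sumBelow-indicator P? (suc n) with P? n
... | yes _ = cong suc (sumBelow-indicator P? n)
... | no  _ = sumBelow-indicator P? n

-- Counting the pairs (l , x) with l < n, x in xs and Q l x by rows or by columns.
double-count : ∀ {A : Set} {Q : ℕ → A → Set} (Q? : ∀ l x → Dec (Q l x)) (xs : List A) n →
  sumBelow (λ l → length (filter (Q? l) xs)) n ≡ sumOver (λ x → count (λ l → Q? l x) n) xs
double-count Q? [] n = zeros n
  where
  zeros : ∀ n → sumBelow (λ _ → 0) n ≡ 0
  zeros zero = refl
  zeros (suc n) = zeros n
double-count Q? (x ∷ xs) n = trans (pointwise n) (trans (sumBelow-+ _ _ n)
  (cong₂ _+_ (sumBelow-indicator (λ l → Q? l x) n) (double-count Q? xs n)))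
  where
  one : ∀ l → length (filter (Q? l) (x ∷ xs)) ≡ indicator (Q? l x) + length (filter (Q? l) xs)
  one l with Q? l x
  ... | yes _ = refl
  ... | no  _ = refl
  pointwise : ∀ n → sumBelow (λ l → length (filter (Q? l) (x ∷ xs))) n ≡ sumBelow (λ l → indicator (Q? l x) + length
      (filter (Q? l) xs)) n
  pointwise zero = refl
  pointwise (suc n) = cong₂ _+_ (one n) (pointwise n)

length-concatMap : ∀ {A B : Set} (f : A → List B) xs → length (concatMap f xs) ≡ sumOver (λ x → length (f x)) xs
length-concatMap f [] = refl
length-concatMap f (x ∷ xs) = trans (length-++ (f x)) (cong (length (f x) +_) (length-concatMap f xs))

-- Remainders

%-absorb : ∀ d .{{_ : NonZero d}} s t → (s % d + t) % d ≡ (s + t) % d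
%-absorb d s t = trans (sym ([m+kn]%n≡m%n (s % d + t) (s / d) d))
  (cong (_% d) (trans (solve 3 (λ x y z → x :+ y :+ z := x :+ z :+ y) refl (s % d) t (s / d * d))
    (cong (_+ t) (sym (m≡m%n+[m/n]*n s d)))))

%-complement : ∀ d .{{_ : NonZero d}} o → (o + (d ∸ o % d)) % d ≡ 0 % d
%-complement d o = trans (sym (%-absorb d o (d ∸ o % d))) (trans (cong (_% d) (m+[n∸m]≡n (<⇒≤ (m%n<n o d))))
    ([m+n]%n≡m%n 0 d))

%-≡⇒∣ : ∀ d .{{_ : NonZero d}} x δ → (x + δ) % d ≡ x % d → d ∣ δ
%-≡⇒∣ d x δ e = ∣m+n∣m⇒∣n (subst (d ∣_) eq (n∣m*n ((x + δ) / d))) (n∣m*n (x / d))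
  where
  eq : (x + δ) / d * d ≡ x / d * d + δ
  eq = +-cancelˡ-≡ (x % d) _ _ (trans (cong (_+ (x + δ) / d * d) (sym e)) (trans (sym (m≡m%n+[m/n]*n (x + δ) d))
    (trans (cong (_+ δ) (m≡m%n+[m/n]*n x d)) (+-assoc (x % d) (x / d * d) δ))))

∣∧<⇒≡0 : ∀ {d δ} → d ∣ δ → δ < d → δ ≡ 0
∣∧<⇒≡0 {d} {zero} _ _ = refl
∣∧<⇒≡0 {d} {suc δ} d∣δ δ<d = ⊥-elim (<⇒≱ δ<d (∣⇒≤ d∣δ))

%-injective : ∀ d .{{_ : NonZero d}} a {x y} → x < d → y < d → (x + a) % d ≡ (y + a) % d → x ≡ y
%-injective d a {x} {y} x<d y<d e with ≤-total x y
... | inj₁ x≤y with m≤n⇒∃[o]m+o≡n x≤y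
... | δ , refl = sym (trans
    (cong (x +_) (∣∧<⇒≡0 {d}
    (%-≡⇒∣ d (x + a) δ (trans (cong (_% d) (solve 3 (λ x a z → x :+ a :+ z := x :+ z :+ a) refl x a δ)) (sym e)))
    (≤-<-trans (m≤n+m δ x) y<d))) (+-identityʳ x))
%-injective d a {x} {y} x<d y<d e | inj₂ y≤x with m≤n⇒∃[o]m+o≡n y≤x
... | δ , refl = trans (cong (y +_)
    (∣∧<⇒≡0 {d} (%-≡⇒∣ d (y + a) δ (trans (cong (_% d) (solve 3 (λ x a z → x :+ a :+ z := x :+ z :+ a) refl y a δ))
    e)) (≤-<-trans (m≤n+m δ y) x<d))) (+-identityʳ y)

multiple-once : ∀ {d x} → d ∣ x → 0 < x → x < 2 * d → x ≡ d
multiple-once {d} (divides zero refl) pos lt = ⊥-elim (<-irrefl refl pos)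
multiple-once {d} (divides (suc zero) refl) pos lt = +-identityʳ d
multiple-once {d} (divides (suc (suc q)) refl) pos lt = ⊥-elim
    (<⇒≱ lt (lin₀ (q * d) (solve 2 (λ a b → con 2 :* a :+ b := a :+ (a :+ b)) refl d (q * d))))

-- Periods, primitive words and least rotations

module _ {A : Set} where

  -- The first m letters of f have period p.
  Period : (ℕ → A) → ℕ → ℕ → Set
  Period f p m = ∀ t → t + p < m → f t ≡ f (t + p)

  Period-≤ : ∀ {f p m m′} → m′ ≤ m → Period f p m → Period f p m′
  Period-≤ m′≤m P t h = P t (<-≤-trans h m′≤m)

  Period-% : ∀ {f g m} .{{_ : NonZero g}} → Period f g m → ∀ t → t < m → f t ≡ f (t % g)
  Period-% {f} {g} {m} P = <-rec (λ t → t < m → f t ≡ f (t % g)) step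
    where
    step : ∀ t → (∀ {s} → s < t → s < m → f s ≡ f (s % g)) → t < m → f t ≡ f (t % g)
    step t rec t<m with t <? g
    ... | yes t<g = cong f (sym (m<n⇒m%n≡m t<g))
    ... | no t≮g with m≤n⇒∃[o]o+m≡n (≮⇒≥ t≮g)
    ... | s , refl = trans (sym (P s t<m))
          (trans (rec (m<m+n s (>-nonZero⁻¹ g)) (≤-<-trans (m≤m+n s g) t<m)) (cong f (sym ([m+n]%n≡m%n s g))))

  Period-of-% : ∀ {f g m} .{{_ : NonZero g}} → (∀ t → t < m → f t ≡ f (t % g)) → Period f g m
  Period-of-% {f} {g} h t lt = trans (h t (≤-<-trans (m≤m+n t g) lt))
    (trans (cong f (sym ([m+n]%n≡m%n t g))) (sym (h (t + g) lt)))

  %-shift : ∀ {g} s q .{{_ : NonZero g}} → (s + q * g) % g ≡ s % g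
  %-shift {g} s q = [m+kn]%n≡m%n s q g

  -- A word with a period a that has, on a prefix of length at least a, a period dividing a
  -- has the latter period throughout.
  Period-extend : ∀ {f a g L M} → 0 < g → 0 < a → g ∣ a → a ≤ L → Period f a M → Period f g L → Period f g M
  Period-extend {f} {a} {g} {L} {M} 0<g 0<a (divides q a≡qg) a≤L Pa Pg = Period-of-%
      (<-rec (λ t → t < M → f t ≡ f (t % g)) step)
    where
    instance _ = >-nonZero 0<g
    step : ∀ t → (∀ {s} → s < t → s < M → f s ≡ f (s % g)) → t < M → f t ≡ f (t % g)
    step t rec t<M with t <? L
    ... | yes t<L = Period-% Pg t t<L
    ... | no t≮L with m≤n⇒∃[o]o+m≡n (≤-trans a≤L (≮⇒≥ t≮L))
    ... | s , refl = trans (sym (Pa s t<M)) (trans (rec (m<m+n s 0<a) (≤-<-trans (m≤m+n s _) t<M))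
          (cong f (trans (sym (%-shift s q)) (cong (λ z → (s + z) % g) (sym a≡qg)))))

  -- The theorem of Fine and Wilf in the weak form that asks for a + b letters: two periods a
  -- and b of such a word have a common divisor that is a period.
  fine-wilf : ∀ {f m} a b → 0 < a → 0 < b → a + b ≤ m → Period f a m → Period f b m →
              ∃ λ g → 0 < g × g ∣ a × g ∣ b × Period f g m
  fine-wilf {f} a b = <-rec FW step (a + b) a b refl
    where
    FW : ℕ → Set
    FW s = ∀ a b → a + b ≡ s → ∀ {m} → 0 < a → 0 < b → a + b ≤ m → Period f a m → Period f b m →
              ∃ λ g → 0 < g × g ∣ a × g ∣ b × Period f g m
    -- The case b = a + e: the last m - a letters and the first m - a letters agree, so the
    -- prefix of that length has periods a and e.
    reduce : ∀ a e → 0 < a → 0 < e → (∀ {m} → a + e ≤ m → Period f a m → Period f e m → ∃ λ g → 0 < g × g ∣ a × g ∣ e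
        × Period f g m) →
             ∀ {m} → a + (a + e) ≤ m → Period f a m → Period f (a + e) m → ∃ λ g → 0 < g × g ∣ a × g ∣ a + e × Period
                 f g m
    reduce a e 0<a 0<e rec {m} le Pa Pb with m≤n⇒∃[o]m+o≡n {a} {m}
        (≮⇒≥ (λ h₋ → lin⊥ (e + m + 1) (le ⊞ h₋ ⊞ h₋) (solve 3 (λ a b c → a :+ b :+ b :+ (con 1 :+ (c :+ a :+ con 1))
        := b :+ (b :+ c) :+ (con 1 :+ a) :+ (con 1 :+ a)) refl m a e)))
    ... | m′ , refl with rec {m′}
        (lin 0 (le) (solve 3 (λ a b c → a :+ b :+ (a :+ c) :+ con 0 := c :+ (a :+ (a :+ b))) refl a e m′))
        (Period-≤ (m≤n+m m′ a) Pa) Pe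
      where
      Pe : Period f e m′
      Pe t lt = trans (Pb t (lin 0 (lt) (solve 4 (λ a b c d → con 1 :+ (a :+ (b :+ c)) :+ d :+ con 0 :=
          b :+ d :+ (con 1 :+ (a :+ c))) refl t a e m′)))
          (sym (trans (Pa (t + e)
          (lin 0 (lt) (solve 4 (λ a b c d → con 1 :+ (a :+ b :+ c) :+ d :+ con 0 := c :+ d :+ (con 1 :+ (a :+ b)))
          refl t e a m′)))
        (cong f (solve 3 (λ t a e → t :+ e :+ a := t :+ (a :+ e)) refl t a e))))
    ... | g , 0<g , g∣a , g∣e , Pg = g , 0<g , g∣a , ∣m∣n⇒∣m+n g∣a g∣e ,
          Period-extend 0<g 0<a g∣a (lin e (le) (solve 3 (λ a b c → a :+ (a :+ b) :+ c := b :+ (a :+ (a :+ c))) refl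
              a m′ e)) Pa Pg
    step : ∀ s → (∀ {s′} → s′ < s → FW s′) → FW s
    step s rec a b refl {m} 0<a 0<b le Pa Pb with <-cmp a b
    ... | tri≈ _ refl _ = a , 0<a , ∣-refl , ∣-refl , Pa
    ... | tri< a<b _ _ with m≤n⇒∃[o]m+o≡n (<⇒≤ a<b)
    ... | e , refl = reduce a e 0<a 0<e
        (λ {m} → rec (lin 0 (0<a) (solve 2 (λ a b → con 1 :+ (a :+ b) :+ a :+ con 0 := a :+ (a :+ b) :+ (con 1 :+ con
        0)) refl a e)) a e refl {m} 0<a 0<e) le Pa Pb
      where
      0<e : 0 < e
      0<e = (lin 0 (a<b) (solve 2 (λ a b → con 1 :+ con 0 :+ (a :+ b) :+ con 0 := b :+ (con 1 :+ a)) refl a e))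
    step s rec a b refl {m} 0<a 0<b le Pa Pb | tri> _ _ b<a with m≤n⇒∃[o]m+o≡n (<⇒≤ b<a)
    ... | e , refl with reduce b e 0<b 0<e
        (λ {m} → rec (lin 0 (0<b) (solve 2 (λ a b → con 1 :+ (a :+ b) :+ a :+ con 0 := a :+ b :+ a :+ (con 1 :+ con
        0)) refl b e)) b e refl {m} 0<b 0<e)
        (lin 0 (le) (solve 3 (λ a b c → a :+ (a :+ b) :+ c :+ con 0 := c :+ (a :+ b :+ a)) refl b e m)) Pb Pa
      where
      0<e : 0 < e
      0<e = (lin 0 (b<a) (solve 2 (λ a b → con 1 :+ con 0 :+ (a :+ b) :+ con 0 := b :+ (con 1 :+ a)) refl b e))
    ... | g , 0<g , g∣b , g∣a , Pg = g , 0<g , g∣a , g∣b , Pg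

  -- The first d letters of f are not a proper power.
  Primitive : (ℕ → A) → ℕ → Set
  Primitive f d = ∀ g → 0 < g → g < d → g ∣ d → ¬ Period f g d

  Primitive-cong : ∀ {f f′ : ℕ → A} {d} → (∀ t → t < d → f t ≡ f′ t) → Primitive f d → Primitive f′ d
  Primitive-cong h pr g 0<g g<d g∣d P = pr g 0<g g<d g∣d λ t lt →
    trans (h t (≤-<-trans (m≤m+n t g) lt)) (trans (P t lt) (sym (h (t + g) lt)))

  -- A primitive period d divides every period e of the same word, provided that the word has
  -- at least d + e letters.
  primitive-divides : ∀ {f d e m} → 0 < d → 0 < e → Primitive f d → d + e ≤ m → Period f d m → Period f e m → d ∣ e
  primitive-divides {f} {d} {e} {m} 0<d 0<e pr le Pd Pe with fine-wilf d e 0<d 0<e le Pd Pe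
  ... | g , 0<g , g∣d , g∣e , Pg with g <? d
  ... | yes g<d = ⊥-elim (pr g 0<g g<d g∣d
      (Period-≤ (lin e (le) (solve 3 (λ a b c → a :+ b :+ c := b :+ (a :+ c)) refl d m e)) Pg))
  ... | no g≮d = subst (_∣ e) (≤-antisym (∣⇒≤ {{>-nonZero 0<d}} g∣d) (≮⇒≥ g≮d)) g∣e

  abstract
    Period? : DecidableEquality A → ∀ f p m → Dec (Period f p m)
    Period? _≟ᴬ_ f p m with allUpTo? (λ t → dec t) m
      where
      dec : ∀ t → Dec (t + p < m → f t ≡ f (t + p))
      dec t with t + p <? m | f t ≟ᴬ f (t + p)
      ... | yes lt | yes e = yes λ _ → e
      ... | yes lt | no ¬e = no λ h → ¬e (h lt)
      ... | no ¬lt | _     = yes λ lt → ⊥-elim (¬lt lt)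
    ... | yes h = yes λ t lt → h (≤-<-trans (m≤m+n t p) lt) lt
    ... | no ¬h = no λ P → ¬h λ {t} _ lt → P t lt

  -- The primitive root of the word formed by the first d letters of f.
  primitive-root : DecidableEquality A → ∀ f d → 0 < d → ∃ λ g → 0 < g × g ∣ d × Period f g d × Primitive f g
  primitive-root _≟ᴬ_ f d 0<d with least root? d (0<d , ∣-refl , λ t lt → ⊥-elim (<⇒≱ lt (m≤n+m d t)))
    where
    root? : ∀ g → Dec (0 < g × g ∣ d × Period f g d)
    root? g = (0 <? g) ×-dec ((g ∣? d) ×-dec Period? _≟ᴬ_ f g d)
  ... | g , _ , (0<g , g∣d , Pg) , min = g , 0<g , g∣d , Pg , λ e 0<e e<g e∣g Pe →
        min e e<g (0<e , ∣-trans e∣g g∣d , Period-extend 0<e 0<g e∣g ≤-refl Pg Pe)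

module _ {k : ℕ} where

  -- The first m letters of f read as a number in base k.  For words of equal length the
  -- order of these values is the lexicographic order.
  val : (ℕ → Fin k) → ℕ → ℕ
  val f zero = 0
  val f (suc m) = val f m * k + toℕ (f m)

  val-cong : ∀ {f g} m → (∀ t → t < m → f t ≡ g t) → val f m ≡ val g m
  val-cong zero h = refl
  val-cong (suc m) h = cong₂ (λ x y → x * k + toℕ y) (val-cong m λ t t<m → h t (m<n⇒m<1+n t<m)) (h m ≤-refl)

  val-+ : ∀ f a b → val f (a + b) ≡ val f a * k ^ b + val (λ t → f (a + t)) b
  val-+ f a zero = trans (cong (val f) (+-identityʳ a)) (solve 1 (λ x → x := x :* con 1 :+ con 0) refl (val f a))
  val-+ f a (suc b) = trans (cong (val f) (+-suc a b)) (trans (cong (λ z → z * k + toℕ (f (a + b))) (val-+ f a b))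
    (solve 5 (λ x p y k c → (x :* p :+ y) :* k :+ c := x :* (k :* p) :+ (y :* k :+ c)) refl (val f a) (k ^ b)
        (val (λ t → f (a + t)) b) k (toℕ (f (a + b)))))

  digit-unique : ∀ x y {r s} → r < k → s < k → x * k + r ≡ y * k + s → x ≡ y × r ≡ s
  digit-unique x y {r} {s} r<k s<k e with <-cmp x y
  ... | tri≈ _ refl _ = refl , +-cancelˡ-≡ (x * k) r s e
  ... | tri< x<y _ _ = ⊥-elim (<-irrefl e (<-≤-trans (+-monoʳ-< (x * k) r<k)
        (≤-trans (≤-reflexive (+-comm (x * k) k)) (≤-trans (*-monoˡ-≤ k x<y) (m≤m+n (y * k) s)))))
  ... | tri> _ _ y<x = ⊥-elim (<-irrefl (sym e) (<-≤-trans (+-monoʳ-< (y * k) s<k)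
        (≤-trans (≤-reflexive (+-comm (y * k) k)) (≤-trans (*-monoˡ-≤ k y<x) (m≤m+n (x * k) r)))))

  val-injective : ∀ {f g} m → val f m ≡ val g m → ∀ t → t < m → f t ≡ g t
  val-injective {f} {g} (suc m) e t t<sm with digit-unique (val f m) (val g m) (toℕ<n (f m)) (toℕ<n (g m)) e | t ≟ m
  ... | _ , d | yes refl = toℕ-injective d
  ... | v , _ | no t≢m   = val-injective m v t (≤∧≢⇒< (≤-pred t<sm) t≢m)

  -- The word formed by the first d letters of f is lexicographically minimal among its
  -- rotations, where f has period d.
  Least : (ℕ → Fin k) → ℕ → Set
  Least f d = ∀ j → val f d ≤ val (λ t → f (j + t)) d

  module _ {f : ℕ → Fin k} {d : ℕ} (per : ∀ t → f (t + d) ≡ f t) (0<d : 0 < d) where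

    -- A rotation that fixes a primitive word of length d is a rotation by a multiple of d.
    rotation-fixed : Primitive f d → ∀ e → 0 < e → (∀ t → t < d → f (e + t) ≡ f t) → d ∣ e
    rotation-fixed pr e 0<e fix = primitive-divides 0<d 0<e pr ≤-refl (λ t _ → sym (per t)) (λ t _ → fixed t)
      where
      instance _ = >-nonZero 0<d
      mod : ∀ t → f t ≡ f (t % d)
      mod t = Period-% {m = suc t} (λ s _ → sym (per s)) t ≤-refl
      fixed : ∀ t → f t ≡ f (t + e)
      fixed t = trans (mod t) (trans (sym (fix (t % d) (m%n<n t d))) (trans (mod (e + t % d))
        (trans (cong f (trans (cong (_% d) (+-comm e (t % d))) (%-absorb d t e))) (sym (mod (t + e))))))

    -- A least rotation of a primitive word has no border.  Write the word as u v = x u with u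
    -- the border: minimality against the rotation v u gives x ≤ v, minimality against u x gives
    -- v ≤ x, so v = x and the word is fixed by a proper rotation.
    least-unbordered : Primitive f d → Least f d → ∀ e → 0 < e → e < d → ¬ Period f e d
    least-unbordered pr least e 0<e e<d P with m≤n⇒∃[o]m+o≡n (<⇒≤ e<d)
    ... | b , refl = <⇒≱ e<d (∣⇒≤ {{>-nonZero 0<e}} (rotation-fixed pr e 0<e fix))
      where
      U = val f b
      V = val (λ t → f (b + t)) e
      X = val f e
      0<k : 0 < k
      0<k = ≤-<-trans z≤n (toℕ<n (f 0))
      instance _ = >-nonZero 0<k
      border : val (λ t → f (e + t)) b ≡ U
      border = val-cong b λ t t<b → sym
          (trans (P t (lin 0 (t<b) (solve 3 (λ a b c → con 1 :+ (a :+ b) :+ c :+ con 0 := b :+ c :+ (con 1 :+ a))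
          refl t e b))) (cong f (+-comm t e)))
      uv : val f (e + b) ≡ U * k ^ e + V
      uv = trans (cong (val f) (+-comm e b)) (val-+ f b e)
      wu : val f (e + b) ≡ X * k ^ b + U
      wu = trans (val-+ f e b) (cong (X * k ^ b +_) border)
      uw : val (λ t → f (e + t)) (e + b) ≡ U * k ^ e + X
      uw = trans (cong (val (λ t → f (e + t))) (+-comm e b)) (trans (val-+ (λ t → f (e + t)) b e)
        (cong₂ (λ p q → p * k ^ e + q) border (val-cong e λ t _ → trans
            (cong f (trans (sym (+-assoc e b t)) (+-comm (e + b) t))) (per t))))
      vu : val (λ t → f (b + t)) (e + b) ≡ V * k ^ b + U
      vu = trans (val-+ (λ t → f (b + t)) e b) (cong (V * k ^ b +_) (val-cong b λ t _ →
        trans (cong f (solve 3 (λ b e t → b :+ (e :+ t) := t :+ (e :+ b)) refl b e t)) (per t)))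
      V≤X : V ≤ X
      V≤X = +-cancelˡ-≤ (U * k ^ e) V X (subst₂ _≤_ uv uw (least e))
      X≤V : X ≤ V
      X≤V = *-cancelʳ-≤ X V (k ^ b) {{m^n≢0 k b}} (+-cancelʳ-≤ U _ _ (subst₂ _≤_ wu vu (least b)))
      fix : ∀ t → t < e + b → f (e + t) ≡ f t
      fix = val-injective (e + b) (trans uw (trans (cong (U * k ^ e +_) (≤-antisym X≤V V≤X)) (sym uv)))

    -- The least of the rotations by 0, …, d - 1 is least among all rotations.
    least-rotation : ∃ λ c → c < d × Least (λ t → f (c + t)) d
    least-rotation with argmin d 0<d
      where
      v : ℕ → ℕ
      v j = val (λ t → f (j + t)) d
      argmin : ∀ m → 0 < m → ∃ λ c → c < m × (∀ j → j < m → v c ≤ v j)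
      argmin (suc zero) _ = 0 , z<s , λ { zero _ → ≤-refl ; (suc j) (s≤s ()) }
      argmin (suc (suc m)) _ with argmin (suc m) z<s
      ... | c , c<m , min with v c ≤? v (suc m)
      ... | yes le = c , m<n⇒m<1+n c<m , λ j j< → case j (j ≟ suc m) j<
        where
        case : ∀ j → Dec (j ≡ suc m) → j < suc (suc m) → v c ≤ v j
        case j (yes refl) _ = le
        case j (no ne) j< = min j (≤∧≢⇒< (≤-pred j<) ne)
      ... | no nle = suc m , ≤-refl , λ j j< → case j (j ≟ suc m) j<
        where
        case : ∀ j → Dec (j ≡ suc m) → j < suc (suc m) → v (suc m) ≤ v j
        case j (yes refl) _ = ≤-refl
        case j (no ne) j< = ≤-trans (<⇒≤ (≰⇒> nle)) (min j (≤∧≢⇒< (≤-pred j<) ne))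
    ... | c , c<d , min = c , c<d , λ j → ≤-trans (min ((c + j) % d) (m%n<n (c + j) d))
          (≤-reflexive (val-cong d λ t _ → trans (mod ((c + j) % d + t))
            (trans (cong f (%-absorb d (c + j) t)) (sym (trans (cong f (sym (+-assoc c j t))) (mod (c + j + t)))))))
      where
      instance _ = >-nonZero 0<d
      mod : ∀ t → f t ≡ f (t % d)
      mod t = Period-% {m = suc t} (λ s _ → sym (per s)) t ≤-refl

-- Runs and conjugacy classes in a periodic sequence

module Periodic {k n : ℕ} (W : ℕ → Fin k) (0<n : 0 < n) (W-period : ∀ i → W (i + n) ≡ W i) where

  instance
    n≢0 : NonZero n
    n≢0 = >-nonZero 0<n

  W-% : ∀ i → W i ≡ W (i % n)
  W-% i = Period-% {m = suc i} (λ s _ → sym (W-period s)) i ≤-refl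

  W-%+ : ∀ i t → W (i % n + t) ≡ W (i + t)
  W-%+ i t = trans (W-% (i % n + t)) (trans (cong W (%-absorb n i t)) (sym (W-% (i + t))))

  -- The windows of length m of W at positions i and j are equal.
  Eq : ℕ → ℕ → ℕ → Set
  Eq m i j = ∀ t → t < m → W (i + t) ≡ W (j + t)

  -- The run of period d formed by the m + d letters of W from position s on.  The parameter m
  -- counts the equalities, not the letters; equivalently, the window of length m at s is
  -- repeated d positions later.
  Run : ℕ → ℕ → ℕ → Set
  Run d s m = ∀ t → t < m → W (s + t) ≡ W (s + t + d)

  abstract
    Eq? : ∀ m i j → Dec (Eq m i j)
    Eq? m i j = map′ (λ h t → h {t}) (λ h {t} → h t) (allUpTo? (λ t → W (i + t) Finₚ.≟ W (j + t)) m)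

  abstract
    Run? : ∀ d s m → Dec (Run d s m)
    Run? d s m = map′ (λ h t → h {t}) (λ h {t} → h t) (allUpTo? (λ t → W (s + t) Finₚ.≟ W (s + t + d)) m)

  Eq-sym : ∀ {m i j} → Eq m i j → Eq m j i
  Eq-sym h t t<m = sym (h t t<m)

  Eq-trans : ∀ {m i j l} → Eq m i j → Eq m j l → Eq m i l
  Eq-trans h h′ t t<m = trans (h t t<m) (h′ t t<m)

  Eq-≤ : ∀ {m m′ i j} → m′ ≤ m → Eq m i j → Eq m′ i j
  Eq-≤ le h t lt = h t (<-≤-trans lt le)

  Eq-% : ∀ m i → Eq m (i % n) i
  Eq-% m i t _ = W-%+ i t

  Eq-+n : ∀ m i → Eq m (i + n) i
  Eq-+n m i t _ = trans (cong W (solve 3 (λ i n t → i :+ n :+ t := i :+ t :+ n) refl i n t)) (W-period (i + t))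

  Run⇒Eq : ∀ {d s m} → Run d s m → Eq m s (s + d)
  Run⇒Eq {d} {s} h t t<m = trans (h t t<m) (cong W (solve 3 (λ s t d → s :+ t :+ d := s :+ d :+ t) refl s t d))

  Eq⇒Run : ∀ {d s m} → Eq m s (s + d) → Run d s m
  Eq⇒Run {d} {s} h t t<m = trans (h t t<m) (cong W (solve 3 (λ s t d → s :+ d :+ t := s :+ t :+ d) refl s t d))

  Run-≤ : ∀ {d s m m′} → m′ ≤ m → Run d s m → Run d s m′
  Run-≤ le h t lt = h t (<-≤-trans lt le)

  Run-cong-+n : ∀ {d s m} → Run d s m → Run d (s + n) m
  Run-cong-+n {d} {s} h t t<m = trans (trans (cong W (solve 3 (λ s n t → s :+ n :+ t := s :+ t :+ n) refl s n t))
      (W-period (s + t)))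
    (trans (h t t<m) (sym (trans (cong W (solve 4 (λ s n t d → s :+ n :+ t :+ d := s :+ t :+ d :+ n) refl s n t d))
        (W-period (s + t + d)))))

  Run⇒Period : ∀ {d s m} → Run d s m → Period (λ t → W (s + t)) d (m + d)
  Run⇒Period {d} {s} {m} h t lt = trans (h t (+-cancelʳ-< d t m lt)) (cong W (+-assoc s t d))

  Period⇒Run : ∀ {d s m} → Period (λ t → W (s + t)) d (m + d) → Run d s m
  Period⇒Run {d} {s} {m} h t lt = trans (h t (+-monoˡ-< d lt)) (cong W (sym (+-assoc s t d)))

  -- Equal windows of length at least n are followed by equal letters for ever.
  Eq-long : ∀ {m i j} → n ≤ m → Eq m i j → ∀ t → W (i + t) ≡ W (j + t)
  Eq-long {m} {i} {j} n≤m h t = trans (mod i) (trans (h (t % n) (<-≤-trans (m%n<n t n) n≤m)) (sym (mod j)))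
    where
    mod : ∀ s → W (s + t) ≡ W (s + t % n)
    mod s = trans (W-% (s + t))
        (trans (cong W (trans (cong (_% n) (+-comm s t)) (trans (sym (%-absorb n t s))
        (cong (_% n) (+-comm (t % n) s))))) (sym (W-% (s + t % n))))

  -- W has period n, so a period valid from s on is valid everywhere.
  shift-all : ∀ {s d} → (∀ t → W (s + t) ≡ W (s + t + d)) → ∀ i → W i ≡ W (i + d)
  shift-all {s} {d} h i with m≤n⇒∃[o]o+m≡n (≤-trans (m≤m*n s n) (m≤n+m (s * n) i))
  ... | o , e = trans (back i)
      (trans (h o) (trans (cong W (trans (cong (_+ d) (trans (+-comm s o) e))
      (solve 3 (λ i x d → i :+ x :+ d := i :+ d :+ x) refl i (s * n) d))) (sym (far s (i + d)))))
    where
    far : ∀ q i → W i ≡ W (i + q * n)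
    far q i = trans (W-% i) (trans (cong W (sym ([m+kn]%n≡m%n i q n))) (sym (W-% (i + q * n))))
    back : ∀ i′ → W i ≡ W (s + o)
    back _ = trans (far s i) (cong W (trans (sym e) (+-comm o s)))

  -- A conjugacy class of primitive words is stored as (d - 1 , c), where d is the length of
  -- its words and c the first position at which W spells the least of them.
  Class : Set
  Class = ℕ × ℕ

  ∥_∥ : Class → ℕ
  ∥ p ∥ = suc (proj₁ p)

  -- The periodic sequence obtained by repeating the least word of the class.  An offset j into
  -- it, or the residue of j modulo the length, is called a phase.
  word : Class → ℕ → Fin k
  word p t = W (proj₂ p + t % ∥ p ∥)

  word-% : ∀ p t → word p t ≡ word p (t % ∥ p ∥)
  word-% p t = cong (λ z → W (proj₂ p + z)) (sym (m%n%n≡m%n t ∥ p ∥))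

  word-period : ∀ p t → word p (t + ∥ p ∥) ≡ word p t
  word-period p t = cong (λ z → W (proj₂ p + z)) ([m+n]%n≡m%n t ∥ p ∥)

  word-+ : ∀ p j t → word p (j % ∥ p ∥ + t) ≡ word p (j + t)
  word-+ p j t = cong (λ z → W (proj₂ p + z)) (%-absorb ∥ p ∥ j t)

  word-%≡ : ∀ p {i j} → i % ∥ p ∥ ≡ j % ∥ p ∥ → ∀ t → word p (i + t) ≡ word p (j + t)
  word-%≡ p {i} {j} e t = trans (sym (word-+ p i t)) (trans (cong (λ z → word p (z + t)) e) (word-+ p j t))

  word-start : ∀ p t → t < ∥ p ∥ → word p t ≡ W (proj₂ p + t)
  word-start p t t<d = cong (λ z → W (proj₂ p + z)) (m<n⇒m%n≡m t<d)

  -- The length is less than n, the word is primitive and least among its rotations, and W does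
  -- not spell it at any earlier position.
  IsClass : Class → Set
  IsClass p = ∥ p ∥ < n × proj₂ p < n × Primitive (word p) ∥ p ∥ ×
    (∀ j → j < ∥ p ∥ → val (word p) ∥ p ∥ ≤ val (λ t → word p (j + t)) ∥ p ∥) ×
    (∀ c → c < proj₂ p → ¬ Eq ∥ p ∥ c (proj₂ p))

  abstract
    allBelow? : ∀ {P : ℕ → Set} → (∀ i → Dec (P i)) → ∀ m → Dec (∀ i → i < m → P i)
    allBelow? P? m = map′ (λ h i → h {i}) (λ h {i} → h i) (allUpTo? P? m)

  abstract
    Primitive? : ∀ (f : ℕ → Fin k) d → Dec (Primitive f d)
    Primitive? f d = map′ (λ h g 0<g g<d → h g g<d 0<g) (λ h g g<d 0<g → h g 0<g g<d) (allBelow? dec d)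
      where
      dec : ∀ g → Dec (0 < g → g ∣ d → ¬ Period f g d)
      dec g with 0 <? g | g ∣? d | Period? Finₚ._≟_ f g d
      ... | yes a | yes b | yes c = no λ h → h a b c
      ... | no ¬a | _ | _ = yes λ a → ⊥-elim (¬a a)
      ... | _ | no ¬b | _ = yes λ _ b → ⊥-elim (¬b b)
      ... | _ | _ | no ¬c = yes λ _ _ → ¬c

  abstract
    IsClass? : ∀ p → Dec (IsClass p)
    IsClass? p = (∥ p ∥ <? n) ×-dec ((proj₂ p <? n) ×-dec (Primitive? (word p) ∥ p ∥ ×-dec
      (allBelow? (λ j → val (word p) ∥ p ∥ ≤? val (λ t → word p (j + t)) ∥ p ∥) ∥ p ∥ ×-dec
       allBelow? (λ c → ¬? (Eq? ∥ p ∥ c (proj₂ p))) (proj₂ p))))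

  abstract
    classes : List Class
    classes = filter IsClass? (cartesianProduct (upTo n) (upTo n))

    classes-unique : Unique classes
    classes-unique = Uniqueₚ.filter⁺ IsClass? (Uniqueₚ.cartesianProduct⁺ (Uniqueₚ.upTo⁺ n) (Uniqueₚ.upTo⁺ n))

    ∈-classes⁻ : ∀ {p} → p ∈ classes → IsClass p
    ∈-classes⁻ {p} p∈ = proj₂ (∈-filter⁻ IsClass? {xs = cartesianProduct (upTo n) (upTo n)} p∈)

    ∈-classes⁺ : ∀ {p} → IsClass p → p ∈ classes
    ∈-classes⁺ {e , c} h@(d<n , c<n , _) = ∈-filter⁺ IsClass? (∈-cartesianProduct⁺ (∈-upTo⁺ (<-trans (n<1+n e) d<n))
        (∈-upTo⁺ c<n)) h

  class-least : ∀ {p} → IsClass p → Least (word p) ∥ p ∥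
  class-least {p} (_ , _ , _ , l , _) j = ≤-trans (l (j % ∥ p ∥) (m%n<n j ∥ p ∥))
    (≤-reflexive (val-cong ∥ p ∥ λ t _ → word-+ p j t))

  class-primitive : ∀ {p} → IsClass p → Primitive (word p) ∥ p ∥
  class-primitive (_ , _ , pr , _) = pr

  class-unbordered : ∀ {p} → IsClass p → ∀ e → 0 < e → e < ∥ p ∥ → ¬ Period (word p) e ∥ p ∥
  class-unbordered {p} h = least-unbordered {f = word p} (word-period p) z<s (class-primitive h) (class-least {p} h)

  class-rotation : ∀ {p} → IsClass p → ∀ e → 0 < e → (∀ t → t < ∥ p ∥ → word p (e + t) ≡ word p t) → ∥ p ∥ ∣ e
  class-rotation {p} h = rotation-fixed {f = word p} (word-period p) z<s (class-primitive h)

  -- A class is determined by its least word, and by any conjugate of it.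
  class-unique : ∀ {p q} → IsClass p → IsClass q → ∥ p ∥ ≡ ∥ q ∥ → (∀ t → t < ∥ p ∥ → word p t ≡ word q t) → p ≡ q
  class-unique {e , c} {e′ , c′} (_ , _ , _ , _ , min) (_ , _ , _ , _ , min′) refl h with <-cmp c c′
  ... | tri≈ _ refl _ = refl
  ... | tri< c<c′ _ _ = ⊥-elim (min′ c c<c′ λ t t<d → trans (sym (word-start (e , c) t t<d))
      (trans (h t t<d) (word-start (e , c′) t t<d)))
  ... | tri> _ _ c′<c = ⊥-elim (min c′ c′<c λ t t<d → trans (sym (word-start (e , c′) t t<d))
      (trans (sym (h t t<d)) (word-start (e , c) t t<d)))

  class-conjugate : ∀ {p q} → IsClass p → IsClass q → ∥ p ∥ ≡ ∥ q ∥ → ∀ j → (∀ t → t < ∥ p ∥ → word p t ≡ word q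
      (j + t)) → p ≡ q
  class-conjugate {p} {q} hp hq refl j h = class-unique {p} {q} hp hq refl (val-injective ∥ p ∥ (≤-antisym
      (≤-trans (class-least {p} hp back) (≤-reflexive (val-cong ∥ p ∥ λ t _ → trans (every (back + t))
          (trans (cong (word q) (sym (+-assoc j back t))) (word-%≡ q {j + back} {0} back-% t)))))
      (≤-trans (class-least {q} hq j) (≤-reflexive (val-cong ∥ p ∥ λ t t<d → sym (h t t<d))))))
    where
    d = ∥ p ∥
    back = d ∸ j % d
    back-% : (j + back) % d ≡ 0 % d
    back-% = %-complement d j
    every : ∀ t → word p t ≡ word q (j + t)
    every t = trans (word-% p t) (trans (h (t % d) (m%n<n t d))
      (trans (cong (word q) (+-comm j (t % d))) (trans (word-+ q t j) (cong (word q) (+-comm t j)))))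

  -- A run with at least 2 d letters and a primitive period d spells a stretch of the periodic
  -- sequence of a class of length d.
  class-of-run : ∀ {d s m} → 0 < d → d < n → d ≤ m → Primitive (λ t → W (s + t)) d → Run d s m →
    ∃ λ p → IsClass p × ∥ p ∥ ≡ d × ∃ λ j → j < d × (∀ t → t < m + d → W (s + t) ≡ word p (j + t))
  class-of-run {suc e} {s} {m} 0<d d<n d≤m pr run with least-rotation {f = λ t → W (s + t % suc e)}
      (λ t → cong (λ z → W (s + z)) ([m+n]%n≡m%n t (suc e))) 0<d
  ... | r , r<d , least-r with least (λ c → Eq? (suc e) c ((s + r) % n)) ((s + r) % n) (λ _ _ → refl)
  ... | c , c≤ , eq , min = (e , c) , (d<n , <-≤-trans (s≤s c≤) (m%n<n (s + r) n) , primitive-u , (λ j _ → least-u j)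
      , minimal) , refl ,
        o % d , m%n<n o d , inside
    where
    d = suc e
    f : ℕ → Fin k
    f t = W (s + t % d)
    f-per : ∀ t → f (t + d) ≡ f t
    f-per t = cong (λ z → W (s + z)) ([m+n]%n≡m%n t d)
    f-+ : ∀ x y → f (x % d + y) ≡ f (x + y)
    f-+ x y = cong (λ z → W (s + z)) (%-absorb d x y)
    W-f : ∀ t → t < m + d → W (s + t) ≡ f t
    W-f = Period-% (Run⇒Period run)
    u : ℕ → Fin k
    u = word (e , c)
    u-f : ∀ t → u t ≡ f (r + t)
    u-f t = trans (eq (t % d) (m%n<n t d)) (trans (W-%+ (s + r) (t % d)) (trans (cong W (+-assoc s r (t % d)))
      (trans (W-f (r + t % d) (<-≤-trans (+-mono-< r<d (m%n<n t d)) (+-monoˡ-≤ d d≤m)))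
        (trans (cong f (+-comm r (t % d))) (trans (f-+ t r) (cong f (+-comm t r)))))))
    minimal : ∀ c′ → c′ < c → ¬ Eq d c′ c
    minimal c′ c′<c h = min c′ c′<c (Eq-trans {i = c′} {c} {(s + r) % n} h eq)
    least-u : ∀ j → val u d ≤ val (λ t → u (j + t)) d
    least-u j = subst₂ _≤_ (val-cong d λ t _ → sym (u-f t)) (val-cong d λ t _ → sym (u-f (j + t))) (least-r j)
    o = d ∸ r
    o+r : r + o ≡ d
    o+r = m+[n∸m]≡n (<⇒≤ r<d)
    f-u : ∀ t → f t ≡ u (o + t)
    f-u t = sym (trans (u-f (o + t))
        (trans (cong f (trans (sym (+-assoc r o t)) (trans (cong (_+ t) o+r) (+-comm d t)))) (f-per t)))
    inside : ∀ t → t < m + d → W (s + t) ≡ u (o % d + t)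
    inside t lt = trans (W-f t lt) (trans (f-u t) (sym (word-+ (e , c) o t)))
    primitive-u : Primitive u d
    primitive-u g 0<g g<d g∣d P = pr g 0<g g<d g∣d λ t lt → trans
        (W-f t (<-≤-trans (≤-<-trans (m≤m+n t g) lt) (m≤n+m d m)))
        (trans (f-u t) (trans (P∞ (o + t)) (trans (cong u (+-assoc o t g)) (trans (sym (f-u (t + g)))
            (sym (W-f (t + g) (<-≤-trans lt (m≤n+m d m))))))))
      where
      P∞ : ∀ t → u t ≡ u (t + g)
      P∞ t = Period-extend {f = u} {M = suc (t + g)} 0<g 0<d g∣d ≤-refl (λ s _ → sym (word-period (e , c) s)) P t
          ≤-refl

-- Squares of a class and the levels at which its cycle is available

-- From here on W has no period smaller than n, and b bounds the lengths of the roots of the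
-- squares under consideration.
module PrimitiveWord {k n : ℕ} (W : ℕ → Fin k) (0<n : 0 < n) (W-period : ∀ i → W (i + n) ≡ W i)
  (W-primitive : ∀ d → 0 < d → d < n → ¬ (∀ i → W i ≡ W (i + d))) (b : ℕ) (b<n : b < n) where

  open Periodic W 0<n W-period public

  -- The window of length m at phase j of the sequence of p occurs in W.
  record Occ (p : Class) (j m : ℕ) : Set where
    constructor occurs
    field
      position : ℕ
      position<n : position < n
      matches  : ∀ t → t < m → W (position + t) ≡ word p (j + t)

  abstract
    Occ? : ∀ p j m → Dec (Occ p j m)
    Occ? p j m = map′ (λ { (i , i<n , h) → occurs i i<n h }) (λ { (occurs i i<n h) → i , i<n , h })
      (anyUpTo? (λ i → allBelow? (λ t → W (i + t) Finₚ.≟ word p (j + t)) m) n)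

  Occ-at : ∀ {p j m} s → (∀ t → t < m → W (s + t) ≡ word p (j + t)) → Occ p j m
  Occ-at s h = occurs (s % n) (m%n<n s n) λ t t<m → trans (W-%+ s t) (h t t<m)

  Occ-part : ∀ {p j m} a m′ → a + m′ ≤ m → Occ p j m → Occ p (j + a) m′
  Occ-part {p} {j} a m′ le (occurs i _ h) = Occ-at (i + a) λ t t<m′ → trans (cong W (+-assoc i a t))
    (trans (h (a + t) (<-≤-trans (+-monoʳ-< a t<m′) le)) (cong (word p) (sym (+-assoc j a t))))

  Occ-%≡ : ∀ {p i j m} → i % ∥ p ∥ ≡ j % ∥ p ∥ → Occ p i m → Occ p j m
  Occ-%≡ {p} {i} {j} e (occurs s s<n h) = occurs s s<n λ t t<m → trans (h t t<m) (word-%≡ p {i} {j} e t)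

  Occ-≤ : ∀ {p j m m′} → m′ ≤ m → Occ p j m → Occ p j m′
  Occ-≤ le (occurs s s<n h) = occurs s s<n λ t t<m′ → h t (<-≤-trans t<m′ le)

  -- The i-th power of the word of p at phase j has length at most b, and its square occurs
  -- in W.  The code (p , i , j) determines this square; phases j < ∥ p ∥ suffice.
  Square : Class → ℕ → ℕ → Set
  Square p i j = i * ∥ p ∥ ≤ b × Occ p j (2 * (i * ∥ p ∥))

  abstract
    Square? : ∀ p i j → Dec (Square p i j)
    Square? p i j = (i * ∥ p ∥ ≤? b) ×-dec Occ? p j (2 * (i * ∥ p ∥))

  #squares : Class → ℕ → ℕ
  #squares p i = count (Square? p i) ∥ p ∥

  triple : Class → ℕ → ℕ → Class × ℕ × ℕ
  triple p i j = p , i , j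

  -- The codes of the squares of p with 1 ≤ i ≤ B.
  squaresUpTo : Class → ℕ → List (Class × ℕ × ℕ)
  squaresUpTo p zero = []
  squaresUpTo p (suc i) = map (triple p (suc i)) (sel (Square? p (suc i)) ∥ p ∥) ++ squaresUpTo p i

  squares : Class → List (Class × ℕ × ℕ)
  squares p = squaresUpTo p b

  -- The number of squares of a class.
  N : Class → ℕ
  N p = length (squares p)

  length-squaresUpTo : ∀ p B → length (squaresUpTo p (suc B)) ≡ #squares p (suc B) + length (squaresUpTo p B)
  length-squaresUpTo p B = trans (length-++ (map (triple p (suc B)) js) {squaresUpTo p B})
      (cong (_+ length (squaresUpTo p B)) (length-map (triple p (suc B)) js))
    where
    js = sel (Square? p (suc B)) ∥ p ∥

  ∈-squares : ∀ {p i j} B → 1 ≤ i → i ≤ B → j < ∥ p ∥ → Square p i j → (p , i , j) ∈ squaresUpTo p B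
  ∈-squares {p} {suc i} {j} (suc B) _ (s≤s i≤B) j<d sq with i ≟ B
  ... | yes refl = ∈-++⁺ˡ (∈-map⁺ (triple p (suc i)) (∈-sel⁺ (Square? p (suc i)) j<d sq))
  ... | no i≢B = ∈-++⁺ʳ (map (triple p (suc B)) (sel (Square? p (suc B)) ∥ p ∥))
      (∈-squares B (s≤s z≤n) (≤∧≢⇒< i≤B i≢B) j<d sq)

  -- The cycle of p is available at level l if a run of p contains a cycle of windows of length
  -- l + 1, or if, for some exponent i + 1, more than l - (2 i + 1) d ≥ 0 of the rotations
  -- have a square of that exponent in W, where d is the length of the class.
  Available : Class → ℕ → Set
  Available p l = (∃ λ j → j < ∥ p ∥ × Occ p j (∥ p ∥ + l)) ⊎
    (∃ λ i → i < b × ∥ p ∥ + 2 * (i * ∥ p ∥) ≤ l × l < ∥ p ∥ + 2 * (i * ∥ p ∥) + #squares p (suc i))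

  abstract
    Available? : ∀ p l → Dec (Available p l)
    Available? p l = anyUpTo? (λ j → Occ? p j (∥ p ∥ + l)) ∥ p ∥ ⊎-dec
      anyUpTo? (λ i → (∥ p ∥ + 2 * (i * ∥ p ∥) ≤? l) ×-dec (l <? ∥ p ∥ + 2 * (i * ∥ p ∥) + #squares p (suc i))) b

  available-0 : ∀ p → Available p 0
  available-0 p = inj₁ (0 , z<s , Occ-at (proj₂ p) λ t t<d → sym
      (word-start p t (subst (t <_) (+-identityʳ ∥ p ∥) t<d)))

  abstract
    top-spec : ∀ p → ∃ λ m → m < n × Available p m × (∀ i → m < i → i < n → ¬ Available p i)
    top-spec p with greatest (Available? p) n
    ... | inj₁ h = h
    ... | inj₂ none = ⊥-elim (none 0 0<n (available-0 p))

  -- The last level below n at which p is available.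
  T : Class → ℕ
  T p = proj₁ (top-spec p)

  T<n : ∀ p → T p < n
  T<n p = proj₁ (proj₂ (top-spec p))

  T-available : ∀ p → Available p (T p)
  T-available p = proj₁ (proj₂ (proj₂ (top-spec p)))

  T-max : ∀ {p l} → l < n → Available p l → l ≤ T p
  T-max {p} {l} l<n a = ≮⇒≥ λ T<l → proj₂ (proj₂ (proj₂ (top-spec p))) l T<l l<n a

  -- Every window of length l + 1 of the sequence of p occurs in W.
  Full : Class → ℕ → Set
  Full p l = ∀ j → Occ p j (suc l)

  Full-≤ : ∀ {p l l′} → l′ ≤ l → Full p l → Full p l′
  Full-≤ le h j = Occ-≤ (s≤s le) (h j)

  -- The phase j as seen from phase j₀.
  offset : ∀ d .{{_ : NonZero d}} → ℕ → ℕ → ℕ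
  offset d j₀ j = (d ∸ j₀ + j) % d

  offset-% : ∀ d .{{_ : NonZero d}} j₀ j → j₀ < d → (j₀ + offset d j₀ j) % d ≡ j % d
  offset-% d j₀ j j₀<d = trans (cong (_% d) (+-comm j₀ _)) (trans (%-absorb d (d ∸ j₀ + j) j₀)
    (trans (cong (_% d) (trans (solve 3 (λ x j y → x :+ j :+ y := j :+ (y :+ x)) refl (d ∸ j₀) j j₀)
        (cong (j +_) (m+[n∸m]≡n (<⇒≤ j₀<d))))) ([m+n]%n≡m%n j d)))

  -- In the second case of availability with l = (2 i + 1) d + κ, the window of length l + 1 at
  -- phase j lies in all squares of length (2 i + 2) d except those starting at κ phases, and
  -- more than κ squares are at hand.
  available⇒full : ∀ {p l} → Available p l → Full p l
  available⇒full {p} {l} (inj₁ (j₀ , j₀<d , occ)) j = Occ-%≡ (offset-% ∥ p ∥ j₀ j j₀<d) (Occ-part a (suc l)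
      (lin 0 ((m%n<n (∥ p ∥ ∸ j₀ + j) ∥ p ∥)) (solve 3 (λ a b c → a :+ (con 1 :+ b) :+ c :+ con 0 :=
          c :+ b :+ (con 1 :+ a)) refl a l (∥ p ∥))) occ)
    where
    a = offset ∥ p ∥ j₀ j
  available⇒full {p} {l} (inj₂ (i , i<b , le , lt)) j with anyUpTo? (λ j₀ → Occ? p j₀ (2 * (suc i * ∥ p ∥)) ×-dec
      (offset ∥ p ∥ j₀ j + suc l ≤? 2 * (suc i * ∥ p ∥))) ∥ p ∥
  ... | yes (j₀ , j₀<d , occ , fits) = Occ-%≡ (offset-% ∥ p ∥ j₀ j j₀<d) (Occ-part _ (suc l) fits occ)
  ... | no none with m≤n⇒∃[o]m+o≡n le
  ... | κ , refl = ⊥-elim (<⇒≱ κ<K (≤-trans (count-inj (Square? p (suc i)) (λ _ → yes tt) {n = κ} R hits inj)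
      (count≤ (λ _ → yes tt) κ)))
    where
    d = ∥ p ∥
    κ<K : κ < #squares p (suc i)
    κ<K = +-cancelˡ-< (d + 2 * (i * d)) κ _ lt
    a : ℕ → ℕ
    a j₀ = offset d j₀ j
    R : ℕ → ℕ → Set
    R j₀ r = a j₀ + κ ≡ d + r
    hits : ∀ {j₀} → j₀ < d → Square p (suc i) j₀ → ∃ λ r → r < κ × ⊤ × R j₀ r
    hits {j₀} j₀<d (_ , occ) with m≤n⇒∃[o]m+o≡n {d} {a j₀ + κ} (≮⇒≥ λ small → none (j₀ , j₀<d , occ , fits small))
      where
      fits : a j₀ + κ < d → a j₀ + suc (d + 2 * (i * d) + κ) ≤ 2 * (suc i * d)
      fits small = subst (a j₀ + suc (d + 2 * (i * d) + κ) ≤_)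
          (solve 2 (λ d x → d :+ con 2 :* x :+ d := con 2 :* (d :+ x)) refl d (i * d))
        (lin 0 (small) (solve 4 (λ a b c d → a :+ (con 1 :+ (b :+ con 2 :* c :+ d)) :+ b :+ con 0 := b :+ con
            2 :* c :+ b :+ (con 1 :+ (a :+ d))) refl (a j₀) d (i * d) κ))
    ... | r , e = r , (lin 0 ((≤-reflexive e) ⊞ (m%n<n (d ∸ j₀ + j) d))
        (solve 4 (λ a b c d → con 1 :+ a :+ (b :+ c :+ d) :+ con 0 := c :+ (d :+ a :+ (con 1 :+ b))) refl r (a j₀) κ
        d)) , tt , sym e
    inj : ∀ {j₀ j₁ r} → j₀ < d → j₁ < d → R j₀ r → R j₁ r → j₀ ≡ j₁
    inj {j₀} {j₁} j₀<d j₁<d r₀ r₁ = %-injective d (a j₀) j₀<d j₁<d (trans (offset-% d j₀ j j₀<d)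
      (trans (sym (offset-% d j₁ j j₁<d)) (cong (λ z → (j₁ + z) % d) (+-cancelʳ-≡ κ (a j₁) (a j₀)
          (trans r₁ (sym r₀))))))

  abstract
    T-full : ∀ p {l} → l ≤ T p → Full p l
    T-full p le = Full-≤ le (available⇒full {p} (T-available p))

  -- At a level l ≥ n the sequence W would follow the cycle of p for ever, so it would have the
  -- period ∥ p ∥ < n.
  full⇒<n : ∀ {p l} → ∥ p ∥ < n → Full p l → l < n
  full⇒<n {p} {l} d<n full = ≰⇒> λ n≤l → let (occurs i _ h) = full 0 in
      W-primitive ∥ p ∥ z<s d<n (shift-all {i} λ t → trans (agree n≤l i h t)
        (trans (sym (word-period p t)) (trans (sym (agree n≤l i h (t + ∥ p ∥))) (cong W (sym (+-assoc i t ∥ p ∥))))))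
    where
    agree : n ≤ l → ∀ i → (∀ t → t < suc l → W (i + t) ≡ word p t) → ∀ t → W (i + t) ≡ word p t
    agree n≤l i h = <-rec (λ t → W (i + t) ≡ word p t) step
      where
      step : ∀ t → (∀ {s} → s < t → W (i + s) ≡ word p s) → W (i + t) ≡ word p t
      step t rec with t <? suc l
      ... | yes t<sl = h t t<sl
      ... | no t≮sl with m≤n⇒∃[o]o+m≡n (≤-trans (n≤1+n l) (≮⇒≥ t≮sl))
      ... | j , refl = trans (cong W (sym (+-assoc i j l)))
          (trans (sym (Eq-long {l} {Occ.position (full j)} {i + j} n≤l same l))
            (Occ.matches (full j) l ≤-refl))
        where
        same : Eq l (Occ.position (full j)) (i + j)
        same s s<l = trans (Occ.matches (full j) s (m<n⇒m<1+n s<l))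
            (sym (trans (cong W (+-assoc i j s)) (rec (+-monoʳ-< j s<l))))

  -- The number N of squares against the last level T.  Here I is the largest exponent of a
  -- square of the class, and 0 if there is none.  If K squares have exponent I > 0, then
  -- N ≤ (I - 1) d + K, and availability gives (2 I - 1) d + K ≤ T + 1.
  record TopBound (p : Class) : Set where
    field
      I        : ℕ
      N≤Id     : N p ≤ I * ∥ p ∥
      N+Id≤T+1 : N p + I * ∥ p ∥ ≤ suc (T p)
      I-max    : ∀ i → i < b → 0 < #squares p (suc i) → i < I
      N≤K      : I ≡ 1 → N p ≤ #squares p 1

  #squares≤d : ∀ p i → #squares p i ≤ ∥ p ∥
  #squares≤d p i = count≤ (Square? p i) ∥ p ∥

  topBound : ∀ {p} → ∥ p ∥ < n → TopBound p
  topBound {p} d<n with go b ≤-refl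
    where
    d = ∥ p ∥
    go : ∀ B → B ≤ b → (length (squaresUpTo p B) ≡ 0 × (∀ i → i < B → ¬ (0 < #squares p (suc i)))) ⊎
         (∃ λ i → i < b × 0 < #squares p (suc i) × length (squaresUpTo p B) ≤ i * d + #squares p (suc i) × i < B ×
             (∀ i′ → i′ < B → 0 < #squares p (suc i′) → i′ ≤ i))
    go zero _ = inj₁ (refl , λ i ())
    go (suc B) B<b with go B (<⇒≤ B<b) | 0 <? #squares p (suc B)
    ... | prev | yes pos = inj₂ (B , B<b , pos , subst (_≤ B * d + #squares p (suc B)) (sym (length-squaresUpTo p B))
            (≤-trans (+-monoʳ-≤ _ (all B)) (≤-reflexive (+-comm _ (B * d)))) , ≤-refl , λ i′ i′<sB _ → ≤-pred i′<sB)
      where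
      all : ∀ B → length (squaresUpTo p B) ≤ B * d
      all zero = z≤n
      all (suc B) = ≤-trans (≤-reflexive (length-squaresUpTo p B))
        (+-mono-≤ (#squares≤d p (suc B)) (all B))
    ... | prev | no ¬pos with n≮0⇒n≡0 ¬pos
      where
      n≮0⇒n≡0 : ∀ {x} → ¬ (0 < x) → x ≡ 0
      n≮0⇒n≡0 {zero} _ = refl
      n≮0⇒n≡0 {suc x} h = ⊥-elim (h z<s)
    ... | k≡0 with prev
    ... | inj₁ (e , none) = inj₁ (trans len e , λ i i<sB → case i (i ≟ B) i<sB)
      where
      len : length (squaresUpTo p (suc B)) ≡ length (squaresUpTo p B)
      len = trans (length-squaresUpTo p B) (cong (_+ length (squaresUpTo p B)) k≡0)
      case : ∀ i → Dec (i ≡ B) → i < suc B → ¬ (0 < #squares p (suc i))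
      case i (yes refl) _ = ¬pos
      case i (no ne) i<sB = none i (≤∧≢⇒< (≤-pred i<sB) ne)
    ... | inj₂ (i , i<b , pos , le , i<B , max) = inj₂ (i , i<b , pos , subst (_≤ i * d + #squares p (suc i))
        (sym len) le , m<n⇒m<1+n i<B ,
            λ i′ i′<sB → case i′ (i′ ≟ B) i′<sB)
      where
      len : length (squaresUpTo p (suc B)) ≡ length (squaresUpTo p B)
      len = trans (length-squaresUpTo p B) (cong (_+ length (squaresUpTo p B)) k≡0)
      case : ∀ i′ → Dec (i′ ≡ B) → i′ < suc B → 0 < #squares p (suc i′) → i′ ≤ i
      case i′ (yes refl) _ h = ⊥-elim (¬pos h)
      case i′ (no ne) i′<sB h = max i′ (≤∧≢⇒< (≤-pred i′<sB) ne) h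
  ... | inj₁ (N≡0 , none) = record { I = 0 ; N≤Id = ≤-reflexive N≡0 ; N+Id≤T+1 = subst (_≤ suc (T p))
      (sym (trans (+-identityʳ (N p)) N≡0)) z≤n
        ; I-max = λ i i<b pos → ⊥-elim (none i i<b pos) ; N≤K = λ () }
  ... | inj₂ (i , i<b , pos , le , _ , max) = record { I = suc i
        ; N≤Id = (lin 0 (le ⊞ (#squares≤d p (suc i))) (solve 4 (λ a b c d → a :+ (b :+ c :+ d) :+ con 0 :=
            d :+ b :+ (a :+ c)) refl (N p) (i * ∥ p ∥) (#squares p (suc i)) (∥ p ∥)))
        ; N+Id≤T+1 = bound pos refl
        ; I-max = λ i′ i′<b pos′ → s≤s (max i′ i′<b pos′)
        ; N≤K = λ { refl → le } }
    where
    bound : ∀ {K} → 0 < K → K ≡ #squares p (suc i) → N p + (∥ p ∥ + i * ∥ p ∥) ≤ suc (T p)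
    bound {suc κ} _ e = (lin 0 (le ⊞ (≤-reflexive (sym e)) ⊞ (T-max {p} l<n av))
        (solve 6 (λ a b c d e f → a :+ (b :+ c) :+ (c :+ d :+ (con 1 :+ e) :+ f) :+ con 0 := con
        1 :+ f :+ (a :+ d :+ (b :+ con 2 :* c :+ e))) refl (N p) (∥ p ∥) (i * ∥ p ∥) (#squares p (suc i)) κ (T p)))
      where
      av : Available p (∥ p ∥ + 2 * (i * ∥ p ∥) + κ)
      av = inj₂ (i , i<b , m≤m+n _ κ , +-monoʳ-< (∥ p ∥ + 2 * (i * ∥ p ∥)) (≤-reflexive e))
      l<n : ∥ p ∥ + 2 * (i * ∥ p ∥) + κ < n
      l<n = full⇒<n {p} d<n (available⇒full {p} av)

  -- Every square with root of length at most b occurring in W is listed under its class: the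
  -- root is a power of its primitive root, which is a conjugate of the word of the class.
  square-class : ∀ {s m} → 0 < m → m ≤ b → Run m s m →
    ∃ λ p → p ∈ classes × ∃ λ i → ∃ λ j → (p , i , j) ∈ squares p × m ≡ i * ∥ p ∥ ×
        (∀ t → t < 2 * m → W (s + t) ≡ word p (j + t))
  square-class {s} {m} 0<m m≤b run with primitive-root Finₚ._≟_ (λ t → W (s + t)) m 0<m
  ... | g , 0<g , divides (suc i) m≡ , Pg , pr = found (class-of-run {g} {s} {m′} 0<g (≤-<-trans (≤-trans g≤m m≤b)
      b<n) g≤m′ pr run-g)
    where
    g∣m : g ∣ m
    g∣m = divides (suc i) m≡
    g≤m : g ≤ m
    g≤m = ∣⇒≤ {{>-nonZero 0<m}} g∣m
    m′ = m + i * g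
    m′+g : m′ + g ≡ 2 * m
    m′+g = trans (+-assoc m (i * g) g) (trans (cong (m +_) (trans (+-comm (i * g) g) (sym m≡)))
        (solve 1 (λ x → x :+ x := con 2 :* x) refl m))
    g≤m′ : g ≤ m′
    g≤m′ = ≤-trans g≤m (m≤m+n m (i * g))
    run-g : Run g s m′
    run-g = Period⇒Run (subst (Period (λ t → W (s + t)) g) (sym m′+g) (Period-extend 0<g 0<m g∣m ≤-refl
      (subst (Period (λ t → W (s + t)) m) (solve 1 (λ x → x :+ x := con 2 :* x) refl m) (Run⇒Period run)) Pg))
    found : (∃ λ p → IsClass p × ∥ p ∥ ≡ g × ∃ λ j → j < g × (∀ t → t < m′ + g → W (s + t) ≡ word p (j + t))) → _
    found (p , isC , refl , j , j<g , h) = p , ∈-classes⁺ isC , suc i , j ,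
        ∈-squares b (s≤s z≤n) i≤b j<g (subst (_≤ b) m≡ m≤b , Occ-at s λ t lt → h t
            (subst (t <_) (trans (cong (2 *_) (sym m≡)) (sym m′+g)) lt)) ,
        m≡ , λ t lt → h t (subst (t <_) (sym m′+g) lt)
      where
      i≤b : suc i ≤ b
      i≤b = ≤-trans (≤-trans (m≤m*n (suc i) ∥ p ∥) (≤-reflexive (sym m≡))) m≤b
  ... | g , 0<g , divides zero m≡ , Pg , pr = ⊥-elim (<-irrefl (sym m≡) 0<m)

  -- Windows, cycles and the bound at one level

  -- The window of length m at i does not occur earlier; windows are represented by their
  -- first occurrences.
  First : ℕ → ℕ → Set
  First m i = ∀ i′ → i′ < i → ¬ Eq m i′ i

  abstract
    First? : ∀ m i → Dec (First m i)
    First? m i = allBelow? (λ i′ → ¬? (Eq? m i′ i)) i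

  -- The number of distinct windows of length m of W.
  windows : ℕ → ℕ
  windows m = count (First? m) n

  abstract
    first-spec : ∀ m i → ∃ λ r → r < n × Eq m r i × First m r
    first-spec m i with least (λ r → Eq? m r (i % n)) (i % n) (λ _ _ → refl)
    ... | r , r≤ , eq , min = r , ≤-<-trans r≤ (m%n<n i n) , Eq-trans {i = r} {i % n} {i} eq (Eq-% m i) ,
          λ i′ i′<r h → min i′ i′<r (Eq-trans {i = i′} {r} {i % n} h eq)

  -- The first occurrence of the window of length m at i.
  vertex : ℕ → ℕ → ℕ
  vertex m i = proj₁ (first-spec m i)

  vertex-Eq : ∀ m i → Eq m (vertex m i) i
  vertex-Eq m i = proj₁ (proj₂ (proj₂ (first-spec m i)))

  First-unique : ∀ {m i j} → First m i → First m j → Eq m i j → i ≡ j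
  First-unique {m} {i} {j} fi fj h with <-cmp i j
  ... | tri≈ _ e _ = e
  ... | tri< i<j _ _ = ⊥-elim (fj i i<j h)
  ... | tri> _ _ j<i = ⊥-elim (fi j j<i (Eq-sym {i = i} h))

  vertex-cong : ∀ {m i j} → Eq m i j → vertex m i ≡ vertex m j
  vertex-cong {m} {i} {j} h = First-unique {m} (proj₂ (proj₂ (proj₂ (first-spec m i))))
      (proj₂ (proj₂ (proj₂ (first-spec m j))))
    (Eq-trans {i = vertex m i} {i} {vertex m j} (vertex-Eq m i) (Eq-trans {i = i} {j} {vertex m j} h
        (Eq-sym {i = vertex m j} (vertex-Eq m j))))

  vertex-first : ∀ {m i} → First m i → vertex m i ≡ i
  vertex-first {m} {i} fi = First-unique {m} (proj₂ (proj₂ (proj₂ (first-spec m i)))) fi (vertex-Eq m i)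

  -- The cycle of p is present at the levels d ≤ l ≤ T, where d is the length of p: the
  -- windows of length l of its sequence all occur, joined in a cycle by those of length l + 1.
  Present : ℕ → Class → Set
  Present l p = ∥ p ∥ ≤ l × l ≤ T p

  abstract
    Present? : ∀ l p → Dec (Present l p)
    Present? l p = (∥ p ∥ ≤? l) ×-dec (l ≤? T p)

  present : ℕ → List Class
  present l = filter (Present? l) classes

  -- The squares of p are charged to the last N p of these levels, at which p is active.
  Active : ℕ → Class → Set
  Active l p = T p < l + N p × l ≤ T p

  abstract
    Active? : ∀ l p → Dec (Active l p)
    Active? l p = (T p <? l + N p) ×-dec (l ≤? T p)

  active : ℕ → List Class
  active l = filter (Active? l) classes

  active⇒present : ∀ {l p} → IsClass p → Active l p → Present l p
  active⇒present {l} {p} isC (lt , le) = go (I) N≤Id N+Id≤T+1 , le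
    where
    open TopBound (topBound {p} (proj₁ isC))
    go : ∀ i → N p ≤ i * ∥ p ∥ → N p + i * ∥ p ∥ ≤ suc (T p) → ∥ p ∥ ≤ l
    go zero h _ = ⊥-elim (lin⊥ 0 (h ⊞ lt ⊞ le) (solve 3 (λ a b c → con 0 :+ (a :+ b) :+ c :+ (con 1 :+ con 0) :=
        b :+ (con 1 :+ c) :+ a) refl l (N p) (T p)))
    go (suc i) _ h = (lin (i * ∥ p ∥) (h ⊞ lt) (solve 5 (λ a b c d e → a :+ (con 1 :+ b :+ (c :+ d)) :+ e :=
        c :+ (d :+ (a :+ e) :+ (con 1 :+ b))) refl (∥ p ∥) (T p) l (N p) (i * ∥ p ∥)))

  -- If the word spelled by p from phase 0 on, of length l + 1 > ∥ p ∥, also lies on a shorter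
  -- cycle q, then the least word of p has the border of length ∥ p ∥ - ∥ q ∥.
  matches⇒<⊥ : ∀ {l p q i j} → IsClass p → ∥ p ∥ ≤ l → (∀ t → t < suc l → W (i + t) ≡ word p t) →
               (∀ t → t < suc l → W (i + t) ≡ word q (j + t)) → ¬ ∥ q ∥ < ∥ p ∥
  matches⇒<⊥ {l} {p} {q} {i} {j} isC d≤l hp hq lt = class-unbordered {p} isC ∥ q ∥ z<s lt λ t t+d<d →
    let t+d<l = <-≤-trans t+d<d (≤-trans d≤l (n≤1+n l)) in
    trans (sym (hp t (≤-<-trans (m≤m+n t ∥ q ∥) t+d<l))) (trans (hq t (≤-<-trans (m≤m+n t ∥ q ∥) t+d<l))
      (trans (sym (word-period q (j + t))) (trans (cong (word q) (+-assoc j t ∥ q ∥))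
          (trans (sym (hq (t + ∥ q ∥) t+d<l)) (hp (t + ∥ q ∥) t+d<l)))))

  -- The graph whose vertices are the windows of length l and whose edges are the windows of
  -- length l + 1, leading from their prefix to their suffix; W is a closed walk through all
  -- of it.  From the cycle of each present class the edge spelled from phase 0 is deleted.
  module Graph (l : ℕ) where

    Matches : Class → ℕ → Set
    Matches p i = ∀ t → t < suc l → W (i + t) ≡ word p t

    Matches-Eq : ∀ {p i j} → Eq (suc l) i j → Matches p i → Matches p j
    Matches-Eq h m t t<sl = trans (sym (h t t<sl)) (m t t<sl)

    -- The edge at position e is deleted from one of the cycles.
    Removed : ℕ → Set
    Removed e = Any.Any (λ p → Matches p e) (present l)

    abstract
      Removed? : ∀ e → Dec (Removed e)
      Removed? e = Any.any? (λ p → allBelow? (λ t → W (e + t) Finₚ.≟ word p t) (suc l)) (present l)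

    edges : List ℕ
    edges = sel (λ e → First? (suc l) e ×-dec ¬? (Removed? e)) n

    -- The two vertices joined by the edge at position e.
    ends : ℕ → ℕ × ℕ
    ends e = vertex l e , vertex l (suc e)

    present⁻ : ∀ {p} → p ∈ present l → IsClass p × Present l p
    present⁻ {p} p∈ = let (p∈C , pr) = ∈-filter⁻ (Present? l) {xs = classes} p∈ in ∈-classes⁻ p∈C , pr

    Eq-suc : ∀ {m i j} → Eq (suc m) i j → Eq m (suc i) (suc j)
    Eq-suc {m} {i} {j} h t t<m = trans (cong W (sym (+-suc i t))) (trans (h (suc t) (s≤s t<m)) (cong W (+-suc j t)))

    -- The graph remains connected: a labelling f of the vertices that is constant along the
    -- remaining edges is constant along W.  Its value at position i is g i.
    module _ (f : ℕ → ℕ) (resp : ∀ {a c} → (a , c) ∈ map ends edges → f a ≡ f c) where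

      g : ℕ → ℕ
      g i = f (vertex l i)

      g-cong : ∀ {i j} → Eq l i j → g i ≡ g j
      g-cong {i} {j} h = cong f (vertex-cong {l} {i} {j} h)

      g-edge : ∀ i → ¬ Removed i → g i ≡ g (suc i)
      g-edge i ¬rem with first-spec (suc l) i
      ... | e , e<n , eq , fst = trans (sym (g-cong {e} {i} (Eq-≤ {i = e} {i} (n≤1+n l) eq)))
          (trans (resp (∈-map⁺ ends
              (∈-sel⁺ (λ e → First? (suc l) e ×-dec ¬? (Removed? e)) e<n
                  (fst , λ r → ¬rem (Any.map (λ {p} → Matches-Eq {p} {e} {i} eq) r)))))
              (g-cong {suc e} {suc i} (Eq-suc {l} {e} {i} eq)))

      -- By induction on the length of the cycle, the ends of a deleted edge carry equal labels:
      -- the rest of its cycle joins them.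
      g-removed : ∀ d → ∀ {p} → p ∈ present l → ∥ p ∥ ≡ d → ∀ i → Matches p i → g i ≡ g (suc i)
      g-removed = <-rec (λ d → ∀ {p} → p ∈ present l → ∥ p ∥ ≡ d → ∀ i → Matches p i → g i ≡ g (suc i)) step
        where
        step : ∀ d → (∀ {d′} → d′ < d → ∀ {p} → p ∈ present l → ∥ p ∥ ≡ d′ → ∀ i → Matches p i → g i ≡ g (suc i)) →
               ∀ {p} → p ∈ present l → ∥ p ∥ ≡ d → ∀ i → Matches p i → g i ≡ g (suc i)
        step d rec {p} p∈ refl i m = trans (g-cong {i} {pos 0} λ t t<l → trans (m t (m<n⇒m<1+n t<l))
            (sym (pos-matches 0 t (m<n⇒m<1+n t<l))))
            (trans (sym (loop (proj₁ p) ≤-refl)) (g-cong {suc (pos 0)} {suc i} (Eq-suc {l} {pos 0} {i} λ t t<sl →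
                trans (pos-matches 0 t t<sl) (sym (m t t<sl)))))
          where
          isC = proj₁ (present⁻ p∈)
          d≤l = proj₁ (proj₂ (present⁻ p∈))
          occ : ∀ j → Occ p j (suc l)
          occ = T-full p (proj₂ (proj₂ (present⁻ p∈)))
          pos : ℕ → ℕ
          pos j = Occ.position (occ j)
          pos-matches : ∀ j t → t < suc l → W (pos j + t) ≡ word p (j + t)
          pos-matches j = Occ.matches (occ j)
          next : ∀ j → g (suc (pos j)) ≡ g (pos (suc j))
          next j = g-cong {suc (pos j)} {pos (suc j)} λ t t<l → trans (cong W (sym (+-suc (pos j) t)))
            (trans (pos-matches j (suc t) (s≤s t<l)) (trans (cong (word p) (+-suc j t))
                (sym (pos-matches (suc j) t (m<n⇒m<1+n t<l)))))
          -- An edge of the cycle other than the one deleted from it, if deleted at all, was deleted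
          -- from a shorter cycle.
          across : ∀ j → 0 < j → j < ∥ p ∥ → g (pos j) ≡ g (suc (pos j))
          across j 0<j j<d with Removed? (pos j)
          ... | no ¬rem = g-edge (pos j) ¬rem
          ... | yes rem with find rem
          ... | q , q∈ , mq with <-cmp ∥ q ∥ ∥ p ∥
          ... | tri< lt _ _ = rec lt q∈ refl (pos j) mq
          ... | tri> _ _ gt = ⊥-elim (matches⇒<⊥ {l} {q} {p} {pos j} {j} (proj₁ (present⁻ q∈))
              (proj₁ (proj₂ (present⁻ q∈))) mq (pos-matches j) gt)
          ... | tri≈ _ e _ = ⊥-elim (<⇒≱ j<d (∣⇒≤ {{>-nonZero 0<j}} (class-rotation {p} isC j 0<j fix)))
            where
            q≡p : q ≡ p
            q≡p = class-conjugate {q} {p} (proj₁ (present⁻ q∈)) isC e j λ t t<d →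
              let t<sl = <-≤-trans t<d (≤-trans (≤-reflexive e) (≤-trans d≤l (n≤1+n l))) in trans (sym (mq t t<sl))
                  (pos-matches j t t<sl)
            fix : ∀ t → t < ∥ p ∥ → word p (j + t) ≡ word p t
            fix t t<d = let t<sl = <-≤-trans t<d (≤-trans d≤l (n≤1+n l)) in
              trans (sym (pos-matches j t t<sl)) (trans (mq t t<sl) (cong (λ z → word z t) q≡p))
          loop : ∀ j → suc j ≤ ∥ p ∥ → g (suc (pos 0)) ≡ g (pos 0)
          loop j _ = trans (walk (proj₁ p) ≤-refl) (g-cong {pos ∥ p ∥} {pos 0} λ t t<l → trans
              (pos-matches ∥ p ∥ t (m<n⇒m<1+n t<l))
            (trans (cong (word p) (+-comm ∥ p ∥ t))
                (trans (word-period p t) (sym (pos-matches 0 t (m<n⇒m<1+n t<l))))))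
            where
            walk : ∀ j → j < ∥ p ∥ → g (suc (pos 0)) ≡ g (pos (suc j))
            walk zero _ = next 0
            walk (suc j) lt = trans (walk j (<-trans (n<1+n j) lt)) (trans (across (suc j) z<s lt) (next (suc j)))

      g-constant : ∀ i → g i ≡ g 0
      g-constant zero = refl
      g-constant (suc i) with Removed? i
      ... | no ¬rem = trans (sym (g-edge i ¬rem)) (g-constant i)
      ... | yes rem with find rem
      ... | p , p∈ , m = trans (sym (g-removed ∥ p ∥ p∈ refl i m)) (g-constant i)

    -- As many edges are deleted as there are cycles, since no edge is deleted twice; the others
    -- still connect all vertices.
    cycles-bound : length (present l) + windows l ≤ suc (windows (suc l))
    cycles-bound = (lin 0 (vertices ⊞ (≤-reflexive (length-map ends edges)) ⊞ (≤-reflexive split) ⊞ removed)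
        (solve 6 (λ a b c d e f → a :+ b :+ (c :+ con 1 :+ d :+ e :+ f) :+ con 0 := con
        1 :+ e :+ (b :+ c :+ (f :+ d) :+ a)) refl (length (present l)) (windows l) (length (map ends edges))
        (length edges) (windows (suc l)) (count (λ e → First? (suc l) e ×-dec Removed? e) n)))
      where
      split = count-split (First? (suc l)) Removed? n
      vertices = connected-bound (sel (First? l) n) (map ends edges) (sel-unique (First? l) n) λ f resp {x} {y} x∈ y∈
          →
        trans (same f resp x∈) (sym (same f resp y∈))
        where
        same : ∀ f (resp : ∀ {a c} → (a , c) ∈ map ends edges → f a ≡ f c) {x} → x ∈ sel (First? l) n → f x ≡ g f
            resp 0
        same f resp {x} x∈ = trans (cong f (sym (vertex-first {l} (proj₂ (∈-sel⁻ (First? l) {n} x∈)))))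
            (g-constant f resp x)
      removed : length (present l) ≤ count (λ e → First? (suc l) e ×-dec Removed? e) n
      removed = injection-length Matches (Uniqueₚ.filter⁺ (Present? l) classes-unique) hit inj
        where
        hit : ∀ {p} → p ∈ present l → ∃ λ e → e ∈ sel (λ e → First? (suc l) e ×-dec Removed? e) n × Matches p e
        hit {p} p∈ with T-full p (proj₂ (proj₂ (present⁻ p∈))) 0
        ... | occurs i i<n m with first-spec (suc l) i
        ... | e , e<n , eq , fst = e , ∈-sel⁺ (λ e → First? (suc l) e ×-dec Removed? e) e<n (fst , lose p∈ me) , me
          where
          me : Matches p e
          me = Matches-Eq {p} {i} {e} (Eq-sym {i = e} eq) m
        inj : ∀ {p q e} → p ∈ present l → q ∈ present l → Matches p e → Matches q e → p ≡ q
        inj {p} {q} {e} p∈ q∈ mp mq with <-cmp ∥ p ∥ ∥ q ∥ | present⁻ p∈ | present⁻ q∈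
        ... | tri< lt _ _ | _ | Cq , d≤l , _ = ⊥-elim (matches⇒<⊥ {l} {q} {p} {e} {0} Cq d≤l mq mp lt)
        ... | tri> _ _ gt | Cp , d≤l , _ | _ = ⊥-elim (matches⇒<⊥ {l} {p} {q} {e} {0} Cp d≤l mp mq gt)
        ... | tri≈ _ d≡ _ | Cp , d≤l , _ | Cq , _ = class-unique {p} {q} Cp Cq d≡ λ t t<d →
              let t<sl = <-≤-trans t<d (≤-trans d≤l (n≤1+n l)) in trans (sym (mp t t<sl)) (mq t t<sl)

  active-count : ℕ → ℕ
  active-count l = length (active l)

  active≤present : ∀ l → active-count l ≤ length (present l)
  active≤present l = injection-length _≡_ (Uniqueₚ.filter⁺ (Active? l) classes-unique)
    (λ {p} p∈ → let (p∈C , a) = ∈-filter⁻ (Active? l) {xs = classes} p∈ in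
      p , ∈-filter⁺ (Present? l) p∈C (active⇒present (∈-classes⁻ p∈C) a) , refl) λ { _ _ refl refl → refl }

  level-bound : ∀ l → active-count l + windows l ≤ suc (windows (suc l))
  level-bound l = ≤-trans (+-monoˡ-≤ (windows l) (active≤present l)) (Graph.cycles-bound l)

  -- The level l is good if level-bound is not attained there.
  Good : ℕ → Set
  Good l = active-count l + windows l ≤ windows (suc l)

  abstract
    Good? : ∀ l → Dec (Good l)
    Good? l = active-count l + windows l ≤? windows (suc l)

  -- A class whose cycle is present but not active at l improves the bound by one.
  idle⇒good : ∀ {p l} → IsClass p → ∥ p ∥ ≤ l → l + N p ≤ T p → Good l
  idle⇒good {p} {l} isC d≤l le = (lin 0 ((Graph.cycles-bound l) ⊞ extra)
      (solve 4 (λ a b c d → a :+ b :+ (con 1 :+ c :+ d) :+ con 0 := c :+ (d :+ b :+ (con 1 :+ a))) refl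
      (active-count l) (windows l) (windows (suc l)) (length (present l))))
    where
    extra : suc (active-count l) ≤ length (present l)
    extra = injection-length _≡_
        (All.tabulate (λ {q} q∈ e → <⇒≱
        (proj₁ (proj₂ (∈-filter⁻ (Active? l) {xs = classes} (subst (_∈ active l) (sym e) q∈)))) le)
        AllPairs.∷ Uniqueₚ.filter⁺ (Active? l) classes-unique)
      (λ { (here refl) → p , ∈-filter⁺ (Present? l) (∈-classes⁺ isC) (d≤l , ≤-trans (m≤m+n l (N p)) le) , refl
         ; {q} (there q∈) → let (q∈C , a) = ∈-filter⁻ (Active? l) {xs = classes} q∈ in q , ∈-filter⁺ (Present? l) q∈C
             (active⇒present (∈-classes⁻ q∈C) a) , refl })
      λ { _ _ refl refl → refl }

  -- The number of codes of squares, all of which are charged to levels below n.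
  total-squares : ℕ
  total-squares = length (concatMap squares classes)

  total-squares≤ : total-squares ≤ sumBelow active-count n
  total-squares≤ = ≤-trans (≤-reflexive (length-concatMap squares classes))
      (≤-trans (sums classes λ p∈ → p∈) (≤-reflexive (sym (double-count Active? classes n))))
    where
    counted : ∀ {p} → IsClass p → N p ≤ count (λ l → Active? l p) n
    counted {p} isC with m≤n⇒∃[o]o+m≡n {N p} {suc (T p)}
        (≤-trans (m≤m+n (N p) _) (TopBound.N+Id≤T+1 (topBound {p} (proj₁ isC))))
    ... | a , e = ≤-trans (≤-trans (m≤n+m (N p) (count (λ l → Active? l p) a))
        (≤-reflexive (sym (count-all (λ l → Active? l p) a (N p) act))))
          (count-mono (λ l → Active? l p) (≤-trans (≤-reflexive e) (T<n p)))
      where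
      act : ∀ t → t < N p → Active (a + t) p
      act t t<N = (lin t ((≤-reflexive (sym e))) (solve 4 (λ a b c d → con 1 :+ a :+ (b :+ c) :+ d :=
          b :+ d :+ c :+ (con 1 :+ a)) refl (T p) a (N p) t)) , (lin 0 ((≤-reflexive e) ⊞ t<N)
          (solve 4 (λ a b c d → a :+ b :+ (con 1 :+ c :+ d) :+ con 0 := c :+ (a :+ d :+ (con 1 :+ b))) refl a t (T p)
          (N p)))
    sums : ∀ ps → (∀ {p} → p ∈ ps → p ∈ classes) → sumOver N ps ≤ sumOver (λ p → count (λ l → Active? l p) n) ps
    sums [] _ = z≤n
    sums (p ∷ ps) sub = +-mono-≤ (counted (∈-classes⁻ (sub (here refl)))) (sums ps λ q∈ → sub (there q∈))

  abstract
    NotGood? : ∀ l → Dec (0 < l × ¬ Good l)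
    NotGood? l = (0 <? l) ×-dec ¬? (Good? l)

  notGood-count : ℕ → ℕ
  notGood-count m = count NotGood? m

  -- Summing the bounds over the levels 1, …, m.  No class is active at level 0.
  telescope : ∀ m → sumBelow active-count (suc m) + windows 1 ≤ windows (suc m) + notGood-count (suc m)
  telescope zero = subst (λ z → z + 0 + windows 1 ≤ windows 1 + notGood-count 1) (sym none)
      (m≤m+n (windows 1) (notGood-count 1))
    where
    none : active-count 0 ≡ 0
    none = n≤0⇒n≡0 (≮⇒≥ λ pos → nothing (active 0) pos λ p∈ → p∈)
      where
      nothing : ∀ ps → 0 < length ps → ¬ (∀ {p} → p ∈ ps → p ∈ active 0)
      nothing (p ∷ ps) _ sub with ∈-filter⁻ (Active? 0) {xs = classes} (sub (here refl))
      ... | p∈C , a with proj₁ (active⇒present (∈-classes⁻ p∈C) a)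
      ... | ()
  telescope (suc m) = case (Good? (suc m))
    where
    ih = telescope m
    case : Dec (Good (suc m)) → sumBelow active-count (suc (suc m)) + windows 1 ≤ windows
        (suc (suc m)) + notGood-count (suc (suc m))
    case (yes good) = (lin 0 (good ⊞ ih ⊞ (count-mono-suc NotGood? (suc m)))
        (solve 7 (λ a b c d e f g → a :+ b :+ c :+ (d :+ (e :+ f) :+ g) :+ con 0 :=
        d :+ g :+ (a :+ e :+ (b :+ c) :+ f)) refl (active-count (suc m)) (sumBelow active-count (suc m)) (windows 1)
        (windows (suc (suc m))) (windows (suc m)) (notGood-count (suc m)) (notGood-count (suc (suc m)))))
    case (no ¬good) = (lin 0 ((level-bound (suc m)) ⊞ ih ⊞
        (≤-reflexive (sym (count-suc-yes NotGood? {suc m} (z<s , ¬good)))))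
        (solve 7 (λ a b c d e f g → a :+ b :+ c :+ (con 1 :+ d :+ (e :+ f) :+ g) :+ con 0 :=
        d :+ g :+ (a :+ e :+ (b :+ c) :+ (con 1 :+ f))) refl (active-count (suc m)) (sumBelow active-count (suc m))
        (windows 1) (windows (suc (suc m))) (windows (suc m)) (notGood-count (suc m)) (notGood-count (suc (suc m)))))

  -- Good levels

  -- No proper shift of W agrees with W on a whole period.
  no-shift : ∀ {s d} → 0 < d → d < n → ¬ Eq n s (s + d)
  no-shift {s} {d} 0<d d<n h = W-primitive d 0<d d<n (shift-all {s} λ t → trans (Eq-long {n} {s} {s + d} ≤-refl h t)
    (cong W (solve 3 (λ s d t → s :+ d :+ t := s :+ t :+ d) refl s d t)))

  -- The number of good levels among 1, …, X - 1.
  abstract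
    Good⁺? : ∀ l → Dec (0 < l × Good l)
    Good⁺? l = (0 <? l) ×-dec Good? l

  abstract
    G : ℕ → ℕ
    G X = count Good⁺? X

    G-range : ∀ a m {X} → 0 < a → a + m ≤ X → (∀ t → t < m → Good (a + t)) → G a + m ≤ G X
    G-range a m {X} 0<a le h = ≤-trans (≤-reflexive (sym (count-all Good⁺? a m λ t t<m → <-≤-trans 0<a (m≤m+n a t) ,
        h t t<m)))
      (count-mono Good⁺? le)

    G-notGood : ∀ m → notGood-count (suc m) + G (suc m) ≡ m
    G-notGood m = trans (+-comm (notGood-count (suc m)) (G (suc m)))
        (trans (count-split (λ l → 0 <? l) Good? (suc m)) (positive m))
      where
      positive : ∀ m → count (λ l → 0 <? l) (suc m) ≡ m
      positive zero = refl
      positive (suc m) = cong suc (positive m)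

  -- A run of primitive period d with m + d letters makes its class available at level m.
  class-length : ∀ {s d m} → 0 < d → d < n → d ≤ m → Primitive (λ t → W (s + t)) d → Run d s m →
    ∃ λ p → IsClass p × ∥ p ∥ ≡ d × m ≤ T p
  class-length {s} {d} {m} 0<d d<n d≤m pr run with class-of-run {d} {s} {m} 0<d d<n d≤m pr run
  ... | p , isC , refl , j , j<d , h = p , isC , refl , T-max {p} (full⇒<n {p} d<n (available⇒full {p} av)) av
    where
    av : Available p m
    av = inj₁ (j , j<d , Occ-at s λ t t< → h t (subst (t <_) (+-comm ∥ p ∥ m) t<))

  idle-end : ∀ {p} → IsClass p → ∃ λ e → e + N p ≡ suc (T p)
  idle-end {p} isC with m≤n⇒∃[o]o+m≡n {N p} {suc (T p)}
      (≤-trans (m≤m+n (N p) _) (TopBound.N+Id≤T+1 (topBound {p} (proj₁ isC))))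
  ... | e , eq = e , eq

  -- The good levels provided by a class are those with ∥ p ∥ ≤ l < e, where e = T + 1 - N.
  idle-good : ∀ {p e l} → IsClass p → e + N p ≡ suc (T p) → ∥ p ∥ ≤ l → l < e → Good l
  idle-good {p} {e} {l} isC eq d≤l l<e = idle⇒good {p} {l} isC d≤l (lin 0 ((≤-reflexive eq) ⊞ l<e)
      (solve 4 (λ a b c d → a :+ b :+ (con 1 :+ c :+ d) :+ con 0 := c :+ (d :+ b :+ (con 1 :+ a))) refl l (N p) (T p)
      e))

  -- A run of period g with m + g letters provides at least (m - 2 g) / 2 good levels, unless
  -- these levels are cut off at X.  The class of its primitive root provides the levels l with
  -- d ≤ l < e = T + 1 - N, where d ≤ g, and m < 2 e because m ≤ T and 2 N ≤ T + 1.
  save : ∀ X {g s m} → 0 < g → g < n → Run g s m → (m ≤ 2 * G X + 2 * g) ⊎ (X ≤ G X + g)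
  save X {g} {s} {m} 0<g g<n run with m ≤? 2 * g
  ... | yes m≤2g = inj₁ (lin (2 * (G X)) (m≤2g) (solve 3 (λ a b c → a :+ con 2 :* b :+ con 2 :* c := con
      2 :* c :+ con 2 :* b :+ a) refl m g (G X)))
  ... | no m≰2g with primitive-root Finₚ._≟_ (λ t → W (s + t)) g 0<g
  ... | d , 0<d , d∣g , Pd , pr with class-length {s} {d} {m} 0<d (≤-<-trans d≤g g<n) d≤m pr run-d
    where
    d≤g : d ≤ g
    d≤g = ∣⇒≤ {{>-nonZero 0<g}} d∣g
    d≤m : d ≤ m
    d≤m = (lin (g + 1) (d≤g ⊞ (≰⇒> m≰2g)) (solve 3 (λ a b c → a :+ (b :+ c) :+ (b :+ con 1) :=
        c :+ (a :+ (con 1 :+ con 2 :* b))) refl d g m))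
    run-d : Run d s m
    run-d = Period⇒Run (Period-≤ (+-monoʳ-≤ m d≤g) (Period-extend 0<d 0<g d∣g ≤-refl (Run⇒Period run) Pd))
  ... | p , isC , refl , m≤T with idle-end {p} isC
  ... | e , eq = decide (e ≤? X) (∥ p ∥ ≤? X)
    where
    open TopBound (topBound {p} (proj₁ isC))
    d≤g : ∥ p ∥ ≤ g
    d≤g = ∣⇒≤ {{>-nonZero 0<g}} d∣g
    2e : m < 2 * e
    2e = (lin 0 (m≤T ⊞ (≤-reflexive (sym eq)) ⊞ (≤-reflexive (sym eq)) ⊞ N≤Id ⊞ N+Id≤T+1)
        (solve 5 (λ a b c d e → con 1 :+ a :+ (b :+ (c :+ d) :+ (c :+ d) :+ e :+ (con 1 :+ b)) :+ con 0 := con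
        2 :* c :+ (a :+ (con 1 :+ b) :+ (con 1 :+ b) :+ d :+ (d :+ e))) refl m (T p) e (N p) (I * ∥ p ∥)))
    good-part : ∀ Y → ∥ p ∥ ≤ Y → Y ≤ e → Y ≤ X → Y ≤ G X + ∥ p ∥
    good-part Y d≤Y Y≤e Y≤X with m≤n⇒∃[o]m+o≡n d≤Y
    ... | r , refl = (lin (G ∥ p ∥) ((G-range ∥ p ∥ r {X} z<s Y≤X (λ t t<r → idle-good {p} {e} isC eq (m≤m+n ∥ p ∥ t)
        (<-≤-trans (+-monoʳ-< ∥ p ∥ t<r) Y≤e)))) (solve 4 (λ a b c d → a :+ b :+ c :+ d := c :+ a :+ (d :+ b)) refl
        (∥ p ∥) r (G X) (G ∥ p ∥)))
    decide : Dec (e ≤ X) → Dec (∥ p ∥ ≤ X) → (m ≤ 2 * G X + 2 * g) ⊎ (X ≤ G X + g)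
    decide (yes e≤X) _ with ∥ p ∥ ≤? e
    ... | yes d≤e = inj₁ (lin 1 (2e ⊞ (good-part e d≤e ≤-refl e≤X) ⊞ (good-part e d≤e ≤-refl e≤X) ⊞ d≤g ⊞ d≤g)
        (solve 5 (λ a b c d e → a :+ (con 2 :* b :+ (c :+ d) :+ (c :+ d) :+ e :+ e) :+ con 1 := con 2 :* c :+ con
        2 :* e :+ (con 1 :+ a :+ b :+ b :+ d :+ d)) refl m e (G X) (∥ p ∥) g))
    ... | no d≰e = inj₁ (lin (2 * (G X) + 3) (2e ⊞ (≰⇒> d≰e) ⊞ (≰⇒> d≰e) ⊞ d≤g ⊞ d≤g)
        (solve 5 (λ a b c d e → a :+ (con 2 :* b :+ c :+ c :+ d :+ d) :+ (con 2 :* e :+ con 3) := con 2 :* e :+ con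
        2 :* d :+ (con 1 :+ a :+ (con 1 :+ b) :+ (con 1 :+ b) :+ c :+ c)) refl m e (∥ p ∥) g (G X)))
    decide (no e≰X) (yes d≤X) = inj₂ (lin 0 ((good-part X d≤X (<⇒≤ (≰⇒> e≰X)) ≤-refl) ⊞ d≤g)
        (solve 4 (λ a b c d → a :+ (b :+ c :+ d) :+ con 0 := b :+ d :+ (a :+ c)) refl X (G X) (∥ p ∥) g))
    decide (no e≰X) (no d≰X) = inj₂ (lin ((G X) + 1) ((≰⇒> d≰X) ⊞ d≤g)
        (solve 4 (λ a b c d → a :+ (b :+ c) :+ (d :+ con 1) := d :+ c :+ (con 1 :+ a :+ b)) refl X (∥ p ∥) g (G X)))

  -- The window of length L at s is not repeated at a distance less than a.  If it is repeated
  -- at distance a ≤ L, this distance is then a primitive period.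
  Consecutive : ℕ → ℕ → ℕ → Set
  Consecutive L a s = ∀ g → 0 < g → g < a → ¬ Eq L s (s + g)

  run-of-divisor : ∀ {g a s L} → 0 < g → 0 < a → g ∣ a → a ≤ L → Run a s L → Period (λ t → W (s + t)) g a → Run g s L
  run-of-divisor {g} {a} {s} {L} 0<g 0<a g∣a a≤L run P = Period⇒Run
      (Period-≤ (+-monoʳ-≤ L (∣⇒≤ {{>-nonZero 0<a}} g∣a))
    (Period-extend 0<g 0<a g∣a ≤-refl (Run⇒Period run) P))

  consecutive-primitive : ∀ {L a s} → 0 < a → a ≤ L → Run a s L → Consecutive L a s → Primitive (λ t → W (s + t)) a
  consecutive-primitive {L} {a} {s} 0<a a≤L run cons g 0<g g<a g∣a P = cons g 0<g g<a
      (Run⇒Eq (run-of-divisor 0<g 0<a g∣a a≤L run P))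

  -- The window of length L at s has period a; unlike for Run, all letters compared lie inside
  -- the window.
  Within : ℕ → ℕ → ℕ → Set
  Within a s L = ∀ t → t + a < L → W (s + t) ≡ W (s + t + a)

  Run⇒Within : ∀ {a s L} → Run a s L → Within a s L
  Run⇒Within {a} run t lt = run t (≤-<-trans (m≤m+n t a) lt)

  Within-Eq : ∀ {a s s′ L} → Eq L s s′ → Within a s L → Within a s′ L
  Within-Eq {a} {s} {s′} {L} eq w t lt = trans (sym (eq t (≤-<-trans (m≤m+n t a) lt))) (trans (w t lt)
    (trans (cong W (+-assoc s t a)) (trans (eq (t + a) lt) (cong W (sym (+-assoc s′ t a))))))

  Within⇒Period : ∀ {a s L} → Within a s L → Period (λ t → W (s + t)) a L
  Within⇒Period {a} {s} w t lt = trans (w t lt) (cong W (+-assoc s t a))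

  -- If a window of length L = m + a has period a and is repeated at distance a + g, then the
  -- m + g letters from position s + a on have period g.
  run-gap : ∀ {a g s L} m → m + a ≡ L → Within a s L → Run (a + g) s L → Run g (s + a) m
  run-gap {a} {g} {s} {L} m refl w run t t<m = trans (cong W (solve 3 (λ s a t → s :+ a :+ t := s :+ t :+ a) refl s a
      t))
    (trans (sym (w t (+-monoˡ-< a t<m))) (trans (run t (<-≤-trans t<m (m≤m+n m a)))
      (cong W (solve 4 (λ s a t g → s :+ t :+ (a :+ g) := s :+ a :+ t :+ g) refl s a t g))))

  -- A window of length L occurs at positions i, i + a and i + σ with 0 < a < σ < n.
  Triple : ℕ → ℕ → Set
  Triple L σ = σ < n × (∃ λ i → i < n × (∃ λ a → a < σ × (0 < a × Eq L i (i + a) × Eq L i (i + σ))))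

  abstract
    Triple? : ∀ L σ → Dec (Triple L σ)
    Triple? L σ = (σ <? n) ×-dec anyUpTo?
        (λ i → anyUpTo? (λ a → (0 <? a) ×-dec (Eq? L i (i + a) ×-dec Eq? L i (i + σ))) σ) n

  -- Three close occurrences of a window

  -- L is a level in the upper half that is not good; below it, at least (2 L - n - 4) / 2
  -- levels are claimed to be good.
  module AtLevel (L : ℕ) (0<L : 0 < L) (L<n : L < n) (n≤2L : n ≤ 2 * L) (¬good : ¬ Good L) where

    Goal : Set
    Goal = 2 * L ≤ n + 4 + 2 * G (suc L)

    -- The good levels of a class end before L, since L itself is not good.
    idle-end≤L : ∀ {p e} → IsClass p → e + N p ≡ suc (T p) → ∥ p ∥ ≤ L → e ≤ L
    idle-end≤L {p} {e} isC eq d≤L = ≮⇒≥ λ L<e → ¬good (idle-good {p} {e} isC eq d≤L L<e)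

    -- A class with squares of exponent at least 2 provides the good levels d, …, 2 d - 1, where
    -- d is its length.
    power-class : ∀ {p i} → IsClass p → ∥ p ∥ ≤ L → N p + suc (suc i) * ∥ p ∥ ≤ suc (T p) → ∥ p ∥ ≤ G (suc L)
    power-class {p} {i} isC d≤L h with idle-end {p} isC
    ... | e , eq = (lin (G ∥ p ∥)
        ((G-range ∥ p ∥ ∥ p ∥ {suc L} z<s (≤-trans 2d≤e (≤-trans (idle-end≤L {p} {e} isC eq d≤L) (n≤1+n L)))
        (λ t t<d → idle-good {p} {e} isC eq (m≤m+n ∥ p ∥ t) (<-≤-trans (+-monoʳ-< ∥ p ∥ t<d) 2d≤e))))
            (solve 3 (λ a b c → a :+ b :+ c := b :+ (c :+ a)) refl (∥ p ∥) (G (suc L)) (G ∥ p ∥)))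
      where
      2d≤e : ∥ p ∥ + ∥ p ∥ ≤ e
      2d≤e = (lin (i * ∥ p ∥) ((≤-reflexive (sym eq)) ⊞ h)
          (solve 5 (λ a b c d e → a :+ a :+ (b :+ c :+ (con 1 :+ d)) :+ e :=
          b :+ (con 1 :+ d :+ (c :+ (a :+ (a :+ e))))) refl (∥ p ∥) e (N p) (T p) (i * ∥ p ∥)))

    -- A window of length L repeated at a primitive distance a, and a stretch of period g with
    -- L - a + g letters.  If L ≤ 2 a the stretch suffices.  Otherwise the class of period a
    -- either has squares of exponent at least 2, or provides the levels from a to L - a, while
    -- the stretch provides levels below a.
    finish : ∀ {a g s s′ m} → 0 < a → 0 < g → Run a s L → Primitive (λ t → W (s + t)) a → m + a ≡ L → Run g s′ m →
             a + 2 * (a + g) ≤ n → 2 * L ≤ n + a + 4 → Goal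
    finish {a} {g} {s} {s′} {m} 0<a 0<g run pr m+a run-g small L-bound = decide (L ≤? 2 * a)
      where
      g<n : g < n
      g<n = (lin (g + 2) (small ⊞ 0<a ⊞ 0<a ⊞ 0<a)
          (solve 3 (λ a b c → con 1 :+ a :+ (b :+ c :+ c :+ c) :+ (a :+ con 2) :=
          b :+ (c :+ con 2 :* (c :+ a) :+ (con 1 :+ con 0) :+ (con 1 :+ con 0) :+ (con 1 :+ con 0))) refl g n a))
      decide : Dec (L ≤ 2 * a) → Goal
      decide (yes L≤2a) with save (suc L) {g} {s′} {m} 0<g g<n run-g
      ... | inj₁ h = (lin 4 (h ⊞ (≤-reflexive (sym m+a)) ⊞ small ⊞ L≤2a)
          (solve 6 (λ a b c d e f → con 2 :* a :+ (con 2 :* b :+ con 2 :* c :+ (d :+ e) :+ f :+ con 2 :* e) :+ con 4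
          := f :+ con 4 :+ con 2 :* b :+ (d :+ a :+ (e :+ con 2 :* (e :+ c)) :+ a)) refl L (G (suc L)) g m a n))
      ... | inj₂ h = (lin (6 + 3 * a) (h ⊞ h ⊞ small)
          (solve 5 (λ a b c d e → con 2 :* a :+ (b :+ c :+ (b :+ c) :+ d) :+ (con 6 :+ con 3 :* e) := d :+ con
          4 :+ con 2 :* b :+ (con 1 :+ a :+ (con 1 :+ a) :+ (e :+ con 2 :* (e :+ c)))) refl L (G (suc L)) g n a))
      decide (no L≰2a) with class-length {s} {a} {L} 0<a (≤-<-trans a≤L L<n) a≤L pr run
        where
        a≤L : a ≤ L
        a≤L = (lin (a + 1) ((≰⇒> L≰2a)) (solve 2 (λ a b → a :+ b :+ (a :+ con 1) := b :+ (con 1 :+ con 2 :* a)) refl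
            a L))
      ... | p , isC , refl , L≤T = cases I refl
        where
        open TopBound (topBound {p} (proj₁ isC))
        2a<L : 2 * a < L
        2a<L = ≰⇒> L≰2a
        a≤L : ∥ p ∥ ≤ L
        a≤L = (lin (a + 1) (2a<L) (solve 2 (λ a b → a :+ b :+ (a :+ con 1) := b :+ (con 1 :+ con 2 :* a)) refl a L))
        low : N p ≤ a → Goal
        low N≤a with idle-end {p} isC | m≤n⇒∃[o]m+o≡n {a} {m} (lin 1 (2a<L ⊞ (≤-reflexive (sym m+a)))
            (solve 3 (λ a b c → a :+ (b :+ (c :+ a)) :+ con 1 := c :+ (con 1 :+ con 2 :* a :+ b)) refl a L m))
        ... | e , eq | r , refl = combine (save a {g} {s′} {a + r} 0<g g<n run-g)
          where
          upper : G a + suc r ≤ G (suc L)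
          upper = G-range a (suc r) {suc L} 0<a (lin a ((≤-reflexive m+a))
              (solve 3 (λ a b c → a :+ (con 1 :+ b) :+ c :+ a := con 1 :+ c :+ (a :+ b :+ a)) refl a r L)) λ t t≤r →
            idle-good {p} {e} {a + t} isC eq (m≤m+n a t)
                (lin 0 ((≤-reflexive (sym eq)) ⊞ N≤a ⊞ L≤T ⊞ (≤-reflexive m+a) ⊞ t≤r)
                (solve 7 (λ a b c d e f g → con 1 :+ (a :+ b) :+ (c :+ d :+ a :+ e :+ f :+ (con 1 :+ g)) :+ con 0 :=
                c :+ (con 1 :+ e :+ d :+ f :+ (a :+ g :+ a) :+ (con 1 :+ b))) refl a t e (N p) (T p) L r))
          combine : _ → Goal
          combine (inj₁ h) = (lin (6 + r) (upper ⊞ upper ⊞ h ⊞ (≤-reflexive (sym m+a)) ⊞ (≤-reflexive (sym m+a)) ⊞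
              small) (solve 7 (λ a b c d e f g → con 2 :* a :+ (b :+ b :+ (con 2 :* c :+ con 2 :* d) :+ (e :+ f :+ e)
              :+ (e :+ f :+ e) :+ g) :+ (con 6 :+ f) := g :+ con 4 :+ con
              2 :* b :+ (c :+ (con 1 :+ f) :+ (c :+ (con 1 :+ f)) :+ (e :+ f) :+ a :+ a :+ (e :+ con 2 :* (e :+ d))))
              refl L (G (suc L)) (G a) g a r n))
          combine (inj₂ h) = (lin (6 + (G a) + g) (upper ⊞ upper ⊞ h ⊞ (≤-reflexive (sym m+a)) ⊞
              (≤-reflexive (sym m+a)) ⊞ small)
              (solve 7 (λ a b c d e f g → con 2 :* a :+ (b :+ b :+ (c :+ d) :+ (e :+ f :+ e) :+ (e :+ f :+ e) :+ g)
              :+ (con 6 :+ c :+ d) := g :+ con 4 :+ con 2 :* b :+ (c :+ (con 1 :+ f) :+ (c :+ (con 1 :+ f)) :+ e :+ a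
              :+ a :+ (e :+ con 2 :* (e :+ d)))) refl L (G (suc L)) (G a) g a r n))
        cases : ∀ i → I ≡ i → Goal
        cases zero e = low (≤-trans (subst (λ z → N p ≤ z * a) e N≤Id) z≤n)
        cases (suc zero) e = low (≤-trans (subst (λ z → N p ≤ z * a) e N≤Id) (≤-reflexive (+-identityʳ a)))
        cases (suc (suc i)) e =
            (lin (G (suc L)) ((power-class {p} {i} isC a≤L (subst (λ z → N p + z * a ≤ suc (T p)) e N+Id≤T+1)) ⊞
            L-bound) (solve 4 (λ a b c d → con 2 :* a :+ (b :+ (c :+ d :+ con 4)) :+ b := c :+ con 4 :+ con
            2 :* b :+ (d :+ con 2 :* a)) refl L (G (suc L)) n a))

    -- One window of length L is repeated at distance lo from s, and at distance hi > lo from s′.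
    -- The stretch of period hi - lo comes from run-gap; lo + hi > L, for otherwise lo divides hi
    -- and the repetition at distance hi is not the next one.
    module Three {lo hi s s′} (0<lo : 0 < lo) (lo<hi : lo < hi) (run-lo : Run lo s L) (run-hi : Run hi s′ L)
        (same : Eq L s s′)
                 (cons-lo : Consecutive L lo s) (cons-hi : Consecutive L hi s′) (small : lo + 2 * hi ≤ n) where

      lo≤L : lo ≤ L
      lo≤L = (≮⇒≥ (λ h₋ → lin⊥ (4 + L) (small ⊞ lo<hi ⊞ lo<hi ⊞ n≤2L ⊞ h₋ ⊞ h₋ ⊞ h₋)
          (solve 4 (λ a b c d → a :+ b :+ b :+ con 2 :* c :+ d :+ d :+ d :+ (con 1 :+ (con 4 :+ c)) := d :+ con
          2 :* b :+ (con 1 :+ d) :+ (con 1 :+ d) :+ a :+ (con 1 :+ c) :+ (con 1 :+ c) :+ (con 1 :+ c)) refl n hi L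
          lo)))
      hi≤L : hi ≤ L
      hi≤L = (≮⇒≥ (λ h₋ → lin⊥ (lo + 1) (small ⊞ n≤2L ⊞ h₋ ⊞ h₋)
          (solve 4 (λ a b c d → a :+ con 2 :* b :+ c :+ c :+ (con 1 :+ (d :+ con 1)) := d :+ con
          2 :* c :+ a :+ (con 1 :+ b) :+ (con 1 :+ b)) refl n L hi lo)))

      within : Within lo s′ L
      within = Within-Eq {lo} {s} {s′} same (Run⇒Within run-lo)

      separated : L < lo + hi
      separated = ≰⇒> λ le → let
          lo∣hi = primitive-divides {f = λ t → W (s + t)} 0<lo (<-trans 0<lo lo<hi) (consecutive-primitive 0<lo lo≤L
              run-lo cons-lo) le
            (Within⇒Period (Run⇒Within run-lo)) (Within⇒Period (Within-Eq {hi} {s′} {s} (Eq-sym {i = s} same)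
                (Run⇒Within run-hi)))
        in cons-hi lo 0<lo lo<hi (Run⇒Eq (run-of-divisor 0<lo (<-trans 0<lo lo<hi) lo∣hi hi≤L run-hi
            (Period-≤ hi≤L (Within⇒Period within))))

      goal : Goal
      goal with m≤n⇒∃[o]m+o≡n (<⇒≤ lo<hi) | m≤n⇒∃[o]o+m≡n lo≤L
      ... | g , refl | m , m+lo = finish 0<lo
          (lin 0 (lo<hi) (solve 2 (λ a b → con 1 :+ con 0 :+ (a :+ b) :+ con 0 := b :+ (con 1 :+ a)) refl lo g))
          run-lo (consecutive-primitive 0<lo lo≤L run-lo cons-lo) m+lo
            (run-gap {lo} {g} {s′} m m+lo within run-hi) small
            (lin 6 (separated ⊞ separated ⊞ small)
                (solve 4 (λ a b c d → con 2 :* a :+ (b :+ (b :+ c) :+ (b :+ (b :+ c)) :+ d) :+ con 6 := d :+ b :+ con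
                4 :+ (con 1 :+ a :+ (con 1 :+ a) :+ (b :+ con 2 :* (b :+ c)))) refl L lo g n))

    -- Occurrences at s, s + a and s + 2 a form a run of period a with L + 2 a letters.  Here
    -- L + a ≤ n, for otherwise the distance r from s + 2 a to s + n would be a multiple of a and
    -- W would have period a.
    equal-gaps : ∀ {a s r} → 0 < a → a ≤ r → a + a + r ≡ n → Run a s L → Run a (s + a) L → Eq L s (s + a + a) →
        Consecutive L a s → Goal
    equal-gaps {a} {s} {r} 0<a a≤r total run run′ same cons with save (suc L) {a} {s} {L + a} 0<a a<n long
      where
      a<n : a < n
      a<n = (lin r ((≤-reflexive total) ⊞ 0<a)
          (solve 3 (λ a b c → con 1 :+ a :+ (b :+ a) :+ c := b :+ (a :+ a :+ c :+ (con 1 :+ con 0))) refl a n r))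
      long : Run a s (L + a)
      long t t< with t <? L
      ... | yes t<L = run t t<L
      ... | no t≮L with m≤n⇒∃[o]m+o≡n {a} {t}
          (≮⇒≥ (λ h₋ → lin⊥ (t + 2) ((≮⇒≥ t≮L) ⊞ (≮⇒≥ t≮L) ⊞ (≤-reflexive total) ⊞ a≤r ⊞ n≤2L ⊞ h₋ ⊞ h₋ ⊞ h₋)
          (solve 5 (λ a b c d e → a :+ a :+ b :+ c :+ con 2 :* d :+ e :+ e :+ e :+ (con 1 :+ (a :+ con 2)) :=
          d :+ d :+ (e :+ e :+ c) :+ e :+ b :+ (con 1 :+ a) :+ (con 1 :+ a) :+ (con 1 :+ a)) refl t n r L a)))
      ... | o , refl = trans (cong W (sym (+-assoc s a o)))
          (trans (run′ o (lin 0 (t<) (solve 3 (λ a b c → con 1 :+ a :+ (b :+ c) :+ con 0 := b :+ (con 1 :+ (c :+ a)))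
          refl o L a)))
              (cong W (cong (_+ a) (+-assoc s a o))))
    ... | inj₂ h = (lin (6 + r) (h ⊞ h ⊞ (≤-reflexive total))
        (solve 5 (λ a b c d e → con 2 :* a :+ (b :+ c :+ (b :+ c) :+ d) :+ (con 6 :+ e) := d :+ con 4 :+ con
        2 :* b :+ (con 1 :+ a :+ (con 1 :+ a) :+ (c :+ c :+ e))) refl L (G (suc L)) a n r))
    ... | inj₁ h = (lin 4 (h ⊞ (separated (r ≤? L)))
        (solve 4 (λ a b c d → con 2 :* a :+ (con 2 :* b :+ con 2 :* c :+ d) :+ con 4 := d :+ con 4 :+ con
        2 :* b :+ (a :+ c :+ (a :+ c))) refl L (G (suc L)) a n))
      where
      a≤L : a ≤ L
      a≤L = (≮⇒≥ (λ h₋ → lin⊥ (L + 2) ((≤-reflexive total) ⊞ a≤r ⊞ n≤2L ⊞ h₋ ⊞ h₋ ⊞ h₋)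
          (solve 4 (λ a b c d → a :+ b :+ con 2 :* c :+ d :+ d :+ d :+ (con 1 :+ (c :+ con 2)) :=
          d :+ d :+ b :+ d :+ a :+ (con 1 :+ c) :+ (con 1 :+ c) :+ (con 1 :+ c)) refl n r L a)))
      separated : Dec (r ≤ L) → L + a ≤ n
      separated (no r≰L) = (lin (1 + a) ((≰⇒> r≰L) ⊞ (≤-reflexive total))
          (solve 4 (λ a b c d → a :+ b :+ (c :+ d) :+ (con 1 :+ b) := d :+ (con 1 :+ a :+ (b :+ b :+ c))) refl L a r
          n))
      separated (yes r≤L) = ≮⇒≥ λ n<L+a → contradictory n<L+a
        where
        contradictory : n < L + a → ⊥
        contradictory n<L+a = no-shift {s} {a} 0<a (lin r ((≤-reflexive total) ⊞ 0<a)
            (solve 3 (λ a b c → con 1 :+ a :+ (b :+ a) :+ c := b :+ (a :+ a :+ c :+ (con 1 :+ con 0))) refl a n r))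
            λ t t<n →
            trans (around t t<n) (cong W (solve 3 (λ s a t → s :+ t :+ a := s :+ a :+ t) refl s a t))
          where
          run-r : Run r (s + a + a) L
          run-r = Eq⇒Run λ t t<L → trans (sym (same t t<L))
              (sym (trans (cong W (trans
              (cong (_+ t) (trans (solve 3 (λ s a r → s :+ a :+ a :+ r := s :+ (a :+ a :+ r)) refl s a r)
              (cong (s +_) total))) refl)) (Eq-+n L s t t<L)))
          a∣r : a ∣ r
          a∣r = primitive-divides {f = λ t → W (s + t)} {m = L} 0<a
              (lin 0 (0<a ⊞ a≤r) (solve 2 (λ a b → con 1 :+ con 0 :+ (a :+ b) :+ con 0 := b :+ (con 1 :+ con 0 :+ a))
              refl a r)) (consecutive-primitive 0<a a≤L run cons)
            (lin 1 (n<L+a ⊞ (≤-reflexive total)) (solve 4 (λ a b c d → a :+ b :+ (c :+ a :+ d) :+ con 1 :=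
                c :+ (con 1 :+ d :+ (a :+ a :+ b))) refl a r L n))
            (Within⇒Period (Run⇒Within run)) (Within⇒Period (Within-Eq {r} {s + a + a} {s} (Eq-sym {i = s} same)
                (Run⇒Within run-r)))
          run-a : Run a (s + a + a) L
          run-a = run-of-divisor 0<a
              (lin 0 (0<a ⊞ a≤r) (solve 2 (λ a b → con 1 :+ con 0 :+ (a :+ b) :+ con 0 := b :+ (con 1 :+ con 0 :+ a))
              refl a r)) a∣r r≤L run-r
              (Period-≤ r≤L (Within⇒Period (Within-Eq {a} {s} {s + a + a} same (Run⇒Within run))))
          around : ∀ t → t < n → W (s + t) ≡ W (s + t + a)
          around t t<n with t <? L
          ... | yes t<L = run t t<L
          ... | no t≮L with m≤n⇒∃[o]m+o≡n {a + a} {t} (lin 1 ((≮⇒≥ t≮L) ⊞ n<L+a ⊞ (≤-reflexive total) ⊞ a≤r)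
              (solve 5 (λ a b c d e → a :+ a :+ (b :+ (c :+ a) :+ d :+ e) :+ con 1 :=
              b :+ (c :+ (con 1 :+ d) :+ (a :+ a :+ e) :+ a)) refl a t L n r))
          ... | o , refl = trans (cong W (solve 3 (λ s a o → s :+ (a :+ a :+ o) := s :+ a :+ a :+ o) refl s a o))
                (trans (run-a o (lin 0 (t<n ⊞ (≤-reflexive (sym total)) ⊞ r≤L)
                    (solve 5 (λ a b c d e → con 1 :+ a :+ (b :+ (c :+ c :+ d) :+ e) :+ con 0 :=
                    e :+ (con 1 :+ (c :+ c :+ a) :+ b :+ d)) refl o n a r L)))
                  (cong W (solve 3 (λ s a o → s :+ a :+ a :+ o :+ a := s :+ (a :+ a :+ o) :+ a) refl s a o)))

    Eq-%+ : ∀ i c → Eq L i (i + c) → Eq L (i % n) (i % n + c)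
    Eq-%+ i c h t t<L = trans (W-%+ i t)
        (trans (h t t<L) (sym (trans (cong W (+-assoc (i % n) c t))
        (trans (W-%+ i (c + t)) (cong W (sym (+-assoc i c t)))))))

    triple-at : ∀ i a c → 0 < a → 0 < c → a + c < n → Eq L i (i + a) → Eq L i (i + (a + c)) → Triple L (a + c)
    triple-at i a c 0<a 0<c lt h h′ = lt , i % n , m%n<n i n , a ,
        (lin 0 (0<c) (solve 2 (λ a b → con 1 :+ a :+ b :+ con 0 := a :+ b :+ (con 1 :+ con 0)) refl a c)) , 0<a ,
        Eq-%+ i a h , Eq-%+ i (a + c) h′

    -- For the least possible σ the three occurrences are neighbours, and the distance r = n - σ
    -- from the third one to the next repetition of the first is the longest of the three.
    triple-goal : ∀ σ → Triple L σ → Goal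
    triple-goal σ tr with least (Triple? L) σ tr
    ... | σ₀ , _ , (σ<n , i , _ , a , a<σ , 0<a , h , h′) , minimal with m≤n⇒∃[o]m+o≡n (<⇒≤ a<σ) | m≤n⇒∃[o]m+o≡n
        (<⇒≤ σ<n)
    ... | c , refl | r , total = by-size (<-cmp a c)
      where
      0<c : 0 < c
      0<c = (lin 0 (a<σ) (solve 2 (λ a b → con 1 :+ con 0 :+ (a :+ b) :+ con 0 := b :+ (con 1 :+ a)) refl a c))
      0<r : 0 < r
      0<r = (lin 0 (σ<n ⊞ (≤-reflexive (sym total)))
          (solve 4 (λ a b c d → con 1 :+ con 0 :+ (a :+ (b :+ c :+ d)) :+ con 0 := d :+ (con 1 :+ (b :+ c) :+ a))
          refl n a c r))
      e₁ : Eq L (i + a) (i + a + c)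
      e₁ = subst (Eq L (i + a)) (sym (+-assoc i a c)) (Eq-trans {i = i + a} {i} {i + (a + c)} (Eq-sym {i = i} h) h′)
      i+n : i + a + c + r ≡ i + n
      i+n = trans (solve 4 (λ i a c r → i :+ a :+ c :+ r := i :+ (a :+ c :+ r)) refl i a c r) (cong (i +_) total)
      e₂ : Eq L (i + a + c) (i + a + c + r)
      e₂ = subst (Eq L (i + a + c)) (sym i+n) (Eq-trans {i = i + a + c} {i} {i + n} (Eq-trans {i = i + a + c} {i + a}
          {i} (Eq-sym {i = i + a} e₁) (Eq-sym {i = i} h)) (Eq-sym {i = i + n} (Eq-+n L i)))
      e₃ : Eq L (i + a + c) (i + a + c + r + a)
      e₃ = Eq-trans {i = i + a + c} {i + a} {i + a + c + r + a} (Eq-sym {i = i + a} e₁)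
          (subst (Eq L (i + a)) (trans (solve 3 (λ i a n → i :+ a :+ n := i :+ n :+ a) refl i a n)
          (cong (_+ a) (sym i+n))) (Eq-sym {i = i + a + n} (Eq-+n L (i + a))))
      cons-a : Consecutive L a i
      cons-a g 0<g g<a eq with m≤n⇒∃[o]m+o≡n (<⇒≤ g<a)
      ... | o , refl = minimal (g + o) a<σ
          (triple-at i g o 0<g (lin 0 (g<a) (solve 2 (λ a b → con 1 :+ con 0 :+ (a :+ b) :+ con 0 :=
          b :+ (con 1 :+ a)) refl g o)) (<-trans a<σ σ<n) eq h)
      cons-c : Consecutive L c (i + a)
      cons-c g 0<g g<c eq with m≤n⇒∃[o]m+o≡n (<⇒≤ g<c)
      ... | o , refl = minimal (g + o)
          (lin 0 (0<a) (solve 3 (λ a b c → con 1 :+ (a :+ b) :+ c :+ con 0 := c :+ (a :+ b) :+ (con 1 :+ con 0)) refl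
          g o a)) (triple-at (i + a) g o 0<g
          (lin 0 (g<c) (solve 2 (λ a b → con 1 :+ con 0 :+ (a :+ b) :+ con 0 := b :+ (con 1 :+ a)) refl g o))
            (lin a (σ<n) (solve 4 (λ a b c d → con 1 :+ (a :+ b) :+ c :+ d := c :+ (con 1 :+ (d :+ (a :+ b)))) refl g
                o n a)) eq e₁)
      a≤r : a ≤ r
      a≤r = ≮⇒≥ λ r<a → minimal (c + r)
          (lin 0 (r<a) (solve 3 (λ a b c → con 1 :+ (a :+ b) :+ c :+ con 0 := c :+ a :+ (con 1 :+ b)) refl c r a))
          (triple-at (i + a) c r 0<c 0<r (lin 0 ((≤-reflexive total) ⊞ 0<a)
          (solve 4 (λ a b c d → con 1 :+ (a :+ b) :+ (c :+ d) :+ con 0 := c :+ (d :+ a :+ b :+ (con 1 :+ con 0)))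
          refl c r n a)) e₁
        (subst (Eq L (i + a)) (+-assoc (i + a) c r) (Eq-trans {i = i + a} {i + a + c} {i + a + c + r} e₁ e₂)))
      c≤r : c ≤ r
      c≤r = ≮⇒≥ λ r<c → minimal (r + a)
          (lin 0 (r<c) (solve 3 (λ a b c → con 1 :+ (a :+ b) :+ c :+ con 0 := b :+ c :+ (con 1 :+ a)) refl r a c))
          (triple-at (i + a + c) r a 0<r 0<a (lin 0 ((≤-reflexive total) ⊞ 0<c)
          (solve 4 (λ a b c d → con 1 :+ (a :+ b) :+ (c :+ d) :+ con 0 := c :+ (b :+ d :+ a :+ (con 1 :+ con 0)))
          refl r a n c)) e₂
        (subst (Eq L (i + a + c)) (+-assoc (i + a + c) r a) e₃))
      by-size : _ → Goal
      by-size (tri≈ _ refl _) = equal-gaps {a} {i} {r} 0<a a≤r total (Eq⇒Run h) (Eq⇒Run e₁)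
          (subst (Eq L i) (sym (+-assoc i a a)) h′) cons-a
      by-size (tri< a<c _ _) = Three.goal {a} {c} {i} {i + a} 0<a a<c (Eq⇒Run h) (Eq⇒Run e₁) h cons-a cons-c
          (lin 0 ((≤-reflexive total) ⊞ c≤r) (solve 4 (λ a b c d → a :+ con 2 :* b :+ (c :+ d) :+ con 0 :=
          c :+ (a :+ b :+ d :+ b)) refl a c n r))
      by-size (tri> _ _ c<a) = Three.goal {c} {a} {i + a} {i} 0<c c<a (Eq⇒Run e₁) (Eq⇒Run h) (Eq-sym {i = i} h)
          cons-c cons-a (lin 0 ((≤-reflexive total) ⊞ a≤r) (solve 4 (λ a b c d → a :+ con 2 :* b :+ (c :+ d) :+ con 0
          := c :+ (b :+ a :+ d :+ b)) refl c a n r))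

-- Runs that contain a whole cycle

-- Here the roots have length at most n / 2.
module ShortRoots {k n : ℕ} (W : ℕ → Fin k) (0<n : 0 < n) (W-period : ∀ i → W (i + n) ≡ W i)
  (W-primitive : ∀ d → 0 < d → d < n → ¬ (∀ i → W i ≡ W (i + d))) (b : ℕ) (b<n : b < n) (2b≤n : 2 * b ≤ n) where

  open PrimitiveWord W 0<n W-period W-primitive b b<n public

  N≡0 : ∀ {p} → b < ∥ p ∥ → N p ≡ 0
  N≡0 {p} b<d = go b
    where
    go : ∀ B → length (squaresUpTo p B) ≡ 0
    go zero = refl
    go (suc B) = trans (length-squaresUpTo p B) (trans (cong (_+ length (squaresUpTo p B))
      (count-none (Square? p (suc B)) 0 ∥ p ∥ λ j _ sq → <⇒≱ b<d (≤-trans (m≤m+n ∥ p ∥ (B * ∥ p ∥)) (proj₁ sq))))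
          (go B))

  -- Every run ends, at the first position at which its period fails.
  abstract
    run-exit : ∀ {d} → 0 < d → d < n → ∀ s → ∃ λ e → Run d s e × W (s + e) ≢ W (s + e + d)
    run-exit {d} 0<d d<n s with Eq? n s (s + d)
    ... | yes h = ⊥-elim (no-shift 0<d d<n h)
    ... | no ¬h with anyUpTo? (λ e → ¬? (W (s + e) Finₚ.≟ W (s + e + d))) n
    ... | no none = ⊥-elim (¬h (Run⇒Eq λ t t<n → decidable-stable (W (s + t) Finₚ.≟ W (s + t + d)) λ ne → none
        (t , t<n , ne)))
    ... | yes (e , _ , ne) with least (λ e → ¬? (W (s + e) Finₚ.≟ W (s + e + d))) e ne
    ... | e₀ , _ , ne₀ , min = e₀ , (λ t t<e → decidable-stable (W (s + t) Finₚ.≟ W (s + t + d)) (min t t<e)) , ne₀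

  -- A run of period ∥ p ∥ is determined by its first ∥ p ∥ letters.
  match-run : ∀ {p s o m} → (∀ t → t < ∥ p ∥ → W (s + t) ≡ word p (o + t)) → Run ∥ p ∥ s m → ∀ t → t < m + ∥ p ∥ → W
      (s + t) ≡ word p (o + t)
  match-run {p} {s} {o} {m} h run t lt = trans (Period-% (Run⇒Period run) t lt) (trans (h (t % ∥ p ∥) (m%n<n t ∥ p ∥))
    (trans (cong (word p) (+-comm o (t % ∥ p ∥))) (trans (word-+ p t o) (cong (word p) (+-comm t o)))))

  run-match : ∀ {p s o} m → (∀ t → t < m + ∥ p ∥ → W (s + t) ≡ word p (o + t)) → Run ∥ p ∥ s m
  run-match {p} {s} {o} m h t t<m = trans (h t (<-≤-trans t<m (m≤m+n m ∥ p ∥))) (trans (sym (word-period p (o + t)))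
    (trans (cong (word p) (+-assoc o t ∥ p ∥)) (trans (sym (h (t + ∥ p ∥) (+-monoˡ-< ∥ p ∥ t<m)))
        (cong W (sym (+-assoc s t ∥ p ∥))))))

  match-all : ∀ {p q o o′} → ∥ p ∥ ≡ ∥ q ∥ → (∀ t → t < ∥ p ∥ → word p (o + t) ≡ word q (o′ + t)) → ∀ t → word p
      (o + t) ≡ word q (o′ + t)
  match-all {p} {q} {o} {o′} d≡ h t = trans (reduce p o) (trans (h (t % ∥ p ∥) (m%n<n t ∥ p ∥))
      (sym (subst (λ z → .{{_ : NonZero z}} → word q (o′ + t) ≡ word q (o′ + t % z)) (sym d≡) (reduce q o′))))
    where
    reduce : ∀ r x → word r (x + t) ≡ word r (x + t % ∥ r ∥)
    reduce r x = trans (cong (word r) (+-comm x t)) (trans (sym (word-+ r t x))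
        (cong (word r) (+-comm (t % ∥ r ∥) x)))

  class-match : ∀ {p q o o′} → IsClass p → IsClass q → ∥ p ∥ ≡ ∥ q ∥ → (∀ t → t < ∥ p ∥ → word p (o + t) ≡ word q
      (o′ + t)) → p ≡ q
  class-match {p} {q} {o} {o′} Cp Cq d≡ h = class-conjugate {p} {q} Cp Cq d≡ (o′ + c) λ t _ →
      trans (sym (word-%≡ p {o + c} {0} back t)) (trans (cong (word p) (+-assoc o c t))
          (trans (match-all {p} {q} {o} {o′} d≡ h (c + t)) (cong (word q) (sym (+-assoc o′ c t)))))
    where
    d = ∥ p ∥
    c = d ∸ o % d
    back : (o + c) % d ≡ 0 % d
    back = %-complement d o

  module NoTriple (L : ℕ) (0<L : 0 < L) (L<n : L < n) (n≤2L : n ≤ 2 * L) (¬good : ¬ Good L) where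

    open AtLevel L 0<L L<n n≤2L ¬good public

    module _ (noTriple : ∀ σ → ¬ Triple L σ) where

      no-three : ∀ i {a c} → 0 < a → a < c → c < n → Eq L i (i + a) → ¬ Eq L i (i + c)
      no-three i {a} {c} 0<a a<c c<n h h′ with m≤n⇒∃[o]m+o≡n (<⇒≤ a<c)
      ... | r , refl = noTriple (a + r)
          (triple-at i a r 0<a (lin 0 (a<c) (solve 2 (λ a b → con 1 :+ con 0 :+ (a :+ b) :+ con 0 :=
          b :+ (con 1 :+ a)) refl a r)) c<n h h′)

      consecutive : ∀ {i x} → x < n → Eq L i (i + x) → Consecutive L x i
      consecutive {i} x<n h g 0<g g<x h′ = no-three i 0<g g<x x<n h′ h

      -- A window is not repeated at a distance y ≤ L with 2 y ≥ n.  If 2 y = n, then W would have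
      -- period y; if 2 y > n, the class of this repetition has no squares, since y > b, so that L
      -- would be good.
      no-long-gap : ∀ {y s} → 0 < y → y < n → y ≤ L → n ≤ 2 * y → ¬ Eq L s (s + y)
      no-long-gap {y} {s} 0<y y<n y≤L n≤2y h with <-cmp (2 * y) n
      ... | tri< lt _ _ = <⇒≱ lt n≤2y
      ... | tri≈ _ e _ = no-shift {s} {y} 0<y y<n λ t t<n → around t t<n (t <? L)
        where
        around : ∀ t → t < n → Dec (t < L) → W (s + t) ≡ W (s + y + t)
        around t t<n (yes t<L) = h t t<L
        around t t<n (no t≮L) with m≤n⇒∃[o]m+o≡n (≤-trans y≤L (≮⇒≥ t≮L))
        ... | o , refl = sym (trans (cong W (trans (solve 3 (λ s y o → s :+ y :+ (y :+ o) := s :+ o :+ con 2 :* y)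
            refl s y o) (cong (s + o +_) e)))
              (trans (W-period (s + o))
                  (trans (h o (lin 0 (t<n ⊞ (≤-reflexive (sym e)) ⊞ y≤L)
                  (solve 4 (λ a b c d → con 1 :+ a :+ (b :+ con 2 :* c :+ d) :+ con 0 :=
                  d :+ (con 1 :+ (c :+ a) :+ b :+ c)) refl o n y L))) (cong W (+-assoc s y o)))))
      ... | tri> _ _ gt with class-length {s} {y} {L} 0<y y<n y≤L (consecutive-primitive 0<y y≤L (Eq⇒Run h)
          (consecutive y<n h)) (Eq⇒Run h)
      ... | p , isC , refl , L≤T = ¬good (idle⇒good {p} {L} isC y≤L (subst (λ z → L + z ≤ T p)
          (sym (N≡0 {p} (≮⇒≥ (λ h₋ → lin⊥ 0 (2b≤n ⊞ gt ⊞ h₋ ⊞ h₋)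
          (solve 3 (λ a b c → a :+ con 2 :* b :+ (con 1 :+ c) :+ (con 1 :+ c) :+ (con 1 :+ con 0) := con
          2 :* c :+ (con 1 :+ a) :+ (con 1 :+ b) :+ (con 1 :+ b)) refl n y b)))))
          (≤-trans (≤-reflexive (+-identityʳ L)) L≤T)))

      -- Apply no-long-gap to the distance x and to the complementary distance n - x.
      gap : ∀ {i x} → 0 < x → x < n → Eq L i (i + x) → (x + L < n) ⊎ (L < x)
      gap {i} {x} 0<x x<n h with x + L <? n | L <? x
      ... | yes lt | _ = inj₁ lt
      ... | _ | yes lt = inj₂ lt
      ... | no ¬a | no ¬b with n ≤? 2 * x
      ... | yes n≤2x = ⊥-elim (no-long-gap 0<x x<n (≮⇒≥ ¬b) n≤2x h)
      ... | no n≰2x with m≤n⇒∃[o]m+o≡n (<⇒≤ x<n)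
      ... | y , total = ⊥-elim (no-long-gap {y} {i + x} (lin 0 (x<n ⊞ (≤-reflexive (sym total)))
          (solve 3 (λ a b c → con 1 :+ con 0 :+ (a :+ (b :+ c)) :+ con 0 := c :+ (con 1 :+ b :+ a)) refl n x y))
          (lin 0 (0<x ⊞ (≤-reflexive total)) (solve 3 (λ a b c → con 1 :+ a :+ (b :+ c) :+ con 0 :=
          c :+ (con 1 :+ con 0 :+ (b :+ a))) refl y x n))
            (lin 0 ((≮⇒≥ ¬a) ⊞ (≤-reflexive total)) (solve 4 (λ a b c d → a :+ (b :+ c :+ d) :+ con 0 :=
                c :+ (d :+ (b :+ a))) refl y x L n))
                (lin 1 ((≰⇒> n≰2x) ⊞ (≤-reflexive (sym total)) ⊞ (≤-reflexive (sym total)))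
                (solve 3 (λ a b c → a :+ (a :+ (b :+ c) :+ (b :+ c)) :+ con 1 := con
                2 :* c :+ (con 1 :+ con 2 :* b :+ a :+ a)) refl n x y))
            (Eq-trans {i = i + x} {i} {i + x + y} (Eq-sym {i = i} h)
                (subst (Eq L i) (trans (cong (i +_) (sym total)) (sym (+-assoc i x y)))
                (Eq-sym {i = i + n} (Eq-+n L i)))))

      -- A window of length d + L of the cycle of p occurs, where d is the length of p: one run of
      -- p contains the cycle formed by the windows of length L + 1.
      FullRun : Class → Set
      FullRun p = ∃ λ j → j < ∥ p ∥ × Occ p j (∥ p ∥ + L)

      active⁻ : ∀ {p} → p ∈ active L → p ∈ classes × IsClass p × ∥ p ∥ ≤ L × L ≤ T p × T p < L + N p
      active⁻ {p} p∈ = let (p∈C , a) = ∈-filter⁻ (Active? L) {xs = classes} p∈ ; C = ∈-classes⁻ p∈C ; (d≤L , L≤T) = active⇒present C a in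
        p∈C , C , d≤L , L≤T , proj₁ a

      -- The window of length L at x occurs at a position j with a repetition ∥ p ∥ positions later,
      -- and W spells a conjugate of the word of p at j.
      Leaves : Class → ℕ → Set
      Leaves p x = ∃ λ j → j < n × Eq L x j × Eq L j (j + ∥ p ∥) × ∃ λ o → ∀ t → t < ∥ p ∥ → W (j + t) ≡ word p
          (o + t)

      -- At the end of the run the last window of length L and its repetition are followed by
      -- different letters.  Hence one of the two windows of length L + 1 does not yet occur where
      -- the window of length L first occurs.
      leaves : ∀ {p} → IsClass p → FullRun p → ∃ λ x → x < n × (First (suc L) x × ¬ First L x) × Leaves p x
      leaves {p} isC (j , _ , occurs i _ h) with run-exit {∥ p ∥} z<s (proj₁ isC) i
      ... | e , run , ne with m≤n⇒∃[o]o+m≡n {L} {e}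
          (≮⇒≥ λ e<L → ne (run-match {p} {i} {j} L (λ t lt → h t (subst (t <_) (+-comm L ∥ p ∥) lt)) e e<L))
      ... | r , refl with first-spec (suc L) (i + r) | first-spec (suc L) (i + r + ∥ p ∥)
      ... | x , x<n , eqx , fx | y , y<n , eqy , fy = choose (First? L x)
        where
        P = i + r
        eqP : Eq L P (P + ∥ p ∥)
        eqP = Run⇒Eq λ t t<L → trans (cong W (+-assoc i r t)) (trans (run (r + t) (+-monoʳ-< r t<L))
            (cong W (cong (_+ ∥ p ∥) (sym (+-assoc i r t)))))
        matchP : ∀ t → t < ∥ p ∥ → W (P + t) ≡ word p (j + r + t)
        matchP t t<d = trans (cong W (+-assoc i r t))
            (trans (match-run {p} {i} {j} {r + L} (λ s s<d → h s (<-≤-trans s<d (m≤m+n ∥ p ∥ L))) run (r + t)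
          (<-≤-trans (+-monoʳ-< r t<d) (+-monoˡ-≤ ∥ p ∥ (m≤m+n r L)))) (cong (word p) (sym (+-assoc j r t))))
        left : ∀ {z} → Eq L z P → Leaves p z
        left {z} eq = P % n , m%n<n P n , Eq-trans {i = z} {P} {P % n} eq (Eq-sym {i = P % n} (Eq-% L P)) , Eq-%+ P ∥
            p ∥ eqP , j + r ,
          λ t t<d → trans (W-%+ P t) (matchP t t<d)
        xP : Eq L x P
        xP = Eq-≤ {i = x} {P} (n≤1+n L) eqx
        yP : Eq L y P
        yP = Eq-trans {i = y} {P + ∥ p ∥} {P} (Eq-≤ {i = y} {P + ∥ p ∥} (n≤1+n L) eqy) (Eq-sym {i = P} eqP)
        choose : Dec (First L x) → ∃ λ x → x < n × (First (suc L) x × ¬ First L x) × Leaves p x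
        choose (no ¬f) = x , x<n , (fx , ¬f) , left {x} xP
        choose (yes f) = y , y<n ,
            (fy , λ f′ → ne (differ (First-unique {L} {x} {y} f f′ (Eq-trans {i = x} {P} {y} xP
            (Eq-sym {i = y} yP))))) , left {y} yP
          where
          differ : x ≡ y → W (i + (r + L)) ≡ W (i + (r + L) + ∥ p ∥)
          differ refl = trans (cong W (sym (+-assoc i r L))) (trans (sym (eqx L ≤-refl)) (trans (eqy L ≤-refl)
            (cong W (solve 4 (λ i r d l → i :+ r :+ d :+ l := i :+ (r :+ l) :+ d) refl i r ∥ p ∥ L))))

      -- Two different classes leaving at the same window would make it occur three times within a
      -- period.
      leaves-injective : ∀ {p q x} → p ∈ active L → q ∈ active L → Leaves p x → Leaves q x → p ≡ q
      leaves-injective {p} {q} {x} p∈ q∈ (j , j<n , xj , jd , o , m) (j′ , j′<n , xj′ , jd′ , o′ , m′) = by-size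
          (<-cmp j j′)
        where
        Cp = proj₁ (proj₂ (active⁻ p∈))
        Cq = proj₁ (proj₂ (active⁻ q∈))
        short : ∀ {d i} → 0 < d → d < n → d ≤ L → Eq L i (i + d) → d + L < n
        short {d} 0<d d<n d≤L h with gap 0<d d<n h
        ... | inj₁ lt = lt
        ... | inj₂ lt = ⊥-elim (<⇒≱ lt d≤L)
        sum<n : ∥ p ∥ + ∥ q ∥ < n
        sum<n = (lin 0 ((short {∥ p ∥} {j} z<s (proj₁ Cp) (proj₁ (proj₂ (proj₂ (active⁻ p∈)))) jd) ⊞
            (proj₁ (proj₂ (proj₂ (active⁻ q∈))))) (solve 4 (λ a b c d → con 1 :+ (a :+ b) :+ (c :+ d) :+ con 0 :=
            c :+ (con 1 :+ (a :+ d) :+ b)) refl (∥ p ∥) (∥ q ∥) n L))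
        jj′ : Eq L j j′
        jj′ = Eq-trans {i = j} {x} {j′} (Eq-sym {i = x} xj) xj′
        apart : ∀ {i i′ d d′} → 0 < d → 0 < d′ → d < n → d + d′ < n → i′ < n → Eq L i i′ → Eq L i (i + d) → Eq L i′
            (i′ + d′) → ¬ (i < i′)
        apart {i} {i′} {d} {d′} 0<d 0<d′ d<n sum i′<n ii′ h h′ i<i′ with m≤n⇒∃[o]m+o≡n (<⇒≤ i<i′)
        ... | δ , refl with <-cmp δ d
        ... | tri< δ<d _ _ = no-three i
            (lin 0 (i<i′) (solve 2 (λ a b → con 1 :+ con 0 :+ (a :+ b) :+ con 0 := b :+ (con 1 :+ a)) refl i δ)) δ<d
            d<n ii′ h
        ... | tri> _ _ d<δ = no-three i 0<d d<δ
            (lin i (i′<n) (solve 3 (λ a b c → con 1 :+ a :+ b :+ c := b :+ (con 1 :+ (c :+ a))) refl δ n i)) h ii′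
        ... | tri≈ _ refl _ = no-three i 0<d
            (lin 0 (0<d′) (solve 2 (λ a b → con 1 :+ a :+ b :+ con 0 := a :+ b :+ (con 1 :+ con 0)) refl d d′)) sum h
            (subst (Eq L i) (+-assoc i d d′) (Eq-trans {i = i} {i + d} {i + d + d′} ii′ h′))
        by-size : _ → p ≡ q
        by-size (tri< lt _ _) = ⊥-elim (apart {j} {j′} {∥ p ∥} {∥ q ∥} z<s z<s (proj₁ Cp) sum<n j′<n jj′ jd jd′ lt)
        by-size (tri> _ _ gt) = ⊥-elim (apart {j′} {j} {∥ q ∥} {∥ p ∥} z<s z<s (proj₁ Cq)
            (subst (_< n) (+-comm ∥ p ∥ ∥ q ∥) sum<n) j<n (Eq-sym {i = j} jj′) jd′ jd gt)
        by-size (tri≈ _ refl _) with <-cmp ∥ p ∥ ∥ q ∥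
        ... | tri< lt _ _ = ⊥-elim (no-three j z<s lt (proj₁ Cq) jd jd′)
        ... | tri> _ _ gt = ⊥-elim (no-three j z<s gt (proj₁ Cp) jd′ jd)
        ... | tri≈ _ d≡ _ = class-match {p} {q} {o} {o′} Cp Cq d≡ λ t t<d → trans (sym (m t t<d))
            (m′ t (subst (t <_) d≡ t<d))

      -- There are at least as many windows of length L + 1 whose prefix of length L occurs earlier
      -- as there are active classes.  The other windows of length L + 1 represent all windows of
      -- length L.
      fullRuns⇒good : (∀ {p} → p ∈ active L → FullRun p) → Good L
      fullRuns⇒good all = (lin 0 (new ⊞ old ⊞ (≤-reflexive (count-split (First? (suc L)) (First? L) n)))
          (solve 5 (λ a b c d e → a :+ b :+ (c :+ d :+ e) :+ con 0 := e :+ (a :+ b :+ (d :+ c))) refl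
          (active-count L) (windows L) (count (λ x → First? (suc L) x ×-dec ¬? (First? L x)) n)
          (count (λ x → First? (suc L) x ×-dec First? L x) n) (windows (suc L))))
        where
        new : active-count L ≤ count (λ x → First? (suc L) x ×-dec ¬? (First? L x)) n
        new = injection-length Leaves (Uniqueₚ.filter⁺ (Active? L) classes-unique)
          (λ p∈ → let (x , x<n , h , l) = leaves (proj₁ (proj₂ (active⁻ p∈))) (all p∈) in x , ∈-sel⁺
              (λ x → First? (suc L) x ×-dec ¬? (First? L x)) x<n h , l)
          leaves-injective
        old : windows L ≤ count (λ x → First? (suc L) x ×-dec First? L x) n
        old = count-⊆ (First? L) (λ x → First? (suc L) x ×-dec First? L x) n λ x _ f →
            (λ i′ i′<x h → f i′ i′<x (Eq-≤ {i = i′} {x} (n≤1+n L) h)) , f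

      -- An active class q whose cycle is spread over several runs, none of which contains it.
      broken-class : ∃ λ q → q ∈ active L × (∀ j → ¬ Occ q j (∥ q ∥ + L))
      broken-class with All.all? fullRun? (active L)
        where
        fullRun? : ∀ p → Dec (FullRun p)
        fullRun? p = anyUpTo? (λ j → Occ? p j (∥ p ∥ + L)) ∥ p ∥
      ... | yes all = ⊥-elim (¬good (fullRuns⇒good λ p∈ → All.lookup all p∈))
      ... | no ¬all with find (¬All⇒Any¬ (λ p → anyUpTo? (λ j → Occ? p j (∥ p ∥ + L)) ∥ p ∥) (active L) ¬all)
      ... | q , q∈ , none = q , q∈ , λ j occ → none (j % ∥ q ∥ , m%n<n j ∥ q ∥ , Occ-%≡ {q} {j} {j % ∥ q ∥}
          (sym (m%n%n≡m%n j ∥ q ∥)) occ)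

  W-≡% : ∀ {x y} → x % n ≡ y % n → ∀ t → W (x + t) ≡ W (y + t)
  W-≡% {x} {y} e t = trans (sym (W-%+ x t)) (trans (cong (λ z → W (z + t)) e) (W-%+ y t))

  %-cancel : ∀ {x y} c → (x + c) % n ≡ (y + c) % n → x % n ≡ y % n
  %-cancel {x} {y} c e = %-injective n c (m%n<n x n) (m%n<n y n)
      (trans (%-absorb n x c) (trans e (sym (%-absorb n y c))))

  Run-≡% : ∀ {d s s′ m} → s % n ≡ s′ % n → Run d s m → Run d s′ m
  Run-≡% {d} {s} {s′} e run t t<m = trans (sym (W-≡% e t))
      (trans (run t t<m) (trans (cong W (+-assoc s t d)) (trans (W-≡% e (t + d)) (cong W (sym (+-assoc s′ t d))))))

  run-at : ∀ {d s m} → Run d s m → ∀ z → s ≤ z → z < s + m → W z ≡ W (z + d)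
  run-at {d} {s} run z s≤z z< with m≤n⇒∃[o]m+o≡n s≤z
  ... | o , refl = run o (+-cancelˡ-< s o _ z<)

  -- A class spread over several runs

  -- Phases of equal factors of the sequence of q agree modulo ∥ q ∥.
  phase-inverse : ∀ {q} → IsClass q → ∀ o o′ c → (o + c) % ∥ q ∥ ≡ 0 % ∥ q ∥ → (∀ t → t < ∥ q ∥ → word q
      (o + t) ≡ word q (o′ + t)) → ∥ q ∥ ∣ o′ + c
  phase-inverse {q} isC o o′ c back h = ∣m+n∣m⇒∣n {d} {d} (subst (d ∣_) (+-comm (o′ + c) d) div) ∣-refl
    where
    d = ∥ q ∥
    div : d ∣ o′ + c + d
    div = class-rotation {q} isC (o′ + c + d) (≤-trans z<s (m≤n+m d (o′ + c))) λ t _ →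
      trans (cong (word q) (solve 4 (λ o c d t → o :+ c :+ d :+ t := o :+ (c :+ t) :+ d) refl o′ c d t))
          (trans (word-period q (o′ + (c + t)))
        (trans (sym (match-all {q} {q} {o} {o′} refl h (c + t))) (trans (cong (word q) (sym (+-assoc o c t)))
            (word-%≡ q {o + c} {0} back t))))

  phase-shift : ∀ {q} → IsClass q → ∀ o δ → (∀ t → t < ∥ q ∥ → word q (o + t) ≡ word q (o + δ + t)) → ∥ q ∥ ∣ δ
  phase-shift {q} isC o δ h = %-≡⇒∣ ∥ q ∥ (o + c) δ
      (trans (n∣m⇒m%n≡0 (o + c + δ) ∥ q ∥ (subst (∥ q ∥ ∣_) (solve 3 (λ o δ c → o :+ δ :+ c := o :+ c :+ δ) refl o δ
      c)
      (phase-inverse {q} isC o (o + δ) c (%-complement ∥ q ∥ o) h)))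
          (sym (trans (%-complement ∥ q ∥ o) (n∣m⇒m%n≡0 0 ∥ q ∥ (∥ q ∥ ∣0)))))
    where
    c = ∥ q ∥ ∸ o % ∥ q ∥

  phase-unique : ∀ {q} → IsClass q → ∀ {j j′} → j < ∥ q ∥ → j′ < ∥ q ∥ → (∀ t → t < ∥ q ∥ → word q (j + t) ≡ word q
      (j′ + t)) → j ≡ j′
  phase-unique {q} isC {j} {j′} j<d j′<d h = %-injective ∥ q ∥ c j<d j′<d (trans (%-complement ∥ q ∥ j)
      (trans (n∣m⇒m%n≡0 0 ∥ q ∥ (∥ q ∥ ∣0))
      (sym (n∣m⇒m%n≡0 (j′ + c) ∥ q ∥ (phase-inverse {q} isC j j′ c (%-complement ∥ q ∥ j) h)))))
    where
    c = ∥ q ∥ ∸ j % ∥ q ∥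

  rotation-primitive : ∀ {q} → IsClass q → ∀ o → Primitive (λ t → word q (o + t)) ∥ q ∥
  rotation-primitive {q} isC o g 0<g g<d g∣d P = <⇒≱ g<d (∣⇒≤ {{>-nonZero 0<g}} (phase-shift {q} isC o g λ t _ →
      trans (Period-extend {f = λ t → word q (o + t)} {M = suc (t + g)} 0<g z<s g∣d ≤-refl
          (λ s _ → sym (trans (cong (word q) (sym (+-assoc o s ∥ q ∥))) (word-period q (o + s)))) P t ≤-refl)
        (cong (word q) (trans (cong (o +_) (+-comm t g)) (sym (+-assoc o g t))))))

  module BrokenClass (L : ℕ) (0<L : 0 < L) (L<n : L < n) (n≤2L : n ≤ 2 * L) (¬good : ¬ Good L)
      (noTriple : ∀ σ → ¬ Triple L σ)
      (q : Class) (isC : IsClass q) (d≤L : ∥ q ∥ ≤ L) (L≤T : L ≤ T q) (T<L+N : T q < L + N q)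
          (broken : ∀ j → ¬ Occ q j (∥ q ∥ + L)) where

    open NoTriple L 0<L L<n n≤2L ¬good public

    d : ℕ
    d = ∥ q ∥

    u : ℕ → Fin k
    u = word q

    0<d : 0 < d
    0<d = z<s

    d<n : d < n
    d<n = proj₁ isC

    2d≤n : 2 * d ≤ n
    2d≤n = ≤-trans (*-monoʳ-≤ 2 (≮⇒≥ λ b<d → (lin⊥ 0 (T<L+N ⊞ L≤T ⊞ (≤-reflexive (N≡0 {q} b<d)))
        (solve 3 (λ a b c → a :+ b :+ c :+ con 0 :+ (con 1 :+ con 0) := con 1 :+ c :+ a :+ b) refl L (N q) (T q)))))
        2b≤n

    tail : ∃ λ λ′ → λ′ + d ≡ L
    tail = m≤n⇒∃[o]o+m≡n d≤L

    -- The windows of length L of the cycle are runs with ℓ equalities.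
    ℓ : ℕ
    ℓ = proj₁ tail

    ℓ+d : ℓ + d ≡ L
    ℓ+d = proj₂ tail

    -- W follows the sequence of q from phase o on for m letters from position s on.
    Match : ℕ → ℕ → ℕ → Set
    Match o s m = ∀ t → t < m → W (s + t) ≡ u (o + t)

    no-long : ∀ {o s m} → Match o s d → Run d s m → m < L
    no-long {o} {s} {m} h run = ≰⇒> λ L≤m → broken o (Occ-at s λ t t< → match-run {q} {s} {o} {L} h (Run-≤ L≤m run) t
        (subst (t <_) (+-comm d L) t<))

    match⇒run : ∀ {o s} m → Match o s (m + d) → Run d s m
    match⇒run {o} {s} m h = run-match {q} {s} {o} m h

    -- W follows the cycle of q from phase θ on for exactly L letters from position P on.
    record Exit (θ P : ℕ) : Set where
      constructor exits
      field
        inside : Match θ P L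
        leaves-at : W (P + L) ≢ u (θ + L)

    open Exit public

    abstract
      -- W also spells the window with its continuation along the cycle, at a distance D < n.
      jump : ∀ {θ P} → Exit θ P → ∃ λ D → 0 < D × D < n × Match θ (P + D) (suc L)
      jump {θ} {P} (exits _ ne) with T-full q L≤T θ
      ... | occurs i i<n h = D , n≢0⇒n>0 nonzero , m%n<n (n ∸ P % n + i) n , match
        where
        D : ℕ
        D = offset n (P % n) i
        P+D : (P + D) % n ≡ i % n
        P+D = trans (sym (%-absorb n P D)) (offset-% n (P % n) i (m%n<n P n))
        match : Match θ (P + D) (suc L)
        match t t<sL = trans (W-≡% P+D t) (h t t<sL)
        nonzero : D ≢ 0
        nonzero D≡0 = ne (trans (cong (λ z → W (z + L)) (sym (trans (cong (P +_) D≡0) (+-identityʳ P))))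
            (match L ≤-refl))

      -- From there W follows the cycle for another α letters and then leaves it; α < d because no
      -- run contains the whole cycle.
      follow : ∀ {θ τ} → Match θ τ (suc L) → ∃ λ α → 0 < α × α < d × Match θ τ (L + α) × Exit (θ + α) (τ + α)
      follow {θ} {τ} h with run-exit 0<d d<n τ
      ... | e , run , ne with m≤n⇒∃[o]m+o≡n {suc ℓ} {e}
          (≰⇒> λ e≤ℓ → ne (match⇒run {θ} {τ} (suc ℓ) (λ t t< → h t (subst (t <_) (cong suc ℓ+d) t<)) e (s≤s e≤ℓ)))
      ... | a , refl = suc a , z<s , (lin 0 (e<L ⊞ (≤-reflexive (sym ℓ+d)))
          (solve 4 (λ a b c d → con 1 :+ (con 1 :+ a) :+ (b :+ (c :+ d)) :+ con 0 :=
          d :+ (con 1 :+ (con 1 :+ c :+ a) :+ b)) refl a L ℓ d)) , match , exits exact ne′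
        where
        start : Match θ τ d
        start t t<d = h t (<-≤-trans t<d (≤-trans d≤L (n≤1+n L)))
        e<L : suc ℓ + a < L
        e<L = no-long {θ} {τ} start run
        len : suc ℓ + a + d ≡ L + suc a
        len = (≤-antisym (lin 0 ((≤-reflexive ℓ+d)) (solve 4 (λ a b c d → con 1 :+ a :+ b :+ c :+ d :+ con 0 :=
            d :+ (con 1 :+ b) :+ (a :+ c)) refl ℓ a d L)) (lin 0 ((≤-reflexive (sym ℓ+d)))
            (solve 4 (λ a b c d → a :+ (con 1 :+ b) :+ (c :+ d) :+ con 0 := con 1 :+ c :+ b :+ d :+ a) refl L a ℓ d)))
        match : Match θ τ (L + suc a)
        match t t< = match-run {q} {τ} {θ} start run t (subst (t <_) (sym len) t<)
        exact : Match (θ + suc a) (τ + suc a) L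
        exact t t<L = trans (cong W (+-assoc τ (suc a) t))
            (trans (match (suc a + t) (subst (suc a + t <_) (+-comm (suc a) L) (+-monoʳ-< (suc a) t<L)))
            (cong u (sym (+-assoc θ (suc a) t))))
        ne′ : W (τ + suc a + L) ≢ u (θ + suc a + L)
        ne′ eq = ne (trans (match (suc ℓ + a) (<-≤-trans (m<m+n (suc ℓ + a) 0<d) (≤-reflexive len)))
            (trans (sym (word-period q (θ + (suc ℓ + a))))
          (trans (cong u (trans (+-assoc θ (suc ℓ + a) d) (trans (cong (θ +_) (trans len (+-comm L (suc a))))
              (sym (+-assoc θ (suc a) L)))))
            (trans (sym eq) (cong W (trans (+-assoc τ (suc a) L)
                (trans (cong (τ +_) (trans (+-comm (suc a) L) (sym len))) (sym (+-assoc τ (suc ℓ + a) d)))))))))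

    -- A window of the cycle is not repeated at a distance y ≤ L - d: otherwise d would divide y,
    -- and the repetition would be part of a long run of period d.
    far-period : ∀ {o s y} → 0 < y → y ≤ L → Match o s L → Run y s L → L < d + y
    far-period {o} {s} {y} 0<y y≤L h run = ≰⇒> λ le → <-irrefl refl
        (no-long {o} {s} {L} (λ t t<d → h t (<-≤-trans t<d d≤L))
      (run-of-divisor 0<d 0<y (primitive-divides {f = λ t → W (s + t)} 0<d 0<y prim le Pd
          (Within⇒Period (Run⇒Within run))) y≤L run (Period-≤ y≤L Pd)))
      where
      Pd : Period (λ t → W (s + t)) d L
      Pd = subst (Period (λ t → W (s + t)) d) ℓ+d
          (Run⇒Period (match⇒run {o} {s} ℓ λ t t< → h t (subst (t <_) ℓ+d t<)))
      prim : Primitive (λ t → W (s + t)) d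
      prim = Primitive-cong (λ t t<d → sym (h t (<-≤-trans t<d d≤L))) (rotation-primitive {q} isC o)

    exit-period : ∀ {θ P D} → Exit θ P → 0 < D → D < n → Match θ (P + D) (suc L) → D + L < n → Run D P L × L < d + D
    exit-period {θ} {P} {D} (exits m _) 0<D D<n m′ lt = run , far-period {θ} {P} 0<D
        (lin 1 (lt ⊞ n≤2L) (solve 3 (λ a b c → a :+ (b :+ con 2 :* c) :+ con 1 := c :+ (con 1 :+ (a :+ c) :+ b)) refl
        D n L)) m run
      where
      run : Run D P L
      run = Eq⇒Run λ t t<L → trans (m t t<L) (sym (m′ t (m<n⇒m<1+n t<L)))

    exit-Eq : ∀ {θ P D} → Exit θ P → Match θ (P + D) (suc L) → Eq L P (P + D)
    exit-Eq (exits m _) m′ t t<L = trans (m t t<L) (sym (m′ t (m<n⇒m<1+n t<L)))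

    -- By gap, the distance D of the jump or the complementary distance n - D is less than n - L;
    -- by far-period it is greater than L - d.
    far : ∀ {θ P} → Exit θ P → 2 * L < n + d
    far {θ} {P} ex with jump ex
    ... | D , 0<D , D<n , m′ with gap noTriple 0<D D<n (exit-Eq ex m′)
    ... | inj₁ lt = (lin 1 ((proj₂ (exit-period ex 0<D D<n m′ lt)) ⊞ lt)
        (solve 4 (λ a b c d → con 1 :+ con 2 :* a :+ (b :+ c :+ d) :+ con 1 :=
        d :+ b :+ (con 1 :+ a :+ (con 1 :+ (c :+ a)))) refl L d D n))
    ... | inj₂ L<D with m≤n⇒∃[o]m+o≡n (<⇒≤ D<n)
    ... | y , total = (lin 1 (sep ⊞ L<D ⊞ (≤-reflexive total))
        (solve 5 (λ a b c d e → con 1 :+ con 2 :* a :+ (b :+ c :+ d :+ e) :+ con 1 :=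
        e :+ b :+ (con 1 :+ a :+ (con 1 :+ a) :+ (d :+ c))) refl L d y D n))
      where
      run : Run y (P + D) L
      run = Eq⇒Run (Eq-trans {i = P + D} {P} {P + D + y} (Eq-sym {i = P} (exit-Eq ex m′))
          (subst (Eq L P) (trans (cong (P +_) (sym total)) (sym (+-assoc P D y))) (Eq-sym {i = P + n} (Eq-+n L P))))
      sep : L < d + y
      sep = far-period {θ} {P + D} {y} (lin 0 (D<n ⊞ (≤-reflexive (sym total)))
          (solve 3 (λ a b c → con 1 :+ con 0 :+ (a :+ (b :+ c)) :+ con 0 := c :+ (con 1 :+ b :+ a)) refl n D y))
          (lin 1 ((≤-reflexive total) ⊞ L<D ⊞ n≤2L) (solve 4 (λ a b c d → a :+ (b :+ c :+ con 2 :* d) :+ con 1 :=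
          d :+ (c :+ a :+ (con 1 :+ d) :+ b)) refl y n D L))
          (λ t t<L → m′ t (m<n⇒m<1+n t<L)) run

    some-exit : ∃ λ θ → ∃ λ P → Exit θ P
    some-exit with T-full q L≤T 0
    ... | occurs i _ h with follow {0} {i} h
    ... | α , _ , _ , _ , ex = α , i + α , ex

    open TopBound (topBound {q} d<n) public

    -- If q has squares of exponent at least 2, it provides d good levels by itself.
    powers-goal : ∀ {i} → I ≡ suc (suc i) → Goal
    powers-goal {i} e = (lin (5 + (G (suc L)))
        ((power-class {q} {i} isC d≤L (subst (λ z → N q + z * d ≤ suc (T q)) e N+Id≤T+1)) ⊞
        (far (proj₂ (proj₂ some-exit)))) (solve 4 (λ a b c d → con 2 :* a :+ (b :+ (c :+ d)) :+ (con 5 :+ b) :=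
        c :+ con 4 :+ con 2 :* b :+ (d :+ (con 1 :+ con 2 :* a))) refl L (G (suc L)) n d))

    -- The number of squares of exponent 1.
    K : ℕ
    K = #squares q 1

    -- The level T is not available through a run of q, so it is available through squares of
    -- exponent 1.
    many-squares : I ≤ 1 → L < d + K
    many-squares I≤1 with T-available q
    ... | inj₁ (j , _ , occ) = ⊥-elim (broken j (Occ-≤ (+-monoʳ-≤ d L≤T) occ))
    ... | inj₂ (i , i<b , le , lt) with I-max i i<b
        (≰⇒> λ K≤0 → (lin⊥ 0 (K≤0 ⊞ le ⊞ lt)
        (solve 4 (λ a b c d → con 0 :+ a :+ (b :+ con 2 :* c :+ d) :+ (con 1 :+ con 0) :=
        d :+ (b :+ con 2 :* c) :+ (con 1 :+ a)) refl (T q) d (i * d) (#squares q (suc i)))))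
    ... | i<I with i
    ... | suc i′ = ⊥-elim (<⇒≱ (≤-trans (s≤s (s≤s z≤n)) i<I) I≤1)
    ... | zero = ≤-<-trans L≤T (subst (λ z → T q < z + #squares q 1) (+-identityʳ d) lt)

    -- The ends of the runs of a broken class

    -- Period d fails at position z.
    Breaks : ℕ → Set
    Breaks z = W z ≢ W (z + d)

    -- A run of period d with r equalities ends with a failure at a position congruent to z
    -- modulo n.
    record End (z r : ℕ) : Set where
      constructor end
      field
        start  : ℕ
        ends   : (start + r) % n ≡ z
        run    : Run d start r
        breaks : Breaks (start + r)

    agree-≡% : ∀ {x y} → x % n ≡ y % n → W x ≡ W (x + d) → W y ≡ W (y + d)
    agree-≡% {x} {y} e h = trans (trans (W-% y) (trans (cong W (sym e)) (sym (W-% x)))) (trans h (W-≡% e d))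

    -- The position x is one of the last r positions up to and including z, modulo n.
    Before : ℕ → ℕ → ℕ → Set
    Before z r x = ∃ λ t → t < r × (x + t) % n ≡ z

    abstract
      Before? : ∀ z r x → Dec (Before z r x)
      Before? z r x = anyUpTo? (λ t → (x + t) % n ≟ z) r

    before-count : ∀ {z r} → r ≤ n → z < n → r ≤ count (Before? z r) n
    before-count {z} {r} r≤n z<n = ≤-trans (≤-reflexive (sym (count-all (λ _ → yes tt) 0 r λ _ _ → tt)))
        (count-inj (λ _ → yes tt) (Before? z r) {r} {n} (λ t x → (x + t) % n ≡ z) hit λ {t} {t′} {x} t<r t′<r e e′ →
          %-injective n x (<-≤-trans t<r r≤n) (<-≤-trans t′<r r≤n) (trans (cong (_% n) (+-comm t x))
              (trans (trans e (sym e′)) (cong (_% n) (+-comm x t′)))))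
      where
      hit : ∀ {t} → t < r → ⊤ → ∃ λ x → x < n × Before z r x × (x + t) % n ≡ z
      hit {t} t<r _ = (z + (n ∸ t)) % n , m%n<n (z + (n ∸ t)) n , (t , t<r , at) , at
        where
        at : ((z + (n ∸ t)) % n + t) % n ≡ z
        at = trans (%-absorb n (z + (n ∸ t)) t)
            (trans (cong (_% n) (trans (+-assoc z (n ∸ t) t) (cong (z +_) (m∸n+n≡m (≤-trans (<⇒≤ t<r) r≤n)))))
            (trans ([m+n]%n≡m%n z n) (m<n⇒m%n≡m z<n)))

    inside-run : ∀ {z z′ r r′ t t′} → End z r → End z′ r′ → ∀ x → t < t′ → t′ < r′ → (x + t) % n ≡ z →
        (x + t′) % n ≡ z′ → ⊥
    inside-run {r = r} {r′} {t} {t′} (end y e₁ _ br) (end y′ e₂ run′ _) x t<t′ t′<r′ e e′ with m≤n⇒∃[o]m+o≡n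
        (<⇒≤ t<t′)
    ... | δ , refl with m≤n⇒∃[o]o+m≡n {δ} {r′} (≤-trans (m≤n+m δ t) (<⇒≤ t′<r′))
    ... | ρ , refl = br (agree-≡% {y′ + ρ} {y + r}
        (trans (%-cancel δ (trans (cong (_% n) (+-assoc y′ ρ δ))
        (trans e₂ (trans (sym e′) (cong (_% n) (sym (+-assoc x t δ))))))) (trans e (sym e₁)))
          (run′ ρ (lin 0 (t<t′) (solve 3 (λ a b c → con 1 :+ a :+ (b :+ c) :+ con 0 := a :+ c :+ (con 1 :+ b)) refl ρ
              t δ))))

    before-disjoint : ∀ {z z′ r r′} → End z r → End z′ r′ → z ≢ z′ → ∀ x → Before z r x → ¬ Before z′ r′ x
    before-disjoint E E′ z≢z′ x (t , t<r , e) (t′ , t′<r′ , e′) with <-cmp t t′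
    ... | tri≈ _ refl _ = z≢z′ (trans (sym e) e′)
    ... | tri< t<t′ _ _ = inside-run E E′ x t<t′ t′<r′ e e′
    ... | tri> _ _ t′<t = inside-run E′ E x t′<t t<r e′ e

    -- A square of length 2 d starts at x.
    abstract
      SquareAt? : ∀ x → Dec (Run d x d)
      SquareAt? x = Run? d x d

    -- Such a square does not start at one of the last d positions up to a failure of period d.
    square-disjoint : ∀ {z r r′} → r′ ≤ d → End z r → ∀ x → Run d x d → ¬ Before z r′ x
    square-disjoint {z} {r} {r′} r′≤d (end y e _ br) x run (t , t<r′ , e′) = br (agree-≡% {x + t} {y + r}
        (trans e′ (sym e)) (run t (<-≤-trans t<r′ r′≤d)))

    square-run : ∀ {j} → Square q 1 j → ∃ λ s → s < n × Match j s (d + d)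
    square-run {j} (_ , occurs s s<n h) = s , s<n , λ t lt → h t
        (subst (t <_) (solve 1 (λ x → x :+ x := con 2 :* (x :+ con 0)) refl d) lt)

    K≤squares : K ≤ count SquareAt? n
    K≤squares = count-inj (Square? q 1) SquareAt? {d} {n} (λ j s → Match j s d)
      (λ {j} _ sq → let (s , s<n , m) = square-run sq in s , s<n , match⇒run {j} {s} d m , λ t t<d → m t
          (<-≤-trans t<d (m≤m+n d d)))
      λ j<d j′<d m m′ → phase-unique {q} isC j<d j′<d λ t t<d → trans (sym (m t t<d)) (m′ t t<d)

    r<n : ∀ {r} → r ≤ d → r ≤ n
    r<n r≤d = ≤-trans r≤d (<⇒≤ d<n)

    -- At least K positions start squares of length 2 d, and d positions belong to each end; all
    -- these sets are disjoint.
    two-ends : ∀ {z₁ z₂} → z₁ < n → z₂ < n → End z₁ d → End z₂ d → z₁ ≢ z₂ → K + 2 * d ≤ n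
    two-ends {z₁} {z₂} z₁<n z₂<n E₁ E₂ ne = (lin 0 (K≤squares ⊞ (before-count (r<n ≤-refl) z₁<n) ⊞
        (before-count (r<n ≤-refl) z₂<n) ⊞ c₁ ⊞ c₂ ⊞ (count≤ U₂? n))
        (solve 8 (λ a b c d e f g h → a :+ con 2 :* b :+ (c :+ d :+ e :+ f :+ g :+ h) :+ con 0 :=
        h :+ (a :+ b :+ b :+ (c :+ d) :+ (f :+ e) :+ g)) refl K d (count SquareAt? n) (count (Before? z₁ d) n)
        (count (Before? z₂ d) n) (count U₁? n) (count U₂? n) n))
      where
      U₁? = λ x → SquareAt? x ⊎-dec Before? z₁ d x
      U₂? = λ x → U₁? x ⊎-dec Before? z₂ d x
      c₁ = count-disjoint SquareAt? (Before? z₁ d) n (square-disjoint {z₁} {d} {d} ≤-refl E₁)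
      c₂ = count-disjoint U₁? (Before? z₂ d) n λ { x (inj₁ s) → square-disjoint {z₂} {d} {d} ≤-refl E₂ x s ; x
          (inj₂ f) → before-disjoint E₁ E₂ ne x f }

    -- With a third end, to which ℓ + 1 positions belong, there would be more than n positions.
    three-ends : ∀ {z₁ z₂ z₃} → L < d + K → suc ℓ ≤ d → z₁ < n → z₂ < n → z₃ < n → End z₁ d → End z₂ d → End z₃
        (suc ℓ) → z₁ ≢ z₂ → z₁ ≢ z₃ → z₂ ≢ z₃ → ⊥
    three-ends {z₁} {z₂} {z₃} L<d+K h≤d z₁<n z₂<n z₃<n E₁ E₂ E₃ ne₁₂ ne₁₃ ne₂₃ =
        (lin⊥ 1 (K≤squares ⊞ (before-count (r<n ≤-refl) z₁<n) ⊞ (before-count (r<n ≤-refl) z₂<n) ⊞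
        (before-count (r<n h≤d) z₃<n) ⊞ c₁ ⊞ c₂ ⊞ c₃ ⊞ (count≤ U₃? n) ⊞ L<d+K ⊞ (≤-reflexive (sym ℓ+d)) ⊞ n≤2L)
        (solve 12 (λ a b c d e f g h i j k l → a :+ b :+ c :+ d :+ e :+ f :+ g :+ h :+ (i :+ j) :+ (k :+ i) :+ con
        2 :* l :+ (con 1 :+ con 1) := j :+ i :+ i :+ (con 1 :+ k) :+ (a :+ b) :+ (e :+ c) :+ (f :+ d) :+ g :+ (con
        1 :+ l) :+ l :+ h) refl (count SquareAt? n) (count (Before? z₁ d) n) (count (Before? z₂ d) n)
        (count (Before? z₃ (suc ℓ)) n) (count U₁? n) (count U₂? n) (count U₃? n) n d K ℓ L))
      where
      U₁? = λ x → SquareAt? x ⊎-dec Before? z₁ d x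
      U₂? = λ x → U₁? x ⊎-dec Before? z₂ d x
      U₃? = λ x → U₂? x ⊎-dec Before? z₃ (suc ℓ) x
      c₁ = count-disjoint SquareAt? (Before? z₁ d) n (square-disjoint {z₁} {d} {d} ≤-refl E₁)
      c₂ = count-disjoint U₁? (Before? z₂ d) n λ { x (inj₁ s) → square-disjoint {z₂} {d} {d} ≤-refl E₂ x s ; x
          (inj₂ f) → before-disjoint E₁ E₂ ne₁₂ x f }
      c₃ = count-disjoint U₂? (Before? z₃ (suc ℓ)) n λ { x (inj₁ (inj₁ s)) → square-disjoint {z₃} {suc ℓ} {suc ℓ} h≤d
          E₃ x s ;
             x (inj₁ (inj₂ f)) → before-disjoint E₁ E₃ ne₁₃ x f ; x (inj₂ f) → before-disjoint E₂ E₃ ne₂₃ x f }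

    -- The run beginning with the square of length 2 d at phase j has e ≥ d equalities and ends
    -- at z.
    record SquareEnd (j z : ℕ) : Set where
      constructor squareEnd
      field
        s e    : ℕ
        d≤e    : d ≤ e
        e<L    : e < L
        match  : Match j s (e + d)
        breaks : Breaks (s + e)
        ends   : (s + e) % n ≡ z

    square-end : ∀ {j} → Square q 1 j → ∃ λ z → z < n × SquareEnd j z
    square-end {j} sq with square-run {j} sq
    ... | s , s<n , m with run-exit 0<d d<n s
    ... | e , run , br = (s + e) % n , m%n<n (s + e) n , squareEnd s e
          (≮⇒≥ λ e<d → br (match⇒run {j} {s} d m e e<d)) (no-long {j} {s} first run) (match-run {q} {s} {j} first
              run) br refl
      where
      first : Match j s d
      first t t<d = m t (<-≤-trans t<d (m≤m+n d d))

    squareEnd⇒End : ∀ {j z} → SquareEnd j z → End z d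
    squareEnd⇒End {j} (squareEnd s e d≤e _ m br at) with m≤n⇒∃[o]o+m≡n d≤e
    ... | o , refl = end (s + o) (trans (cong (_% n) (+-assoc s o d)) at)
          (λ t t<d → trans (cong W (+-assoc s o t)) (trans (match⇒run {j} {s} (o + d) m (o + t) (+-monoʳ-< o t<d))
              (cong W (cong (_+ d) (sym (+-assoc s o t))))))
          (subst Breaks (sym (+-assoc s o d)) br)

    abstract
      -- The end belonging to the square at phase j; the value 0 for other phases is immaterial.
      endOf : ℕ → ℕ
      endOf j with Square? q 1 j
      ... | yes sq = proj₁ (square-end sq)
      ... | no _   = 0

      endOf-spec : ∀ {j} → Square q 1 j → endOf j < n × SquareEnd j (endOf j)
      endOf-spec {j} sq with Square? q 1 j
      ... | yes sq′ = proj₂ (square-end sq′)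
      ... | no ¬sq  = ⊥-elim (¬sq sq)

    EndsAt? : ∀ z j → Dec (Square q 1 j × endOf j ≡ z)
    EndsAt? z j = Square? q 1 j ×-dec (endOf j ≟ z)

    -- At most B squares end at z if the runs that they begin have fewer than d + B equalities:
    -- distinct squares begin their runs at distinct distances from z.
    ends-count : ∀ {z B} → (∀ {j} → (E : SquareEnd j z) → SquareEnd.e E < d + B) → count (EndsAt? z) d ≤ B
    ends-count {z} {B} bound = ≤-trans (count-inj (EndsAt? z) (λ _ → yes tt) {d} {B}
        (λ j r → ∃ λ s → (s + (d + r)) % n ≡ z × Match j s d) hit
        λ { j<d j′<d (s , e , m) (s′ , e′ , m′) → phase-unique {q} isC j<d j′<d λ t t<d → trans (sym (m t t<d))
            (trans (W-≡% (%-cancel _ (trans e (sym e′))) t) (m′ t t<d)) }) (count≤ (λ _ → yes tt) B)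
      where
      hit : ∀ {j} → j < d → Square q 1 j × endOf j ≡ z → ∃ λ r → r < B × ⊤ × ∃ λ s → (s + (d + r)) % n ≡ z × Match j
          s d
      hit {j} _ (sq , refl) = found (proj₂ (endOf-spec {j} sq))
        where
        found : SquareEnd j (endOf j) → ∃ λ r → r < B × ⊤ × ∃ λ s → (s + (d + r)) % n ≡ endOf j × Match j s d
        found E@(squareEnd s e d≤e e<L m br at) with m≤n⇒∃[o]m+o≡n d≤e
        ... | r , refl = r , +-cancelˡ-< d r B (bound E) , tt , s , at , λ t t<d → m t
            (<-≤-trans t<d (m≤n+m d (d + r)))

    -- Two runs and the jumps between them

    module Corners (L<d+K : L < d + K) where

      K≤d : K ≤ d
      K≤d = #squares≤d q 1

      ℓ<K : ℓ < K
      ℓ<K = (lin 0 (L<d+K ⊞ (≤-reflexive ℓ+d)) (solve 4 (λ a b c d → con 1 :+ a :+ (b :+ c :+ d) :+ con 0 :=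
          c :+ (con 1 :+ d :+ (a :+ b))) refl ℓ d K L))

      h≤d : suc ℓ ≤ d
      h≤d = ≤-trans ℓ<K K≤d

      End-≤ : ∀ {z r r′} → r′ ≤ r → End z r → End z r′
      End-≤ {z} {r} {r′} le (end y e run br) with m≤n⇒∃[o]o+m≡n le
      ... | o , refl = end (y + o) (trans (cong (_% n) (+-assoc y o r′)) e)
            (λ t t<r′ → trans (cong W (+-assoc y o t)) (trans (run (o + t) (+-monoʳ-< o t<r′))
                (cong W (cong (_+ d) (sym (+-assoc y o t))))))
            (subst Breaks (sym (+-assoc y o r′)) br)

      -- The runs of the squares of q end at two places z₁ and z₂, and so does every run of period d
      -- with at least ℓ + 1 equalities.
      record TwoEnds : Set where
        field
          z₁ z₂ : ℕ
          z₁<n  : z₁ < n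
          z₂<n  : z₂ < n
          j₁ j₂ : ℕ
          S₁    : SquareEnd j₁ z₁
          S₂    : SquareEnd j₂ z₂
          other : ∀ {z} → z < n → End z (suc ℓ) → z ≢ z₁ → z ≡ z₂
          total : K ≤ count (EndsAt? z₁) d + count (EndsAt? z₂) d
          room  : K + 2 * d ≤ n

      abstract
        -- One end accounts for at most ℓ < K squares, so there is a second one; three-ends excludes
        -- a third one.
        find-ends : TwoEnds
        find-ends = second (count-positive (Square? q 1) d (≤-<-trans z≤n ℓ<K))
          where
          Elsewhere? : ∀ j₁ j → Dec (Square q 1 j × endOf j ≢ endOf j₁)
          Elsewhere? j₁ j = Square? q 1 j ×-dec ¬? (endOf j ≟ endOf j₁)
          both : ∀ j₁ → Square q 1 j₁ → (∃ λ j₂ → j₂ < d × (Square q 1 j₂ × endOf j₂ ≢ endOf j₁)) → TwoEnds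
          both j₁ sq₁ (j₂ , _ , sq₂ , ne) = record { z₁ = z₁ ; z₂ = z₂ ; z₁<n = proj₁ spec₁ ; z₂<n = proj₁ spec₂ ; j₁
              = j₁ ; j₂ = j₂ ; S₁ = proj₂ spec₁ ; S₂ = proj₂ spec₂
              ; other = only ; total = sum ; room = two-ends (proj₁ spec₁) (proj₁ spec₂)
                  (squareEnd⇒End (proj₂ spec₁)) (squareEnd⇒End (proj₂ spec₂)) (λ e → ne (sym e)) }
            where
            z₁ z₂ : ℕ
            z₁ = endOf j₁
            z₂ = endOf j₂
            spec₁ : z₁ < n × SquareEnd j₁ z₁
            spec₁ = endOf-spec {j₁} sq₁
            spec₂ : z₂ < n × SquareEnd j₂ z₂
            spec₂ = endOf-spec {j₂} sq₂
            only : ∀ {z} → z < n → End z (suc ℓ) → z ≢ z₁ → z ≡ z₂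
            only {z} z<n E ne₁ = decidable-stable (z ≟ z₂) λ ne₂ → three-ends L<d+K h≤d (proj₁ spec₁) (proj₁ spec₂)
                z<n (squareEnd⇒End (proj₂ spec₁)) (squareEnd⇒End (proj₂ spec₂)) E
              (λ e → ne (sym e)) (λ e → ne₁ (sym e)) λ e → ne₂ (sym e)
            rest≤ : count (Elsewhere? j₁) d ≤ count (EndsAt? z₂) d
            rest≤ = count-⊆ (Elsewhere? j₁) (EndsAt? z₂) d λ { j _ (sq , e≢) → sq , only (proj₁ (endOf-spec {j} sq))
                (End-≤ h≤d (squareEnd⇒End (proj₂ (endOf-spec {j} sq)))) e≢ }
            sum : K ≤ count (EndsAt? z₁) d + count (EndsAt? z₂) d
            sum = (lin 0 ((≤-reflexive (sym (count-split (Square? q 1) (λ j → endOf j ≟ z₁) d))) ⊞ rest≤)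
                (solve 4 (λ a b c d → a :+ (b :+ c :+ d) :+ con 0 := b :+ d :+ (a :+ c)) refl K
                (count (EndsAt? z₁) d) (count (Elsewhere? j₁) d) (count (EndsAt? z₂) d)))
          second : (∃ λ j₁ → j₁ < d × Square q 1 j₁) → TwoEnds
          second (j₁ , _ , sq₁) = both j₁ sq₁ (count-positive (Elsewhere? j₁) d
              (lin 0 ((≤-reflexive (sym (count-split (Square? q 1) (λ j → endOf j ≟ endOf j₁) d))) ⊞ few ⊞ ℓ<K)
              (solve 4 (λ a b c d → con 1 :+ con 0 :+ (a :+ b :+ c :+ d) :+ con 0 := b :+ (d :+ a :+ (con 1 :+ c)))
              refl (count (EndsAt? (endOf j₁)) d) (count (Elsewhere? j₁) d) ℓ K)))
            where
            few : count (EndsAt? (endOf j₁)) d ≤ ℓ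
            few = ends-count λ E → subst (SquareEnd.e E <_) (trans (sym ℓ+d) (+-comm ℓ d)) (SquareEnd.e<L E)

      -- The longest run of period d ending at z with fewer than L equalities.  It starts at a, has
      -- d + μ equalities, and its last L letters form the window at P at which W leaves the cycle.
      -- At most μ + 1 squares end at z.
      record Block (z : ℕ) : Set where
        field
          a μ θ P : ℕ
          short   : d + μ < L
          run     : Run d a (d + μ)
          a-end   : a + (d + μ) ≡ z + n
          maximal : ∀ {y m} → m < L → Run d y m → (y + m) % n ≡ z → m ≤ d + μ
          P-end   : P + ℓ ≡ z + n
          exit    : Exit θ P
          squares≤ : count (EndsAt? z) d ≤ suc μ

      run-back : ∀ {z y m} → z < n → m < L → Run d y m → (y + m) % n ≡ z → Run d (z + n ∸ m) m
      run-back {z} {y} {m} z<n m<L run e = Run-≡%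
          (%-cancel m (trans e (trans (sym (trans ([m+n]%n≡m%n z n) (m<n⇒m%n≡m z<n)))
        (cong (_% n) (sym (m∸n+n≡m (≤-trans (<⇒≤ (<-trans m<L L<n)) (m≤n+m n z)))))))) run

      abstract
        block : ∀ {j z} → z < n → SquareEnd j z → Block z
        block {j} {z} z<n (squareEnd s e d≤e e<L m br at) = [ longest , (λ none → ⊥-elim (none e e<L here-run)) ]′
            (greatest (λ m → Run? d (z + n ∸ m) m) L)
          where
          here-run : Run d (z + n ∸ e) e
          here-run = run-back z<n e<L (match⇒run {j} {s} e m) at
          longest : (∃ λ M → M < L × Run d (z + n ∸ M) M × (∀ i → M < i → i < L → ¬ Run d (z + n ∸ i) i)) → Block z
          longest (M , M<L , run , max) = build
              (m≤n⇒∃[o]m+o≡n {d} {M} (≤-trans d≤e (≮⇒≥ λ M<e → max e M<e e<L here-run)))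
              (m≤n⇒∃[o]m+o≡n {ℓ} {e} (≤-trans (<⇒≤ h≤d) d≤e))
            where
            build : (∃ λ μ → d + μ ≡ M) → (∃ λ ε → ℓ + ε ≡ e) → Block z
            build (μ , refl) (ε , refl) = record { a = z + n ∸ (d + μ) ; μ = μ ; θ = j + ε ; P = P ; short = M<L ;
                run = run ; a-end = m∸n+n≡m (≤-trans (<⇒≤ (<-trans M<L L<n)) (m≤n+m n z))
                ; maximal = maximal ; P-end = P-end ; exit = exits inside′ leaves′
                ; squares≤ = ends-count λ { {i} (squareEnd s′ e′ _ e′<L m′ _ at′) → ≤-trans
                    (s≤s (maximal e′<L (match⇒run {i} {s′} e′ m′) at′)) (≤-reflexive (sym (+-suc d μ))) } }
              where
              maximal : ∀ {y m} → m < L → Run d y m → (y + m) % n ≡ z → m ≤ d + μ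
              maximal {y} {m} m<L run e = ≮⇒≥ λ lt → max m lt m<L (run-back z<n m<L run e)
              P : ℕ
              P = z + n ∸ ℓ
              P-end : P + ℓ ≡ z + n
              P-end = m∸n+n≡m (≤-trans (≤-trans (m≤m+n ℓ d) (≤-trans (≤-reflexive ℓ+d) (<⇒≤ L<n))) (m≤n+m n z))
              P≡ : P % n ≡ (s + ε) % n
              P≡ = %-cancel ℓ (trans (cong (_% n) P-end)
                  (trans ([m+n]%n≡m%n z n)
                  (trans (m<n⇒m%n≡m z<n) (trans (sym at)
                  (cong (_% n) (solve 3 (λ s l e → s :+ (l :+ e) := s :+ e :+ l) refl s ℓ ε))))))
              here-at : ∀ t → W (P + t) ≡ W (s + (ε + t))
              here-at t = trans (W-≡% P≡ t) (cong W (+-assoc s ε t))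
              inside′ : Match (j + ε) P L
              inside′ t t<L = trans (here-at t)
                  (trans (m (ε + t) (lin 0 ((≤-reflexive (sym ℓ+d)) ⊞ t<L)
                  (solve 5 (λ a b c d e → con 1 :+ (a :+ b) :+ (c :+ d :+ e) :+ con 0 :=
                  c :+ a :+ d :+ (e :+ (con 1 :+ b))) refl ε t ℓ d L))) (cong u (sym (+-assoc j ε t))))
              ε+L : ε + L ≡ ℓ + ε + d
              ε+L = trans (cong (ε +_) (sym ℓ+d)) (solve 3 (λ e l d → e :+ (l :+ d) := l :+ e :+ d) refl ε ℓ d)
              leaves′ : W (P + L) ≢ u (j + ε + L)
              leaves′ eq = br (trans (m (ℓ + ε) (m<m+n (ℓ + ε) 0<d)) (trans (sym (word-period q (j + (ℓ + ε))))
                  (trans (cong u (trans (+-assoc j (ℓ + ε) d) (trans (cong (j +_) (sym ε+L)) (sym (+-assoc j ε L)))))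
                (trans (sym eq) (trans (here-at L) (cong W (trans (cong (s +_) ε+L) (sym (+-assoc s (ℓ + ε) d)))))))))

      -- The jump by D from the exit at P, and the α letters that W follows the cycle afterwards,
      -- until the next exit at P + D + α.
      record Step (θ P : ℕ) : Set where
        field
          D α   : ℕ
          0<D   : 0 < D
          D<n   : D < n
          0<α   : 0 < α
          α<d   : α < d
          again : Match θ (P + D) (L + α)
          exit′ : Exit (θ + α) (P + D + α)
          moved : (P + D + α) % n ≢ P % n

      abstract
        step : ∀ {θ P} → Exit θ P → Step θ P
        step {θ} {P} ex with jump ex
        ... | D , 0<D , D<n , m with follow {θ} {P + D} m
        ... | α , 0<α , α<d , m′ , ex′ = record { D = D ; α = α ; 0<D = 0<D ; D<n = D<n ; 0<α = 0<α ; α<d = α<d ;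
            again = m′ ; exit′ = ex′
            ; moved = λ e → <⇒≱ α<d (∣⇒≤ {{>-nonZero 0<α}} (phase-shift {q} isC θ α λ t t<d → trans
                (sym (inside ex t (<-≤-trans t<d d≤L)))
                (trans (sym (W-≡% e t)) (inside ex′ t (<-≤-trans t<d d≤L))))) }

      exit-breaks : ∀ {θ P} → Exit θ P → Breaks (P + ℓ)
      exit-breaks {θ} {P} (exits m ne) h = ne (trans (cong W (trans (cong (P +_) (sym ℓ+d)) (sym (+-assoc P ℓ d))))
          (trans (sym h) (trans (m ℓ (<-≤-trans (m<m+n ℓ 0<d) (≤-reflexive ℓ+d)))
        (trans (sym (word-period q (θ + ℓ))) (cong u (trans (+-assoc θ ℓ d) (cong (θ +_) ℓ+d)))))))

      step-run : ∀ {θ P} (S : Step θ P) → Run d (P + Step.D S) (ℓ + Step.α S)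
      step-run {θ} {P} S = match⇒run {θ} {P + D} (ℓ + α) λ t t< → again t
          (<-≤-trans t< (≤-reflexive (trans (solve 3 (λ l a d → l :+ a :+ d := l :+ d :+ a) refl ℓ α d)
          (cong (_+ α) ℓ+d))))
        where open Step S

      step-end : ∀ {θ P} (S : Step θ P) → End ((P + Step.D S + Step.α S + ℓ) % n) (suc ℓ)
      step-end {θ} {P} S with Step.α S | Step.0<α S | step-run S | exit-breaks (Step.exit′ S)
      ... | suc a | _ | run | br = end (P + D + a) (cong (_% n) eq) (λ t t< → trans (cong W (+-assoc (P + D) a t))
          (trans (run (a + t) (lin 0 (t<) (solve 3 (λ a b c → con 1 :+ (a :+ b) :+ (con 1 :+ c) :+ con 0 :=
          c :+ (con 1 :+ a) :+ (con 1 :+ b)) refl a t ℓ))) (cong W (cong (_+ d) (sym (+-assoc (P + D) a t))))))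
            (subst Breaks (sym eq) br)
        where
        D = Step.D S
        eq : P + D + a + suc ℓ ≡ P + D + suc a + ℓ
        eq = solve 3 (λ x a l → x :+ a :+ (con 1 :+ l) := x :+ (con 1 :+ a) :+ l) refl (P + D) a ℓ

      -- The run after a jump does not reach the failure at P + ℓ one period later.
      step-short : ∀ {θ P} → Exit θ P → (S : Step θ P) → Step.D S + Step.α S < n
      step-short {θ} {P} ex S = ≤∧≢⇒< (≮⇒≥ λ n< → exit-breaks ex (agree-≡% ([m+n]%n≡m%n (P + ℓ) n)
          (run-at (step-run S) (P + ℓ + n)
          (lin (ℓ + 1) (D<n) (solve 4 (λ a b c d → a :+ b :+ c :+ (d :+ con 1) := a :+ d :+ c :+ (con 1 :+ b)) refl P
              D n ℓ)) (lin 0 (n<) (solve 5 (λ a b c d e → con 1 :+ (a :+ b :+ c) :+ (d :+ e) :+ con 0 :=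
              a :+ d :+ (b :+ e) :+ (con 1 :+ c)) refl P ℓ n D α)))))
          λ e → moved (trans (cong (_% n) (trans (+-assoc P D α) (cong (P +_) e))) ([m+n]%n≡m%n P n))
        where open Step S

      -- A jump longer than d: run-gap gives a stretch of period D - d.
      gap-goal : ∀ {θ P D} → Exit θ P → Run D P L → d < D → L + 2 * D ≤ n + d → Goal
      gap-goal {θ} {P} {D} ex run d<D small with m≤n⇒∃[o]m+o≡n (<⇒≤ d<D)
      ... | g , refl with save (suc L) {g} {P + d} {ℓ}
          (lin 0 (d<D) (solve 2 (λ a b → con 1 :+ con 0 :+ (a :+ b) :+ con 0 := b :+ (con 1 :+ a)) refl d g))
          (lin (d + g) (small ⊞ 0<L) (solve 4 (λ a b c d → con 1 :+ a :+ (b :+ c :+ d) :+ (c :+ a) :=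
          b :+ (d :+ con 2 :* (c :+ a) :+ (con 1 :+ con 0))) refl g n d L))
            (run-gap {d} {g} {P} ℓ ℓ+d (λ t lt → match⇒run {θ} {P} ℓ
                (λ s s< → inside ex s (<-≤-trans s< (≤-reflexive ℓ+d))) t
                (+-cancelʳ-< d t ℓ (<-≤-trans lt (≤-reflexive (sym ℓ+d))))) run)
      ... | inj₁ h = (lin 4 (h ⊞ (≤-reflexive (sym ℓ+d)) ⊞ small)
          (solve 6 (λ a b c d e f → con 2 :* a :+ (con 2 :* b :+ con 2 :* c :+ (d :+ e) :+ (f :+ e)) :+ con 4 :=
          f :+ con 4 :+ con 2 :* b :+ (d :+ a :+ (a :+ con 2 :* (e :+ c)))) refl L (G (suc L)) g ℓ d n))
      ... | inj₂ h = (≮⇒≥ (λ h₋ → lin⊥ (18 + 2 * d + n + 2 * (G (suc L))) (h ⊞ h ⊞ h ⊞ h ⊞ small ⊞ small ⊞ h₋ ⊞ h₋ ⊞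
          h₋) (solve 5 (λ a b c d e → a :+ b :+ (a :+ b) :+ (a :+ b) :+ (a :+ b) :+ (c :+ d) :+ (c :+ d) :+ con
          2 :* e :+ con 2 :* e :+ con 2 :* e :+ (con 1 :+ (con 18 :+ con 2 :* d :+ c :+ con 2 :* a)) := con
          1 :+ e :+ (con 1 :+ e) :+ (con 1 :+ e) :+ (con 1 :+ e) :+ (e :+ con 2 :* (d :+ b)) :+ (e :+ con
          2 :* (d :+ b)) :+ (con 1 :+ (c :+ con 4 :+ con 2 :* a)) :+ (con 1 :+ (c :+ con 4 :+ con 2 :* a)) :+ (con
          1 :+ (c :+ con 4 :+ con 2 :* a))) refl (G (suc L)) g n d L)))

      -- A jump shorter than d from the end of a run of period d: combining the two periods gives a
      -- stretch of period d - D.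
      short-goal : ∀ {P D a μ} → 0 < D → D < n → Run D P L → Run d a (d + μ) → a + (d + μ) ≡ P + ℓ → D < d →
          L < d + D → D + 2 * d ≤ n → d + L < n → Goal
      short-goal {P} {D} {a} {μ} 0<D D<n run run-d a-end D<d far small room with m≤n⇒∃[o]m+o≡n (<⇒≤ D<d) |
          m≤n⇒∃[o]o+m≡n {D} {L} (≤-trans (<⇒≤ D<d) d≤L)
      ... | g , D+g | m , m+D with m≤n⇒∃[o]m+o≡n {a + g} {P} (lin (μ + 1) ((≤-reflexive a-end) ⊞ (≤-reflexive D+g) ⊞
          far ⊞ (≤-reflexive ℓ+d))
          (solve 8 (λ a b c d e f g h → a :+ b :+ (c :+ d :+ e :+ (e :+ f) :+ g) :+ (h :+ con 1) :=
          c :+ (a :+ (e :+ h) :+ (f :+ b) :+ (con 1 :+ g) :+ (d :+ e))) refl a g P ℓ d D L μ))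
      ... | r , refl = finish {D} {g} {a + g + r} {a + r} {m} 0<D (lin 0 (D<d ⊞ (≤-reflexive (sym D+g)))
          (solve 3 (λ a b c → con 1 :+ con 0 :+ (a :+ (b :+ c)) :+ con 0 := c :+ (con 1 :+ b :+ a)) refl d D g)) run
            (consecutive-primitive 0<D (≤-trans (<⇒≤ D<d) d≤L) run (consecutive noTriple D<n (Run⇒Eq run))) m+D run-g
            (lin 0 (small ⊞ (≤-reflexive D+g) ⊞ (≤-reflexive D+g))
                (solve 4 (λ a b c d → a :+ con 2 :* (a :+ b) :+ (c :+ d :+ d) :+ con 0 :=
                c :+ (a :+ con 2 :* d :+ (a :+ b) :+ (a :+ b))) refl D g n d))
                (lin 6 (far ⊞ room) (solve 4 (λ a b c d → con 2 :* a :+ (b :+ c :+ d) :+ con 6 := d :+ c :+ con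
                4 :+ (con 1 :+ a :+ (con 1 :+ (b :+ a)))) refl L d D n))
        where
        run-g : Run g (a + r) m
        run-g t t<m = trans (trans (cong W (+-assoc a r t))
            (trans (run-d (r + t) (lin 0 ((≤-reflexive (sym a-end)) ⊞ t<m ⊞ (≤-reflexive m+D) ⊞
            (≤-reflexive (sym ℓ+d)) ⊞ (≤-reflexive (sym D+g)))
            (solve 10 (λ a b c d e f g h i j → con 1 :+ (a :+ b) :+ (c :+ (d :+ e) :+ f :+ g :+ (h :+ d) :+ (i :+ j))
            :+ con 0 := d :+ e :+ (c :+ j :+ a :+ h :+ (con 1 :+ b) :+ (f :+ i) :+ g :+ d)) refl r t a d μ m L ℓ D
            g)))
            (cong W (trans (cong (a + (r + t) +_) (sym D+g)) (solve 5 (λ a r t x g → a :+ (r :+ t) :+ (x :+ g) :=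
                a :+ g :+ r :+ t :+ x) refl a r t D g)))))
          (trans (sym (run t (lin D (t<m ⊞ (≤-reflexive m+D)) (solve 4 (λ a b c d → con 1 :+ a :+ (b :+ c) :+ d :=
              c :+ (con 1 :+ a :+ (b :+ d))) refl t m L D))))
              (cong W (solve 4 (λ a g r t → a :+ g :+ r :+ t := a :+ r :+ t :+ g) refl a g r t)))

      -- After a jump shorter than d the run before the jump ends at P + ℓ + d, and the run after it
      -- starts at a₂.  If they overlap in m letters, there is a stretch of period g = d - D with
      -- m + g letters.
      run-overlap : ∀ {P D α a₁ μ₁ a₂ μ₂ g} → Run D P L → 0 < D → D + g ≡ d → 0 < g → D + α < n → 0 < α →
        Run d a₁ (d + μ₁) → a₁ + (d + μ₁) ≡ P + ℓ → Run d a₂ (d + μ₂) → a₂ + (d + μ₂) ≡ P + D + α + ℓ → Breaks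
            (P + ℓ) → ℓ + α ≤ d + μ₂ →
        (P + ℓ + d ≤ a₂ + 2 * G (suc L) + 2 * g) ⊎ (suc L ≤ G (suc L) + g)
      run-overlap {P} {D} {α} {a₁} {μ₁} {a₂} {μ₂} {g} run 0<D D+g 0<g D+α<n 0<α run₁ end₁ run₂ end₂ br long with
          P + ℓ <? a₂ | a₂ ≤? P + ℓ + d
      ... | no ¬lt | _ = ⊥-elim
          (br (run-at run₂ (P + ℓ) (≮⇒≥ ¬lt) (lin α ((≤-reflexive (sym end₂)) ⊞ 0<D)
          (solve 7 (λ a b c d e f g → con 1 :+ (a :+ b) :+ (c :+ (d :+ e) :+ f) :+ g :=
          c :+ (d :+ e) :+ (a :+ f :+ g :+ b :+ (con 1 :+ con 0))) refl P ℓ a₂ d μ₂ D α))))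
      ... | yes b<a₂ | no ¬le = inj₁ (lin (2 * (G (suc L)) + 2 * g + 1) ((≰⇒> ¬le))
          (solve 6 (λ a b c d e f → a :+ b :+ c :+ d :+ (con 2 :* e :+ con 2 :* f :+ con 1) := d :+ con 2 :* e :+ con
          2 :* f :+ (con 1 :+ (a :+ b :+ c))) refl P ℓ d a₂ (G (suc L)) g))
      ... | yes b<a₂ | yes a₂≤ with m≤n⇒∃[o]o+m≡n {d} {a₂} (lin (1 + a₁ + μ₁) (b<a₂ ⊞ (≤-reflexive end₁))
          (solve 6 (λ a b c d e f → a :+ (b :+ (c :+ d)) :+ (con 1 :+ e :+ f) :=
          b :+ (con 1 :+ (c :+ d) :+ (e :+ (a :+ f)))) refl d a₂ P ℓ a₁ μ₁)) | m≤n⇒∃[o]o+m≡n a₂≤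
      ... | c , refl | m , m+a₂ with save (suc L) {g} {c} {m} 0<g (lin D ((≤-reflexive D+g) ⊞ d<n)
          (solve 4 (λ a b c d → con 1 :+ a :+ (b :+ c) :+ d := c :+ (d :+ a :+ (con 1 :+ b))) refl g d n D)) run-g
        where
        c+m : c + m ≡ P + ℓ
        c+m = (≤-antisym (lin 0 ((≤-reflexive m+a₂)) (solve 5 (λ a b c d e → a :+ b :+ (c :+ d :+ e) :+ con 0 :=
            c :+ d :+ (b :+ (a :+ e))) refl c m P ℓ d)) (lin 0 ((≤-reflexive (sym m+a₂)))
            (solve 5 (λ a b c d e → a :+ b :+ (c :+ (d :+ e)) :+ con 0 := d :+ c :+ (a :+ b :+ e)) refl P ℓ m c d)))
        a₁<c : a₁ < c
        a₁<c = (lin μ₁ (b<a₂ ⊞ (≤-reflexive end₁)) (solve 6 (λ a b c d e f → con 1 :+ a :+ (b :+ c :+ (d :+ e)) :+ f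
            := b :+ (con 1 :+ (d :+ e) :+ (a :+ (c :+ f)))) refl a₁ c d P ℓ μ₁))
        -- From P on the jump gives W w = W (w + D); for w < P the same holds after shifting both
        -- sides by d inside the two runs.
        by-D : ∀ w → c + g ≤ w → w < P + ℓ + g → W w ≡ W (w + D)
        by-D w lo hi with w <? P
        ... | no w≮P = run-at run w (≮⇒≥ w≮P) (lin D (hi ⊞ (≤-reflexive ℓ+d) ⊞ (≤-reflexive D+g))
            (solve 7 (λ a b c d e f g → con 1 :+ a :+ (b :+ c :+ d :+ e :+ f) :+ g :=
            b :+ e :+ (con 1 :+ a :+ (c :+ f) :+ (g :+ d))) refl w P ℓ g L d D))
        ... | yes w<P = trans (run-at run₁ w
            (lin (1 + g) (a₁<c ⊞ lo) (solve 4 (λ a b c d → a :+ (b :+ c) :+ (con 1 :+ d) :=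
            c :+ (con 1 :+ a :+ (b :+ d))) refl a₁ c w g)) (lin ℓ ((≤-reflexive (sym end₁)) ⊞ w<P)
            (solve 6 (λ a b c d e f → con 1 :+ a :+ (b :+ (c :+ d) :+ e) :+ f :=
            b :+ (c :+ d) :+ (e :+ f :+ (con 1 :+ a))) refl w a₁ d μ₁ P ℓ)))
              (trans (run-at run (w + d) (lin (ℓ + 1 + g) (b<a₂ ⊞ lo)
                  (solve 6 (λ a b c d e f → a :+ (b :+ c :+ d) :+ (e :+ con 1 :+ f) :=
                  d :+ c :+ (con 1 :+ (a :+ e) :+ (b :+ f))) refl P c d w ℓ g))
                  (lin 0 (w<P ⊞ d≤L) (solve 4 (λ a b c d → con 1 :+ (a :+ b) :+ (c :+ d) :+ con 0 :=
                  c :+ d :+ (con 1 :+ a :+ b)) refl w d P L)))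
              (trans (cong W (solve 3 (λ w d x → w :+ d :+ x := w :+ x :+ d) refl w d D))
                (sym (run-at run₂ (w + D) (lin 0 (lo ⊞ (≤-reflexive (sym D+g)))
                    (solve 5 (λ a b c d e → a :+ b :+ (c :+ (d :+ e)) :+ con 0 := c :+ d :+ (a :+ e :+ b)) refl c d w
                    D g)) (lin (α + ℓ) (w<P ⊞ (≤-reflexive (sym end₂)))
                    (solve 8 (λ a b c d e f g h → con 1 :+ (a :+ b) :+ (c :+ (d :+ e :+ (e :+ f))) :+ (g :+ h) :=
                    d :+ e :+ (e :+ f) :+ (con 1 :+ a :+ (c :+ b :+ g :+ h))) refl w D P c d μ₂ α ℓ))))))
        run-g : Run g c m
        run-g t t<m = trans (run-at run₁ (c + t)
            (lin (t + 1) (a₁<c) (solve 3 (λ a b c → a :+ b :+ (c :+ con 1) := b :+ c :+ (con 1 :+ a)) refl a₁ c t))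
            (lin 0 ((≤-reflexive (sym end₁)) ⊞ (≤-reflexive c+m) ⊞ t<m)
            (solve 8 (λ a b c d e f g h → con 1 :+ (a :+ b) :+ (c :+ (d :+ e) :+ (f :+ g) :+ h) :+ con 0 :=
            c :+ (d :+ e) :+ (f :+ g :+ (a :+ h) :+ (con 1 :+ b))) refl c t a₁ d μ₁ P ℓ m)))
          (trans (cong W (trans (cong (c + t +_) (sym D+g))
              (solve 4 (λ c t x g → c :+ t :+ (x :+ g) := c :+ t :+ g :+ x) refl c t D g)))
            (sym (by-D (c + t + g) (lin₀ t (solve 3 (λ a b c → a :+ b :+ c := a :+ c :+ b) refl c g t))
                (lin 0 ((≤-reflexive c+m) ⊞ t<m)
                (solve 6 (λ a b c d e f → con 1 :+ (a :+ b :+ c) :+ (d :+ e :+ f) :+ con 0 :=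
                d :+ e :+ c :+ (a :+ f :+ (con 1 :+ b))) refl c t g P ℓ m)))))
      ... | inj₁ h = inj₁ (lin 0 (h ⊞ (≤-reflexive (sym m+a₂)))
          (solve 7 (λ a b c d e f g → a :+ b :+ c :+ (con 2 :* d :+ con 2 :* e :+ (f :+ (g :+ c))) :+ con 0 :=
          g :+ c :+ con 2 :* d :+ con 2 :* e :+ (f :+ (a :+ b :+ c))) refl P ℓ d (G (suc L)) g m c))
      ... | inj₂ h = inj₂ h

      -- Two steps lead from the exit at z₁ over the exit at z₂ back to the exit at z₁: the phases
      -- advance by α₁ + α₂ = d and the positions by D₁ + D₂ + d = n.
      module Around (E : TwoEnds) (B₁ : Block (TwoEnds.z₁ E)) (B₂ : Block (TwoEnds.z₂ E))
          (s₁ : Step (Block.θ B₁) (Block.P B₁))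
        (s₂ : Step (Block.θ B₁ + Step.α s₁) (Block.P B₁ + Step.D s₁ + Step.α s₁)) where

        open TwoEnds E
        open Block B₁ using () renaming (a to a₁; μ to μ₁; θ to θ₁; P to P₁; run to run₁; a-end to end₁; P-end to
            P₁-end; exit to exit₁; squares≤ to squares₁; maximal to maximal₁)
        open Block B₂ using () renaming (a to a₂; μ to μ₂; run to run₂; a-end to end₂; short to short₂; squares≤ to
            squares₂; maximal to maximal₂)
        at-z : ∀ {z x} → z < n → x ≡ z + n → x % n ≡ z
        at-z {z} z<n refl = trans ([m+n]%n≡m%n z n) (m<n⇒m%n≡m z<n)
        open Step s₁ using () renaming (D to D₁; α to α₁; 0<D to 0<D₁; D<n to D₁<n; 0<α to 0<α₁; α<d to α₁<d; again
            to again₁; exit′ to exit₂; moved to moved₁)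
        P₂ : ℕ
        P₂ = P₁ + D₁ + α₁
        P₂-end : (P₂ + ℓ) % n ≡ z₂
        P₂-end = other (m%n<n (P₂ + ℓ) n) (step-end s₁) λ e → moved₁ (%-cancel ℓ (trans e (sym (at-z z₁<n P₁-end))))
        open Step s₂ using () renaming (D to D₂; α to α₂; 0<D to 0<D₂; D<n to D₂<n; 0<α to 0<α₂; α<d to α₂<d; again
            to again₂; exit′ to exit₃; moved to moved₂)
        P₃ : ℕ
        P₃ = P₂ + D₂ + α₂
        P₃≡P₁ : P₃ % n ≡ P₁ % n
        P₃≡P₁ with (P₃ + ℓ) % n ≟ z₁
        ... | yes e = %-cancel ℓ (trans e (sym (at-z z₁<n P₁-end)))
        ... | no ne = ⊥-elim (moved₂ (%-cancel ℓ (trans (other (m%n<n (P₃ + ℓ) n) (step-end s₂) ne) (sym P₂-end))))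
        α-sum : α₁ + α₂ ≡ d
        α-sum = multiple-once (phase-shift {q} isC θ₁ (α₁ + α₂) λ t t<d → trans
            (sym (inside exit₁ t (<-≤-trans t<d d≤L))) (trans (sym (W-≡% P₃≡P₁ t))
            (trans (inside exit₃ t (<-≤-trans t<d d≤L)) (cong (λ z → u (z + t)) (+-assoc θ₁ α₁ α₂)))))
          (lin α₂ (0<α₁) (solve 2 (λ a b → con 1 :+ con 0 :+ a :+ b := a :+ b :+ (con 1 :+ con 0)) refl α₁ α₂))
              (lin 1 (α₁<d ⊞ α₂<d) (solve 3 (λ a b c → con 1 :+ (a :+ b) :+ (c :+ c) :+ con 1 := con
              2 :* c :+ (con 1 :+ a :+ (con 1 :+ b))) refl α₁ α₂ d))
        short₁ = step-short exit₁ s₁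
        short₃ = step-short exit₂ s₂
        sum : D₁ + D₂ + d ≡ n
        sum = multiple-once (%-≡⇒∣ n P₁ (D₁ + D₂ + d) (trans (cong (_% n) (sym P₃-eq)) P₃≡P₁))
            (lin (D₁ + D₂) (0<d) (solve 3 (λ a b c → con 1 :+ con 0 :+ a :+ (b :+ c) := b :+ c :+ a :+ (con 1 :+ con
            0)) refl d D₁ D₂))
            (lin 1 (short₁ ⊞ short₃ ⊞ (≤-reflexive (sym α-sum)))
                (solve 6 (λ a b c d e f → con 1 :+ (a :+ b :+ c) :+ (d :+ d :+ (e :+ f)) :+ con 1 := con
                2 :* d :+ (con 1 :+ (a :+ e) :+ (con 1 :+ (b :+ f)) :+ c)) refl D₁ D₂ d n α₁ α₂))
          where
          P₃-eq : P₃ ≡ P₁ + (D₁ + D₂ + d)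
          P₃-eq = trans (solve 5 (λ p x a y c → p :+ x :+ a :+ y :+ c := p :+ (x :+ y :+ (a :+ c))) refl P₁ D₁ α₁ D₂
              α₂) (cong (λ z → P₁ + (D₁ + D₂ + z)) α-sum)
        jump₁ : Match θ₁ (P₁ + D₁) (suc L)
        jump₁ t t< = again₁ t (<-≤-trans t<
            (lin 0 (0<α₁) (solve 2 (λ a b → con 1 :+ a :+ b :+ con 0 := a :+ b :+ (con 1 :+ con 0)) refl L α₁)))
        jump₂ : Match (θ₁ + α₁) (P₂ + D₂) (suc L)
        jump₂ t t< = again₂ t (<-≤-trans t<
            (lin 0 (0<α₂) (solve 2 (λ a b → con 1 :+ a :+ b :+ con 0 := a :+ b :+ (con 1 :+ con 0)) refl L α₂)))
        small₁ : D₁ + L < n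
        small₁ with gap noTriple 0<D₁ D₁<n (exit-Eq exit₁ jump₁)
        ... | inj₁ lt = lt
        ... | inj₂ L<D₁ = ⊥-elim (lin⊥ 1 ((proj₂ (exit-period exit₂ 0<D₂ D₂<n jump₂ ⟨lt⟩)) ⊞ L<D₁ ⊞ (≤-reflexive sum)
            ⊞ n≤2L) (solve 5 (λ a b c d e → a :+ b :+ c :+ d :+ con 2 :* e :+ (con 1 :+ con 1) := con
            1 :+ e :+ (con 1 :+ e) :+ (c :+ b :+ a) :+ d) refl d D₂ D₁ n L))
          where
          ⟨lt⟩ : D₂ + L < n
          ⟨lt⟩ = (lin d (L<D₁ ⊞ (≤-reflexive sum)) (solve 5 (λ a b c d e → con 1 :+ (a :+ b) :+ (c :+ d) :+ e :=
              d :+ (con 1 :+ b :+ (c :+ a :+ e))) refl D₂ L D₁ n d))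
        small₂ : D₂ + L < n
        small₂ with gap noTriple 0<D₂ D₂<n (exit-Eq exit₂ jump₂)
        ... | inj₁ lt = lt
        ... | inj₂ L<D₂ = ⊥-elim (lin⊥ 1 ((proj₂ (exit-period exit₁ 0<D₁ D₁<n jump₁ small₁)) ⊞ L<D₂ ⊞
            (≤-reflexive sum) ⊞ n≤2L) (solve 5 (λ a b c d e → a :+ b :+ c :+ d :+ con 2 :* e :+ (con 1 :+ con 1) :=
            con 1 :+ e :+ (con 1 :+ e) :+ (b :+ c :+ a) :+ d) refl d D₁ D₂ n L))
        R₁ = proj₁ (exit-period exit₁ 0<D₁ D₁<n jump₁ small₁)
        far₁ = proj₂ (exit-period exit₁ 0<D₁ D₁<n jump₁ small₁)
        R₂ = proj₁ (exit-period exit₂ 0<D₂ D₂<n jump₂ small₂)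
        far₂ = proj₂ (exit-period exit₂ 0<D₂ D₂<n jump₂ small₂)
        L<2d : L < 2 * d
        L<2d = (lin 0 (L<d+K ⊞ K≤d) (solve 3 (λ a b c → con 1 :+ a :+ (b :+ c :+ b) :+ con 0 := con
            2 :* b :+ (con 1 :+ a :+ c)) refl L d K))
        room′ : d + L < n
        room′ = (lin 0 (L<d+K ⊞ room) (solve 4 (λ a b c d → con 1 :+ (a :+ b) :+ (a :+ c :+ d) :+ con 0 :=
            d :+ (con 1 :+ b :+ (c :+ con 2 :* a))) refl d L K n))
        end₁′ : a₁ + (d + μ₁) ≡ P₁ + ℓ
        end₁′ = trans end₁ (sym P₁-end)
        -- The second run, moved to the period in which the exit at P₂ lies.
        ã₂ : ∃ λ a → a + (d + μ₂) ≡ P₂ + ℓ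
        ã₂ = m≤n⇒∃[o]o+m≡n (lin (D₁ + α₁ + 2 + z₁) (short₂ ⊞ L<n ⊞ (≤-reflexive (sym P₁-end)))
            (solve 9 (λ a b c d e f g h i → a :+ b :+ (c :+ d :+ (e :+ f)) :+ (g :+ h :+ con 2 :+ i) :=
            e :+ g :+ h :+ f :+ (con 1 :+ (a :+ b) :+ (con 1 :+ c) :+ (i :+ d))) refl d μ₂ L n P₁ ℓ D₁ α₁ z₁))
        end₂′ = proj₂ ã₂
        run₂′ : Run d (proj₁ ã₂) (d + μ₂)
        run₂′ = Run-≡% (%-cancel (d + μ₂) (trans (at-z z₂<n end₂) (trans (sym P₂-end) (cong (_% n) (sym end₂′)))))
            run₂
        same-d : ∀ {θ P D} → Exit θ P → Run D P L → D ≢ d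
        same-d {θ} {P} ex run refl = <-irrefl refl (no-long {θ} {P} {L} (λ t t<d → inside ex t (<-≤-trans t<d d≤L))
            run)
        -- The overlaps reach from the start of the second run to P₁ + ℓ + d, and from a₁ + n to
        -- P₂ + ℓ + d.  They are long since the K squares bound μ₁ + μ₂ from below.
        both-short : D₁ < d → D₂ < d → Goal
        both-short D₁<d D₂<d with m≤n⇒∃[o]m+o≡n (<⇒≤ D₁<d) | m≤n⇒∃[o]m+o≡n (<⇒≤ D₂<d)
        ... | g₁ , D+g₁ | g₂ , D+g₂ = join
              (run-overlap {P₁} {D₁} {α₁} {a₁} {μ₁} {proj₁ ã₂} {μ₂} {g₁} R₁ 0<D₁ D+g₁
                  (lin 0 (D₁<d ⊞ (≤-reflexive (sym D+g₁)))
                  (solve 3 (λ a b c → con 1 :+ con 0 :+ (a :+ (b :+ c)) :+ con 0 := c :+ (con 1 :+ b :+ a)) refl d D₁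
                  g₁)) short₁ 0<α₁ run₁ end₁′ run₂′ end₂′ (exit-breaks exit₁)
                (maximal₂ (lin 0 (α₁<d ⊞ (≤-reflexive ℓ+d))
                    (solve 4 (λ a b c d → con 1 :+ (a :+ b) :+ (c :+ d) :+ con 0 := d :+ (con 1 :+ b :+ (a :+ c)))
                    refl ℓ α₁ d L)) (step-run s₁)
                    (trans (cong (_% n) (solve 4 (λ p x l a → p :+ x :+ (l :+ a) := p :+ x :+ a :+ l) refl P₁ D₁ ℓ
                    α₁)) P₂-end)))
              (run-overlap {P₂} {D₂} {α₂} {proj₁ ã₂} {μ₂} {a₁ + n} {μ₁} {g₂} R₂ 0<D₂ D+g₂
                  (lin 0 (D₂<d ⊞ (≤-reflexive (sym D+g₂)))
                  (solve 3 (λ a b c → con 1 :+ con 0 :+ (a :+ (b :+ c)) :+ con 0 := c :+ (con 1 :+ b :+ a)) refl d D₂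
                  g₂)) short₃ 0<α₂ run₂′ end₂′ (Run-cong-+n run₁)
                (≤-antisym (lin 0 ((≤-reflexive end₁′) ⊞ (≤-reflexive (sym sum)) ⊞ (≤-reflexive (sym α-sum)))
                    (solve 10 (λ a b c d e f g h i j → a :+ b :+ (c :+ d) :+ (e :+ f :+ (g :+ h :+ c) :+ (i :+ j)) :+
                    con 0 := e :+ g :+ i :+ h :+ j :+ f :+ (a :+ (c :+ d) :+ b :+ c)) refl a₁ n d μ₁ P₁ ℓ D₁ D₂ α₁
                    α₂)) (lin 0 ((≤-reflexive (sym end₁′)) ⊞ (≤-reflexive sum) ⊞ (≤-reflexive α-sum))
                    (solve 10 (λ a b c d e f g h i j → a :+ b :+ c :+ d :+ e :+ f :+ (g :+ (h :+ i) :+ j :+ h) :+ con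
                    0 := g :+ j :+ (h :+ i) :+ (a :+ f :+ (b :+ d :+ h) :+ (c :+ e))) refl P₁ D₁ α₁ D₂ α₂ ℓ a₁ d μ₁
                    n))) (exit-breaks exit₂)
                (maximal₁ (lin 0 (α₂<d ⊞ (≤-reflexive ℓ+d))
                    (solve 4 (λ a b c d → con 1 :+ (a :+ b) :+ (c :+ d) :+ con 0 := d :+ (con 1 :+ b :+ (a :+ c)))
                    refl ℓ α₂ d L)) (step-run s₂)
                    (trans (cong (_% n) (solve 4 (λ p x l a → p :+ x :+ (l :+ a) := p :+ x :+ a :+ l) refl P₂ D₂ ℓ
                    α₂)) P₃-end)))
          where
          P₃-end : (P₃ + ℓ) % n ≡ z₁
          P₃-end = trans (trans (sym (%-absorb n P₃ ℓ)) (trans (cong (λ z → (z + ℓ) % n) P₃≡P₁) (%-absorb n P₁ ℓ)))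
              (at-z z₁<n P₁-end)
          join : _ → _ → Goal
          join (inj₂ h) _ = (lin (6 + 2 * D₁) (h ⊞ h ⊞ (≤-reflexive D+g₁) ⊞ (≤-reflexive D+g₁) ⊞ 2d≤n)
              (solve 6 (λ a b c d e f → con 2 :* a :+ (b :+ c :+ (b :+ c) :+ d :+ d :+ e) :+ (con 6 :+ con 2 :* f) :=
              e :+ con 4 :+ con 2 :* b :+ (con 1 :+ a :+ (con 1 :+ a) :+ (f :+ c) :+ (f :+ c) :+ con 2 :* d)) refl L
              (G (suc L)) g₁ d n D₁))
          join _ (inj₂ h) = (lin (6 + 2 * D₂) (h ⊞ h ⊞ (≤-reflexive D+g₂) ⊞ (≤-reflexive D+g₂) ⊞ 2d≤n)
              (solve 6 (λ a b c d e f → con 2 :* a :+ (b :+ c :+ (b :+ c) :+ d :+ d :+ e) :+ (con 6 :+ con 2 :* f) :=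
              e :+ con 4 :+ con 2 :* b :+ (con 1 :+ a :+ (con 1 :+ a) :+ (f :+ c) :+ (f :+ c) :+ con 2 :* d)) refl L
              (G (suc L)) g₂ d n D₂))
          join (inj₁ h₁) (inj₁ h₂) =
              (≮⇒≥ (λ h₋ → lin⊥ 11 (h₁ ⊞ h₂ ⊞ (≤-reflexive end₁′) ⊞ (≤-reflexive end₂′) ⊞ (≤-reflexive D+g₁) ⊞
              (≤-reflexive D+g₁) ⊞ (≤-reflexive D+g₂) ⊞ (≤-reflexive D+g₂) ⊞ (≤-reflexive (sym sum)) ⊞
              (≤-reflexive (sym sum)) ⊞ total ⊞ squares₁ ⊞ squares₂ ⊞ L<d+K ⊞ room′ ⊞ room′ ⊞ room′ ⊞ h₋ ⊞ h₋)
              (solve 18 (λ a b c d e f g h i j k l m o p q r s → a :+ con 2 :* b :+ con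
              2 :* c :+ (d :+ e :+ con 2 :* b :+ con 2 :* f) :+ (g :+ h) :+ (g :+ i :+ j :+ h) :+ k :+ k :+ k :+ k :+
              (i :+ l :+ k) :+ (i :+ l :+ k) :+ (m :+ o) :+ (con 1 :+ p) :+ (con 1 :+ q) :+ (k :+ r) :+ e :+ e :+ e
              :+ con 2 :* s :+ con 2 :* s :+ (con 1 :+ con 11) := g :+ h :+ k :+ (g :+ i :+ j :+ h :+ k) :+
              (d :+ (k :+ p)) :+ (a :+ (k :+ q)) :+ (i :+ c) :+ (i :+ c) :+ (l :+ f) :+ (l :+ f) :+ e :+ e :+ r :+ m
              :+ o :+ (con 1 :+ s) :+ (con 1 :+ (k :+ s)) :+ (con 1 :+ (k :+ s)) :+ (con 1 :+ (k :+ s)) :+ (con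
              1 :+ (e :+ con 4 :+ con 2 :* b)) :+ (con 1 :+ (e :+ con 4 :+ con 2 :* b))) refl (proj₁ ã₂) (G (suc L))
              g₁ a₁ n g₂ P₁ ℓ D₁ α₁ d D₂ (count (EndsAt? z₁) d) (count (EndsAt? z₂) d) μ₁ μ₂ K L)))
        first-short : D₁ < d → d ≤ D₂ → Goal
        first-short D₁<d d≤D₂ = short-goal {P₁} {D₁} {a₁} {μ₁} 0<D₁ D₁<n R₁ run₁ end₁′ D₁<d far₁
            (lin 0 ((≤-reflexive sum) ⊞ d≤D₂) (solve 4 (λ a b c d → a :+ con 2 :* b :+ (c :+ d) :+ con 0 :=
            c :+ (a :+ d :+ b :+ b)) refl D₁ d n D₂)) room′
        second-short : D₂ < d → d ≤ D₁ → Goal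
        second-short D₂<d d≤D₁ = short-goal {P₂} {D₂} {proj₁ ã₂} {μ₂} 0<D₂ D₂<n R₂ run₂′ end₂′ D₂<d far₂
            (lin 0 ((≤-reflexive sum) ⊞ d≤D₁) (solve 4 (λ a b c d → a :+ con 2 :* b :+ (c :+ d) :+ con 0 :=
            c :+ (d :+ a :+ b :+ b)) refl D₂ d n D₁)) room′
        both-long : d < D₁ → d < D₂ → Goal
        both-long d<D₁ d<D₂ with ≤-total D₁ D₂
        ... | inj₁ le = gap-goal exit₁ R₁ d<D₁ (lin 1 (le ⊞ (≤-reflexive sum) ⊞ L<2d)
            (solve 5 (λ a b c d e → a :+ con 2 :* b :+ (c :+ d :+ con 2 :* e) :+ con 1 :=
            d :+ e :+ (b :+ (b :+ c :+ e) :+ (con 1 :+ a))) refl L D₁ D₂ n d))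
        ... | inj₂ le = gap-goal exit₂ R₂ d<D₂ (lin 1 (le ⊞ (≤-reflexive sum) ⊞ L<2d)
            (solve 5 (λ a b c d e → a :+ con 2 :* b :+ (c :+ d :+ con 2 :* e) :+ con 1 :=
            d :+ e :+ (b :+ (c :+ b :+ e) :+ (con 1 :+ a))) refl L D₂ D₁ n d))
        cases : Tri (D₁ < d) (D₁ ≡ d) (d < D₁) → Tri (D₂ < d) (D₂ ≡ d) (d < D₂) → Goal
        cases (tri≈ _ e _) _ = ⊥-elim (same-d exit₁ R₁ e)
        cases _ (tri≈ _ e _) = ⊥-elim (same-d exit₂ R₂ e)
        cases (tri< x _ _) (tri< y _ _) = both-short x y
        cases (tri< x _ _) (tri> _ _ y) = first-short x (<⇒≤ y)
        cases (tri> _ _ x) (tri< y _ _) = second-short y (<⇒≤ x)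
        cases (tri> _ _ x) (tri> _ _ y) = both-long x y
        goal : Goal
        goal = cases (<-cmp D₁ d) (<-cmp D₂ d)

      corners-goal : Goal
      corners-goal = Around.goal find-ends B₁ (block (TwoEnds.z₂<n find-ends) (TwoEnds.S₂ find-ends)) s₁
          (step (Step.exit′ s₁))
        where
        B₁ = block (TwoEnds.z₁<n find-ends) (TwoEnds.S₁ find-ends)
        s₁ = step (Block.exit B₁)

  -- A level L ≥ n / 2 that is not good is preceded by at least (2 L - n - 4) / 2 good levels.
  not-good-late : ∀ L → 0 < L → L < n → n ≤ 2 * L → ¬ Good L → 2 * L ≤ n + 4 + 2 * G (suc L)
  not-good-late L 0<L L<n n≤2L ¬good with anyUpTo? (Triple? L) n
  ... | yes (σ , _ , tr) = AtLevel.triple-goal L 0<L L<n n≤2L ¬good σ tr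
  ... | no none = finally (broken-class noTriple)
    where
    open NoTriple L 0<L L<n n≤2L ¬good
    noTriple : ∀ σ → ¬ Triple L σ
    noTriple σ tr = none (σ , proj₁ tr , tr)
    finally : _ → Goal
    finally (q , q∈ , broken) with active⁻ noTriple q∈
    ... | _ , isC , d≤L , L≤T , T<L+N = by-power I refl
      where
      open BrokenClass L 0<L L<n n≤2L ¬good noTriple q isC d≤L L≤T T<L+N broken using (I; many-squares; powers-goal;
          module Corners)
      by-power : ∀ i → I ≡ i → Goal
      by-power zero e = Corners.corners-goal (many-squares (≤-trans (≤-reflexive e) z≤n))
      by-power (suc zero) e = Corners.corners-goal (many-squares (≤-reflexive e))
      by-power (suc (suc i)) e = powers-goal e

-- The count for a word that is not a proper power

applyUpTo-cong : ∀ {A : Set} {f g : ℕ → A} m → (∀ t → t < m → f t ≡ g t) → applyUpTo f m ≡ applyUpTo g m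
applyUpTo-cong zero h = refl
applyUpTo-cong (suc m) h = cong₂ _∷_ (h 0 z<s) (applyUpTo-cong m λ t t<m → h (suc t) (s≤s t<m))

applyUpTo-injective : ∀ {A : Set} {f g : ℕ → A} m → applyUpTo f m ≡ applyUpTo g m → ∀ t → t < m → f t ≡ g t
applyUpTo-injective (suc m) e zero _ = proj₁ (∷-injective e)
applyUpTo-injective (suc m) e (suc t) (s≤s t<m) = applyUpTo-injective m (proj₂ (∷-injective e)) t t<m

applyUpTo-square : ∀ {A : Set} (x : List A) {f : ℕ → A} {m} → x ++ x ≡ applyUpTo f m →
  m ≡ length x + length x × (∀ t → t < length x → f t ≡ f (t + length x))
applyUpTo-square x {f} {m} e = m≡ , λ t t<μ → applyUpTo-injective (length x) (trans (sym (proj₁ halves))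
    (proj₂ halves)) t t<μ
  where
  m≡ : m ≡ length x + length x
  m≡ = trans (sym (length-applyUpTo f m)) (trans (sym (cong length e)) (length-++ x))
  split : ∀ {A : Set} (x y : List A) (f : ℕ → A) → x ++ y ≡ applyUpTo f (length x + length y) →
          x ≡ applyUpTo f (length x) × y ≡ applyUpTo (λ t → f (t + length x)) (length y)
  split [] y f e = refl , trans e (applyUpTo-cong (length y) λ t _ → cong f (sym (+-identityʳ t)))
  split (a ∷ x) y f e with ∷-injective e
  ... | refl , e′ with split x y (λ t → f (suc t)) e′
  ... | p , r = cong (a ∷_) p , trans r (applyUpTo-cong (length y) λ t _ → cong f (sym (+-suc t (length x))))
  halves = split x x f (trans e (cong (applyUpTo f) m≡))

length-cartesianProduct : ∀ {A B : Set} (xs : List A) (ys : List B) → length (cartesianProduct xs ys) ≡ length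
    xs * length ys
length-cartesianProduct [] ys = refl
length-cartesianProduct (x ∷ xs) ys = trans (length-++ (map (x ,_) ys)) (cong₂ _+_ (length-map (x ,_) ys)
    (length-cartesianProduct xs ys))

module Count {k n : ℕ} (W : ℕ → Fin k) (0<n : 0 < n) (W-period : ∀ i → W (i + n) ≡ W i)
  (W-primitive : ∀ d → 0 < d → d < n → ¬ (∀ i → W i ≡ W (i + d))) where

  -- Squares with roots of length at most n / 2.
  module Half (b : ℕ) (b<n : b < n) (2b≤n : 2 * b ≤ n) where

    open ShortRoots W 0<n W-period W-primitive b b<n 2b≤n

    -- Let L be the last level in the upper half that is not good.  By not-good-late at most
    -- (n + 4) / 2 of the levels up to L are not good.
    notGood-bound : 2 * notGood-count n ≤ n + 4
    notGood-bound = [ from-last , from-half ]′ (greatest (λ L → (n ≤? 2 * L) ×-dec NotGood? L) n)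
      where
      from-last : (∃ λ L → L < n × (n ≤ 2 * L × 0 < L × ¬ Good L) ×
          (∀ i → L < i → i < n → ¬ (n ≤ 2 * i × 0 < i × ¬ Good i))) → 2 * notGood-count n ≤ n + 4
      from-last (L , L<n , (n≤2L , 0<L , ¬good) , max) = split (m≤n⇒∃[o]m+o≡n L<n)
        where
        split : (∃ λ r → suc L + r ≡ n) → 2 * notGood-count n ≤ n + 4
        split (r , eq) = (lin 0
            ((≤-reflexive (trans (cong notGood-count (sym eq)) (count-none NotGood? (suc L) r late))) ⊞
            (≤-reflexive (trans (cong notGood-count (sym eq)) (count-none NotGood? (suc L) r late))) ⊞
            (≤-reflexive (G-notGood L)) ⊞ (≤-reflexive (G-notGood L)) ⊞ (not-good-late L 0<L L<n n≤2L ¬good))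
            (solve 5 (λ a b c d e → con 2 :* a :+ (b :+ b :+ c :+ c :+ (d :+ con 4 :+ con 2 :* e)) :+ con 0 :=
            d :+ con 4 :+ (a :+ a :+ (b :+ e) :+ (b :+ e) :+ con 2 :* c)) refl (notGood-count n)
            (notGood-count (suc L)) L n (G (suc L))))
          where
          late : ∀ t → t < r → ¬ (0 < suc L + t × ¬ Good (suc L + t))
          late t t<r ng = max (suc L + t) (s≤s (m≤m+n L t)) (lin 0 ((≤-reflexive eq) ⊞ t<r)
              (solve 4 (λ a b c d → con 1 :+ (con 1 :+ a :+ b) :+ (c :+ d) :+ con 0 :=
              c :+ (con 1 :+ a :+ d :+ (con 1 :+ b))) refl L t n r))
              ((lin (2 + 2 * t) (n≤2L) (solve 3 (λ a b c → a :+ con 2 :* b :+ (con 2 :+ con 2 :* c) := con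
              2 :* (con 1 :+ b :+ c) :+ a) refl n L t)) , ng)
      from-half : (∀ i → i < n → ¬ (n ≤ 2 * i × 0 < i × ¬ Good i)) → 2 * notGood-count n ≤ n + 4
      from-half none = at-half ⌈ n /2⌉ ⌊ n /2⌋ (⌊n/2⌋≤⌈n/2⌉ n) (⌊n/2⌋≤⌈n/2⌉ (suc n)) (⌊n/2⌋+⌈n/2⌉≡n n)
          (⌊n/2⌋+⌈n/2⌉≡n (suc n))
        where
        at-half : ∀ c f {c′} → f ≤ c → c ≤ c′ → f + c ≡ n → c + c′ ≡ suc n → 2 * notGood-count n ≤ n + 4
        at-half c f {c′} f≤c c≤c′ e e′ =
            (lin 3 ((≤-reflexive (trans (cong notGood-count (trans (sym e) (+-comm f c)))
            (count-none NotGood? c f late))) ⊞ (≤-reflexive (trans (cong notGood-count (trans (sym e) (+-comm f c)))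
            (count-none NotGood? c f late))) ⊞ (count≤ NotGood? c) ⊞ (count≤ NotGood? c) ⊞ c≤c′ ⊞ (≤-reflexive e′))
            (solve 5 (λ a b c d e → con 2 :* a :+ (b :+ b :+ c :+ c :+ d :+ (con 1 :+ e)) :+ con 3 := e :+ con
            4 :+ (a :+ a :+ b :+ b :+ c :+ (c :+ d))) refl (notGood-count n) (notGood-count c) c c′ n))
          where
          late : ∀ t → t < f → ¬ (0 < c + t × ¬ Good (c + t))
          late t t<f ng = none (c + t) (lin 0 ((≤-reflexive e) ⊞ t<f)
              (solve 4 (λ a b c d → con 1 :+ (a :+ b) :+ (c :+ d) :+ con 0 := c :+ (d :+ a :+ (con 1 :+ b))) refl c t
              n f)) ((lin (2 * t) ((≤-reflexive (sym e)) ⊞ f≤c)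
              (solve 4 (λ a b c d → a :+ (b :+ c :+ c) :+ con 2 :* d := con 2 :* (c :+ d) :+ (a :+ b)) refl n f c t))
              , ng)

    two-letters : 1 < n → 2 ≤ windows 1
    two-letters 1<n with anyUpTo? (λ i → ¬? (Eq? 1 0 i)) n
    ... | no none = ⊥-elim (no-shift {0} {1} z<s 1<n λ t t<n → trans (sym (zeroth t t<n)) (next t t<n))
      where
      zeroth : ∀ t → t < n → W 0 ≡ W t
      zeroth t t<n = trans (decidable-stable (Eq? 1 0 t) (λ ne → none (t , t<n , ne)) 0 z<s) (cong W (+-identityʳ t))
      next : ∀ t → t < n → W 0 ≡ W (suc t)
      next t t<n = trans (zeroth (suc t % n) (m%n<n (suc t) n)) (sym (W-% (suc t)))
    ... | yes (i , i<n , ne) with least (λ j → ¬? (Eq? 1 0 j)) i ne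
    ... | j , j≤i , ne′ , min = injection-length {xs = 0 ∷ j ∷ []} _≡_ (((λ { refl → ne′ (λ _ _ → refl) }) ∷ [])
        AllPairs.∷ ([] AllPairs.∷ AllPairs.[]))
          (λ { (here refl) → 0 , ∈-sel⁺ (First? 1) 0<n (λ i ()) , refl ; (there (here refl)) → j , ∈-sel⁺ (First? 1)
              (≤-<-trans j≤i i<n) fresh , refl }) λ { _ _ refl refl → refl }
      where
      fresh : First 1 j
      fresh i′ i′<j h = ne′ (Eq-trans {i = 0} {i′} {j} (decidable-stable (Eq? 1 0 i′) (min i′ i′<j)) h)

    total-bound : 2 * total-squares ≤ 3 * n
    total-bound = go n refl
      where
      go : ∀ m → m ≡ n → 2 * total-squares ≤ 3 * n
      go zero e = ⊥-elim (<-irrefl e 0<n)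
      go (suc zero) refl = (lin 1 (total-squares≤ ⊞ total-squares≤ ⊞ (telescope 0) ⊞ (telescope 0) ⊞
          (count≤ NotGood? 1) ⊞ (count≤ NotGood? 1))
          (solve 4 (λ a b c d → con 2 :* a :+ (b :+ b :+ (c :+ d) :+ (c :+ d) :+ con 1 :+ con 1) :+ con 1 := con
          3 :+ (a :+ a :+ (b :+ c) :+ (b :+ c) :+ d :+ d)) refl total-squares (sumBelow active-count 1) (windows 1)
          (notGood-count 1)))
      go (suc (suc m)) refl = (lin 0 (total-squares≤ ⊞ total-squares≤ ⊞ (telescope (suc m)) ⊞ (telescope (suc m)) ⊞
          (count≤ (First? n) n) ⊞ (count≤ (First? n) n) ⊞ (two-letters (s≤s (s≤s z≤n))) ⊞
          (two-letters (s≤s (s≤s z≤n))) ⊞ notGood-bound)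
          (solve 6 (λ a b c d e f → con 2 :* a :+ (b :+ b :+ (c :+ d) :+ (c :+ d) :+ e :+ e :+ f :+ f :+ (e :+ con
          4)) :+ con 0 := con 3 :* e :+ (a :+ a :+ (b :+ f) :+ (b :+ f) :+ c :+ c :+ con 2 :+ con 2 :+ con 2 :* d))
          refl total-squares (sumBelow active-count n) (windows n) (notGood-count n) n (windows 1)))

  -- Squares with roots of length less than n.
  module Below (b : ℕ) (b<n : b < n) where

    open PrimitiveWord W 0<n W-period W-primitive b b<n

    -- The square word with a given code.
    spell : Class × ℕ × ℕ → List (Fin k)
    spell (p , i , j) = applyUpTo (λ t → word p (j + t)) (2 * (i * ∥ p ∥))

    all-squares : List (Class × ℕ × ℕ)
    all-squares = concatMap squares classes

    spelled : ∀ {s m} → 0 < m → m ≤ b → Run m s m → ∃ λ y → y ∈ all-squares × applyUpTo (λ t → W (s + t))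
        (2 * m) ≡ spell y
    spelled {s} {m} 0<m m≤b run = from (square-class {s} {m} 0<m m≤b run)
      where
      from : (∃ λ p → p ∈ classes × ∃ λ i → ∃ λ j → (p , i , j) ∈ squares p × m ≡ i * ∥ p ∥ ×
          (∀ t → t < 2 * m → W (s + t) ≡ word p (j + t))) →
             ∃ λ y → y ∈ all-squares × applyUpTo (λ t → W (s + t)) (2 * m) ≡ spell y
      from (p , p∈ , i , j , sq∈ , m≡ , h) = (p , i , j) , ∈-concatMap⁺ squares (Any.map (λ { refl → sq∈ }) p∈) ,
        trans (applyUpTo-cong (2 * m) h) (cong (λ z → applyUpTo (λ t → word p (j + t)) (2 * z)) m≡)

    total-below : total-squares ≤ 2 * n
    total-below = go n refl
      where
      go : ∀ m → m ≡ n → total-squares ≤ 2 * n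
      go zero e = ⊥-elim (<-irrefl e 0<n)
      go (suc m) refl = (lin (windows 1) (total-squares≤ ⊞ (telescope m) ⊞ (count≤ (First? n) n) ⊞
          (count≤ NotGood? n)) (solve 6 (λ a b c d e f → a :+ (b :+ (c :+ d) :+ e :+ e) :+ f := con
          2 :* e :+ (a :+ (b :+ f) :+ c :+ d)) refl total-squares (sumBelow active-count n) (windows n)
          (notGood-count n) n (windows 1)))

-- Cyclic words

module Cyclic {k n : ℕ} .{{_ : NonZero n}} (w : Vec (Fin k) n) where

  0<n : 0 < n
  0<n = >-nonZero⁻¹ n

  abstract
    W : ℕ → Fin k
    W i = (w ^ℤ) (int i)

    W-period : ∀ i → W (i + n) ≡ W i
    W-period i = ^ℤ-periodic w (int i)

    factor≡ : ∀ i m → factor (w ^ℤ) i m ≡ applyUpTo (λ t → W (i %ℕ n + t)) m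
    factor≡ i m = applyUpTo-cong m λ t _ → trans (cong (w ^ℤ) (trans (cong (ℤ._+ int t) (a≡a%ℕn+[a/ℕn]*n i n))
        (rearrange (int (i %ℕ n)) (i /ℕ n) (int n) (int t)))) (^ℤ-periodic-* w (int (i %ℕ n + t)) (i /ℕ n))
      where
      open ℤSolver.+-*-Solver using () renaming (solve to solveℤ; _:=_ to _:≡_; _:+_ to _⊕_; _:*_ to _⊗_)
      rearrange : ∀ r q N t → r ℤ.+ q ℤ.* N ℤ.+ t ≡ r ℤ.+ t ℤ.+ q ℤ.* N
      rearrange = solveℤ 4 (λ r q N t → r ⊕ q ⊗ N ⊕ t :≡ r ⊕ t ⊕ q ⊗ N) refl

  module P = Periodic W 0<n W-period

  -- The word u is the square of length 2 m at position s of W.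
  record SquareRun (u : Word k) : Set where
    constructor squareRun
    field
      m s     : ℕ
      0<m     : 0 < m
      2m≤n    : 2 * m ≤ n
      run     : P.Run m s m
      spelled : u ≡ applyUpTo (λ t → W (s + t)) (2 * m)

  square-run : ∀ {u} → IsCyclicSquare w u → SquareRun u
  square-run {u} ((x , x≢[] , u≡) , len , i , m , e) = from (applyUpTo-square x (trans (sym u≡) e′))
    where
    e′ : u ≡ applyUpTo (λ t → W (i %ℕ n + t)) m
    e′ = trans e (factor≡ i m)
    double : length x + length x ≡ 2 * length x
    double = solve 1 (λ y → y :+ y := con 2 :* y) refl (length x)
    positive : ∀ (x : Word k) → x ≢ [] → 0 < length x
    positive [] ne = ⊥-elim (ne refl)
    positive (a ∷ x) _ = z<s
    from : m ≡ length x + length x × (∀ t → t < length x → W (i %ℕ n + t) ≡ W (i %ℕ n + (t + length x))) → SquareRun u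
    from (m≡ , h) = squareRun (length x) (i %ℕ n) (positive x x≢[])
        (subst (_≤ n) (trans (cong length u≡) (trans (length-++ x) double)) len)
      (λ t t<μ → trans (h t t<μ) (cong W (sym (+-assoc (i %ℕ n) t (length x)))))
          (trans e′ (cong (applyUpTo (λ t → W (i %ℕ n + t))) (trans m≡ double)))

  -- The least period n₀ of W divides n, and the words of length n₀ of W are primitive.
  abstract
    Shift? : ∀ d → Dec (0 < d × P.Eq n 0 d)
    Shift? d = (0 <? d) ×-dec P.Eq? n 0 d

  abstract
    least-period : ∃ λ n₀ → n₀ ≤ n × (0 < n₀ × P.Eq n 0 n₀) × (∀ d → d < n₀ → ¬ (0 < d × P.Eq n 0 d))
    least-period = least Shift? n (0<n , P.Eq-sym {n} {n} {0} (P.Eq-+n n 0))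

  n₀ : ℕ
  n₀ = proj₁ least-period

  0<n₀ : 0 < n₀
  0<n₀ = proj₁ (proj₁ (proj₂ (proj₂ least-period)))

  W-period₀ : ∀ i → W (i + n₀) ≡ W i
  W-period₀ i = trans (cong W (+-comm i n₀))
      (sym (P.Eq-long {n} {0} {n₀} ≤-refl (proj₂ (proj₁ (proj₂ (proj₂ least-period)))) i))

  W-primitive₀ : ∀ d → 0 < d → d < n₀ → ¬ (∀ i → W i ≡ W (i + d))
  W-primitive₀ d 0<d d<n₀ h = proj₂ (proj₂ (proj₂ least-period)) d d<n₀ (0<d , λ t _ → trans (h t)
      (cong W (+-comm t d)))

  period-divides : ∀ d → 0 < d → (∀ i → W i ≡ W (i + d)) → n₀ ∣ d
  period-divides d 0<d h with fine-wilf {f = W} {m = n₀ + d} n₀ d 0<n₀ 0<d ≤-refl (λ t _ → sym (W-period₀ t))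
      (λ t _ → h t)
  ... | g , 0<g , g∣n₀ , g∣d , Pg with g <? n₀
  ... | no g≮n₀ = subst (_∣ d) (≤-antisym (∣⇒≤ {{>-nonZero 0<n₀}} g∣n₀) (≮⇒≥ g≮n₀)) g∣d
  ... | yes g<n₀ = ⊥-elim (W-primitive₀ g 0<g g<n₀ λ i → Period-extend {f = W} {M = suc (i + g)} 0<g 0<n₀ g∣n₀
      (m≤m+n n₀ d) (λ t _ → sym (W-period₀ t)) Pg i ≤-refl)

  n₀∣n : n₀ ∣ n
  n₀∣n = period-divides n 0<n (λ i → sym (W-period i))

  xs : List (Word k)
  xs = proj₁ (cyclicSquares w)

  xs-run : ∀ {u} → u ∈ xs → SquareRun u
  xs-run {u} u∈ = square-run {u} (Equivalence.to (proj₂ (proj₂ (cyclicSquares w)) u) u∈)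

  module P₀ = Periodic W 0<n₀ W-period₀

  n₀≢0 : NonZero n₀
  n₀≢0 = >-nonZero 0<n₀

  module C = Count W 0<n₀ W-period₀ W-primitive₀

  -- Not a proper power: the squares of length at most n have roots of length at most n / 2.
  primitive-bound : n₀ ≡ n → 2 * length xs ≤ 3 * n
  primitive-bound n₀≡n = ≤-trans (*-monoʳ-≤ 2 covered) (subst (λ z → 2 * length all-squares ≤ 3 * z) n₀≡n
      (C.Half.total-bound b b<n₀ 2b≤n₀))
    where
    b : ℕ
    b = ⌊ n₀ /2⌋
    2b≤n₀ : 2 * b ≤ n₀
    2b≤n₀ = (lin 0 ((≤-reflexive (⌊n/2⌋+⌈n/2⌉≡n n₀)) ⊞ (⌊n/2⌋≤⌈n/2⌉ n₀))
        (solve 3 (λ a b c → con 2 :* a :+ (b :+ c) :+ con 0 := b :+ (a :+ c :+ a)) refl b n₀ (⌈ n₀ /2⌉)))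
    n₀≤2b+1 : n₀ ≤ suc (2 * b)
    n₀≤2b+1 = (lin 0 ((≤-reflexive (sym (⌊n/2⌋+⌈n/2⌉≡n n₀))) ⊞ (⌈n/2⌉≤ n₀))
        (solve 3 (λ a b c → a :+ (b :+ c :+ (con 1 :+ b)) :+ con 0 := con 1 :+ con 2 :* b :+ (a :+ c)) refl n₀ b
        (⌈ n₀ /2⌉)))
      where
      ⌈n/2⌉≤ : ∀ x → ⌈ x /2⌉ ≤ suc ⌊ x /2⌋
      ⌈n/2⌉≤ zero = z≤n
      ⌈n/2⌉≤ (suc zero) = ≤-refl
      ⌈n/2⌉≤ (suc (suc x)) = s≤s (⌈n/2⌉≤ x)
    b<n₀ : b < n₀
    b<n₀ = (≮⇒≥ (λ h₋ → lin⊥ 0 (2b≤n₀ ⊞ 0<n₀ ⊞ h₋ ⊞ h₋)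
        (solve 2 (λ a b → a :+ a :+ (con 1 :+ b) :+ (con 1 :+ b) :+ (con 1 :+ con 0) := con
        2 :* b :+ (con 1 :+ con 0) :+ (con 1 :+ a) :+ (con 1 :+ a)) refl n₀ b)))
    open C.Below b b<n₀
    covered : length xs ≤ length all-squares
    covered = injection-length (λ u y → u ≡ spell y) (proj₁ (proj₂ (cyclicSquares w))) (λ u∈ → hit (xs-run u∈)) λ _ _
        e e′ → trans e (sym e′)
      where
      hit : ∀ {u} → SquareRun u → ∃ λ y → y ∈ all-squares × u ≡ spell y
      hit (squareRun m s 0<m 2m≤n run u≡) =
          let (y , y∈ , e) = spelled {s} {m} 0<m (≮⇒≥ (λ h₋ → lin⊥ 0 (2m≤n ⊞ (≤-reflexive (sym n₀≡n)) ⊞ n₀≤2b+1 ⊞ h₋ ⊞ h₋) (solve 4 (λ a b c d → a :+ b :+ (con 1 :+ con 2 :* c) :+ d :+ d :+ (con 1 :+ con 0) := con 2 :* d :+ a :+ b :+ (con 1 :+ c) :+ (con 1 :+ c)) refl n n₀ b m))) run in y , y∈ , trans u≡ e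

  -- A proper power: the roots shorter than n₀ give at most 2 n₀ squares, and the other roots are
  -- the powers with exponent at most n / (2 n₀) of the n₀ rotations of W[0..n₀).
  power-bound : ∀ q → n ≡ suc (suc q) * n₀ → 2 * length xs ≤ 3 * n
  power-bound q n≡ = (lin 0 ((≤-trans covered (≤-reflexive sizes)) ⊞ (≤-trans covered (≤-reflexive sizes)) ⊞
      total-below ⊞ total-below ⊞ long ⊞ short ⊞ short)
      (solve 5 (λ a b c d e → con 2 :* a :+ (b :+ c :+ (b :+ c) :+ con 2 :* d :+ con 2 :* d :+ e :+ e :+ e) :+ con 0
      := con 3 :* e :+ (a :+ a :+ b :+ b :+ con 2 :* c :+ con 2 :* d :+ con 2 :* d)) refl (length xs)
      (length all-squares) (h * n₀) n₀ n))
    where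
    b : ℕ
    b = pred n₀
    b<n₀ : b < n₀
    b<n₀ = ≤-reflexive (suc-pred n₀ {{n₀≢0}})
    open C.Below b b<n₀
    h : ℕ
    h = ⌊ suc (suc q) /2⌋
    short : 2 * n₀ ≤ n
    short = (lin (q * n₀) ((≤-reflexive (sym n≡))) (solve 3 (λ a b c → con 2 :* a :+ b :+ c := b :+ (a :+ (a :+ c)))
        refl n₀ n (q * n₀)))
    2h≤ : h + h ≤ suc (suc q)
    2h≤ = ≤-trans (+-monoʳ-≤ h (⌊n/2⌋≤⌈n/2⌉ (suc (suc q)))) (≤-reflexive (⌊n/2⌋+⌈n/2⌉≡n (suc (suc q))))
    long : 2 * (h * n₀) ≤ n
    long = subst₂ _≤_ (solve 2 (λ h x → (h :+ h) :* x := con 2 :* (h :* x)) refl h n₀) (sym n≡) (*-monoˡ-≤ n₀ 2h≤)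
    Target : Set
    Target = (P.Class × ℕ × ℕ) ⊎ (ℕ × ℕ)
    -- The code (i , s) stands for the square of the (i + 1)-st power of the rotation starting at s.
    powers : List (ℕ × ℕ)
    powers = cartesianProduct (upTo h) (upTo n₀)
    targets : List Target
    targets = map inj₁ all-squares ++ map inj₂ powers
    sizes : length targets ≡ length all-squares + h * n₀
    sizes = trans (length-++ (map inj₁ all-squares)) (cong₂ _+_ (length-map inj₁ all-squares)
        (trans (length-map inj₂ powers)
      (trans (length-cartesianProduct (upTo h) (upTo n₀)) (cong₂ _*_ (length-upTo h) (length-upTo n₀)))))
    spells : Target → Word k
    spells (inj₁ y) = spell y
    spells (inj₂ (i , s)) = applyUpTo (λ t → W (s + t)) (2 * (suc i * n₀))
    covered : length xs ≤ length targets
    covered = injection-length (λ u y → u ≡ spells y) (proj₁ (proj₂ (cyclicSquares w))) (λ u∈ → hit (xs-run u∈)) λ _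
        _ e e′ → trans e (sym e′)
      where
      hit : ∀ {u} → SquareRun u → ∃ λ y → y ∈ targets × u ≡ spells y
      hit (squareRun m s 0<m 2m≤n run u≡) = by-length (m <? n₀)
        where
        power : n₀ ∣ m → ∃ λ y → y ∈ targets × _ ≡ spells y
        power (divides zero e) = ⊥-elim (<-irrefl (sym e) 0<m)
        power (divides (suc i) e) = inj₂ (i , s % n₀) , ∈-++⁺ʳ (map inj₁ all-squares)
            (∈-map⁺ inj₂ (∈-cartesianProduct⁺ (∈-upTo⁺ i<h) (∈-upTo⁺ (m%n<n s n₀)))) ,
            trans u≡ (trans (applyUpTo-cong (2 * m) λ t _ → sym (P₀.W-%+ s t))
                (cong (λ z → applyUpTo (λ t → W (s % n₀ + t)) (2 * z)) e))
          where
          2i≤ : 2 * suc i ≤ suc (suc q)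
          2i≤ = *-cancelʳ-≤ (2 * suc i) (suc (suc q)) n₀ {{n₀≢0}}
              (subst₂ _≤_ (trans (cong (2 *_) e) (sym (*-assoc 2 (suc i) n₀))) n≡ 2m≤n)
          i<h : suc i ≤ h
          i<h = subst (_≤ h) (trans (cong ⌊_/2⌋ (solve 1 (λ x → con 2 :* x := x :+ x) refl (suc i)))
              (sym (n≡⌊n+n/2⌋ (suc i)))) (⌊n/2⌋-mono 2i≤)
        by-length : Dec (m < n₀) → ∃ λ y → y ∈ targets × _ ≡ spells y
        by-length (yes m<n₀) = let (y , y∈ , e) = spelled {s} {m} 0<m (≤-pred (≤-trans m<n₀ (≤-reflexive (sym (suc-pred n₀ {{n₀≢0}}))))) run in
          inj₁ y , ∈-++⁺ˡ (∈-map⁺ inj₁ y∈) , trans u≡ e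
        by-length (no m≮n₀) = power (period-divides m 0<m (P₀.shift-all {s} λ t → trans (P₀.Eq-long {m} {s} {s + m}
            (≮⇒≥ m≮n₀) (P₀.Run⇒Eq run) t)
          (cong W (solve 3 (λ s m t → s :+ m :+ t := s :+ t :+ m) refl s m t))))

  bound : 2 * length xs ≤ 3 * n
  bound with n₀∣n
  ... | divides zero n≡ = ⊥-elim (<-irrefl (sym n≡) 0<n)
  ... | divides (suc zero) n≡ = primitive-bound (sym (trans n≡ (+-identityʳ n₀)))
  ... | divides (suc (suc q)) n≡ = power-bound q n≡

theorem1p1 : ∀ {k n : ℕ} .{{_ : NonZero n}} (w : Vec (Fin k) n) → S° w ≤ (3 * n) / 2
theorem1p1 {n = n} w = subst (_≤ (3 * n) / 2) (m*n/n≡m (S° w) 2)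
    (/-monoˡ-≤ 2 (subst (_≤ 3 * n) (*-comm 2 (S° w)) (Cyclic.bound w)))
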